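{- Let $n$ be a positive integer and let $\Psi=A_{n-1}$ or $\Psi=B_n$. Let $f$ be the map from the set $\mathrm{NN}(\Psi)$ of nonnesting partitions of type $\Psi$ to the set $\mathrm{NC}(\Psi)$ of noncrossing partitions of type $\Psi$ defined recursively in the context. Then $f:\mathrm{NN}(\Psi)\to \mathrm{NC}(\Psi)$ is a bijection, and it preserves the triples of openers, closers and transients: $(op(f(\pi)),cl(f(\pi)),tr(f(\pi)))=(op(\pi),cl(\pi),tr(\pi))$ for every $\pi\in \mathrm{NN}(\Psi)$.
   Context: **Roots and reflections.** Let $e_1,\dots,e_n$ be the standard basis of $\mathbb{R}^n$ and $[\pm n]=\{\pm1,\dots,\pm n\}$. Type $A_{n-1}$: positive roots $\Phi^+=\{e_i-e_j: 1\le j<i\le n\}$, simple roots $r_i=e_{i+1}-e_i$ ($1\le i\le n-1$). The positive roots are the sums $r_i+\cdots+r_j$ with $1\le i\le j\le n-1$; such a root is identified with the transposition $(i\; j+1)\in\mathfrak{S}_n$. Type $B_n$: positive roots $\Phi^+=\{e_i:1\le i\le n\}\cup\{e_i\pm e_j:1\le j<i\le n\}$, simple roots $r_1=e_1$, $r_i=e_i-e_{i-1}$ ($2\le i\le n$). Then $e_i=\sum_{k=1}^i r_k$, and for $i>j$, $e_i-e_j=\sum_{k=j+1}^i r_k$ and $e_i+e_j=2\sum_{k=1}^j r_k+\sum_{k=j+1}^i r_k$. The roots $e_i$, $e_i-e_j$, $e_i+e_j$ are identified respectively with the permutations $(i,-i)$, $(i,j)(-i,-j)$, $(i,-j)(-i,j)$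 of $[\pm n]$. Products of permutations are composed from right to left, and a permutation is identified with the partition of $[n]$ (type $A$) or $[\pm n]$ (type $B$) into its cycles, fixed points being singleton blocks. **$\mathrm{NN}$ and $\mathrm{NC}$.** The root order on $\Phi^+$ is $\alpha\le\beta$ iff $\beta-\alpha$ is a nonnegative integer combination of simple roots. $\mathrm{NN}(\Psi)$ is the set of antichains of $(\Phi^+,\le)$. An antichain is also viewed as a set partition of $[n]$ (resp. $[\pm n]$): the one whose blocks are the classes of the equivalence relation generated by $x\sim y$ whenever $x,y$ are exchanged by the permutation of some root in the antichain. $\mathrm{NC}(A_{n-1})$ is the set of noncrossing partitions of $[n]$, i.e. those with no $a<b<c<d$ such that $a,c$ lie in one block and $b,d$ in another. $\mathrm{NC}(B_n)$ is the set of partitions of $[\pm n]$ that are invariant under $x\mapsto -x$ and noncrossing with respect to the linear order $1,2,\dots,n,-1,-2,\dots,-n$. (These are the usual realizations, via cycles, of the interval $[1,c]$ in the absolute order, with $c=(1\,2\cdots n)$, resp. $c=(1,\dots,n,-1,\dots,-n)$.) **Openers, closers, transients.** Type $A$: for a partition of $[n]$, $op$ is the set of least elements of blocks, $cl$ the set of greatest elements of blocks, and $tr$ the set of remaining elements of $[n]$. Type $B$: for a partition of $[\pm n]$, $op$ is the set of least elements of the blocks having only positive integers; $cl$ consists of the greatest elements of the blocks having only positive integers together with the absolute values of the least and of the greatest elements (for the usual order of integers) of the blocks having both positive and negative integers; $tr=[n]\setminus(op\cup cl)$. **Notation for roots.** For $\beta=r_i+\cdots+r_j$ (no double roots): $\mathrm{supp}(\beta)=\overline{\mathrm{supp}}(\beta)=\{r_i,\dots,r_j\}$,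 first index $i$, last index $j$. For (type $B$ only) $\alpha=2r_1+\cdots+2r_j+r_{j+1}+\cdots+r_i$, which is said to have double roots $2r_1,\dots,2r_j$: $\mathrm{supp}(\alpha)=\{2r_1,\dots,2r_j,r_{j+1},\dots,r_i\}$, $\overline{\mathrm{supp}}(\alpha)=\{r_1,\dots,r_i\}$, first index $1$, last index $i$, last double index $j$, and $D_\alpha=\{r_2,\dots,r_j\}$. If $\beta$ has no double roots and $\mathrm{supp}(\alpha)\cap\mathrm{supp}(\beta)\ne\emptyset$, then $\alpha\cup\beta$ and $\alpha\cap\beta$ are the positive roots with supports $\mathrm{supp}(\alpha)\cup(\mathrm{supp}(\beta)\setminus\overline{\mathrm{supp}}(\alpha))$ and $\overline{\mathrm{supp}}(\alpha)\cap\mathrm{supp}(\beta)$; if $\alpha$ has double roots, the d-intersection $\alpha\cap^d\beta$ is the positive root with support $D_\alpha\cap\mathrm{supp}(\beta)$. Antichains are written as tuples $(\alpha_1,\dots,\alpha_m)$ ordered by strictly increasing last index. (In type $B$ the roots having double roots then come before, or are followed only by, roots without double roots: $\alpha_1,\dots,\alpha_\ell$ have double roots and $\alpha_{\ell+1},\dots,\alpha_m$ have none, for some $0\le\ell\le m$.) An antichain is connected if $\mathrm{supp}(\alpha_i)\cap\mathrm{supp}(\alpha_{i+1})\neq\emptyset$ for all $i<m$; the connected components of an antichain are its maximal connected runs of consecutive roots. **The map $f$.** $f$ of the empty antichain is the identity; $f(\alpha_1)=\alpha_1$ for a single positive root. Let $\alpha=(\alpha_1,\dots,\alpha_m)$ be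 a connected antichain, $m\ge2$. (a) If no $\alpha_i$ has double roots, $f(\alpha)=\left(\bigcup_{k=1}^m\alpha_k\right) f(\overline\alpha_2,\dots,\overline\alpha_m)$, where $\overline\alpha_k=\alpha_{k-1}\cap\alpha_k$ (this is again an antichain, not necessarily connected). (b) Suppose $\alpha_1,\dots,\alpha_\ell$ have double roots ($\ell\ge1$) and $\alpha_{\ell+1},\dots,\alpha_m$ have none. Put $\Gamma_d=(\alpha_1,\dots,\alpha_\ell)$, $\Gamma=(\alpha_{\ell+1},\dots,\alpha_m)$. *l-links:* let $m'$ be the largest index of an element $\alpha_{m'}$ of $\Gamma$ with first index $i\ne1$ such that some element of $\Gamma_d$ has the term $2r_i$; let $\alpha_k$ be the rightmost such element of $\Gamma_d$; l-link $\alpha_k$ with $\alpha_{m'}$. Then ignore $\alpha_k$ and $\alpha_{m'}$ and repeat with the remaining roots, until no such $m'$ exists. *u-links:* call admissible the elements of $\Gamma$ whose first index is not $1$ and which are not l-linked. Let $m'$ be the smallest index of an admissible root $\alpha_{m'}$, with first index $i$, for which there is an element $\alpha_k$ to its left ($k<m'$) in $\alpha$ with $r_i$ or $2r_i$ in its support and not yet u-linked to an element on its right; take the leftmost such $\alpha_k$ and u-link $\alpha_k$ with $\alpha_{m'}$. Remove $\alpha_{m'}$ from the admissible roots and repeat until no such $m'$ exists. Let $T$ be the set consisting of all last double indices of the roots of $\Gamma_d$ that are not l-linked, and all last indices of the roots of $\alpha$ that are not u-linked to an element on their right. Define $$f(\alpha)=\pi_1\cdots\pi_\ell\,\pi_0\,\theta_1\cdots\theta_q\,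 f(\theta_{q+1},\dots,\theta_s),$$ where: for $j=1,\dots,\ell$ successively, $\pi_j=2r_1+\cdots+2r_{j'}+r_{j'+1}+\cdots+r_{j''}$ with $j'$ and $j''$ the smallest and largest elements of $T$ not yet used; $\pi_0=r_1+\cdots+r_t$, with $t$ the only element of $T$ not yet used, if $\Gamma$ is nonempty and $\alpha_{\ell+1}$ has first index $1$, and $\pi_0$ is the identity otherwise; $\theta_1,\dots,\theta_q$ are the d-intersections $\alpha_k\cap^d\alpha_{m'}$ of the l-linked pairs, listed starting from the rightmost $\alpha_k$ in $\Gamma_d$; $\theta_{q+1},\dots,\theta_s$ are the intersections $\alpha_k\cap\alpha_{m'}$ of the u-linked pairs, listed starting from the leftmost $\alpha_{m'}$ in $\Gamma$. (c) For an antichain with several connected components, $f$ is the product, from left to right, of the values of $f$ on its connected components in order. In type $A$ only (a) and (c) occur. -}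

module Defs where

import Algebra.Construct.NaturalChoice.Max as Max
import Algebra.Construct.NaturalChoice.Min as Min
import Algebra.Properties.CommutativeMonoid.Sum as Sum
open import Data.Bool.Base using (if_then_else_)
open import Data.Fin.Base as Fin using (Fin; zero; suc; toℕ; inject₁; _↑ˡ_; _↑ʳ_)
import Data.Fin.Properties as Fin
open import Data.Integer.Base as ℤ using (ℤ; +_; _◃_)
import Data.Integer.Properties as ℤ
open import Data.List.Base
  using (List; []; _∷_; [_]; _++_; map; mapMaybe; concatMap; filter; foldr; foldl; zipWith;
         head; length; reverse; unsnoc; allFin; _∷ʳ_)
import Data.List.Base as List
import Data.List.Membership.DecPropositional as DecMembership
open import Data.List.NonEmpty.Base as List⁺ using (List⁺; _∷_)
open import Data.List.Relation.Unary.All using (All)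
open import Data.List.Relation.Unary.AllPairs using (AllPairs)
open import Data.List.Relation.Unary.Any using (Any)
open import Data.Maybe.Base using (just; nothing; maybe′)
open import Data.Nat.Base as ℕ using (ℕ; zero; suc; pred)
open import Data.Nat.DivMod using (_%_; _/_; m≡m%n+[m/n]*n; m%n<n)
import Data.Nat.Properties as ℕ
open import Data.Product.Base using (_×_; _,_; Σ-syntax; ∃-syntax; proj₁; proj₂; map₁)
open import Data.Product.Properties using (≡-dec)
open import Data.Sign.Base as Sign using (Sign)
import Data.Sign.Properties as Sign
open import Data.Sum.Base using (_⊎_; inj₁; inj₂)
open import Data.Unit.Base using (⊤)
open import Data.Vec.Functional using (Vector)
open import Function.Base using (_on_)
open import Function.Bundles using (_↔_; Inverse; mk↔ₛ′)
open import Function.Construct.Composition using (_↔-∘_)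
open import Function.Construct.Identity using (↔-id)
open import Function.Definitions using (Injective)
open import Level using (0ℓ)
open import Relation.Binary.Construct.Closure.Equivalence using (EqClosure)
open import Relation.Binary.Core using (Rel; _⇔_)
open import Relation.Binary.Definitions using (DecidableEquality) renaming (Decidable to Decidable₂)
open import Relation.Binary.PropositionalEquality.Core
  using (_≡_; _≢_; refl; sym; trans; cong)
open import Relation.Binary.Structures using (IsDecEquivalence)
open import Relation.Nullary using (¬_; Dec; yes; no; does; contradiction)
open import Relation.Nullary.Decidable using (map′; _×-dec_; ¬?)
open import Relation.Unary using (Pred; _≐_)

private
  variable
    n N : ℕ
    X : Set

-- With parameter n, the series A stands for A_{n-1} and B for B_n.
data Series : Set where
  A B : Series

rank : Series → ℕ → ℕ
rank A n = pred n
rank B n = n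

-- Indices are shifted: k in Fin N stands for the simple root r_{k+1}, and the
-- element k of Fin n for the standard basis vector e_{k+1}.

-- r_i + ⋯ + r_j
record Interval (N : ℕ) : Set where
  constructor [_⋯_]
  field
    first last : Fin N

-- 2[ j ]+[ i ] is 2r_1 + ⋯ + 2r_j + r_{j+1} + ⋯ + r_i
record Double (n : ℕ) : Set where
  constructor 2[_]+[_]
  field
    lastDouble last : Fin n

-- The endpoints are unconstrained here: elements of this type denote
-- positive roots only when they satisfy IsPositive below.
data Root : Series → ℕ → Set where
  single : ∀ {Ψ n} → Interval (rank Ψ n) → Root Ψ n
  double : ∀ {n} → Double n → Root B n

private
  variable
    Ψ : Series

data IsPositive : Root Ψ n → Set where
  single : ∀ {Ψ n} {i j : Fin (rank Ψ n)} → i Fin.≤ j → IsPositive {Ψ} {n} (single [ i ⋯ j ])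
  double : ∀ {n} {j i : Fin n} → j Fin.< i → IsPositive (double 2[ j ]+[ i ])

e : Fin n → Vector ℤ n
e i x = if does (i Fin.≟ x) then ℤ.1ℤ else ℤ.0ℤ

-- All roots have integer coordinates, so they are taken in ℤⁿ.
⟦_⟧ : Root Ψ n → Vector ℤ n
⟦_⟧ {A} {suc m} (single [ i ⋯ j ])     x = e (suc j) x ℤ.- e (inject₁ i) x
⟦_⟧ {B} {n}     (single [ zero ⋯ j ])  x = e j x
⟦_⟧ {B} {n}     (single [ suc i ⋯ j ]) x = e j x ℤ.- e (inject₁ i) x
⟦_⟧ {B} {n}     (double 2[ j ]+[ i ])  x = e i x ℤ.+ e j x

simple : Fin (rank Ψ n) → Vector ℤ n
simple {Ψ} {n} k = ⟦ single {Ψ} {n} [ k ⋯ k ] ⟧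

open Sum ℤ.+-0-commutativeMonoid using (sum)

infix 4 _≼_

_≼_ : Rel (Root Ψ n) 0ℓ
_≼_ {Ψ} {n} α β =
  Σ[ c ∈ (Fin (rank Ψ n) → ℕ) ] ∀ x → ⟦ β ⟧ x ℤ.- ⟦ α ⟧ x ≡ sum λ k → + (c k) ℤ.* simple {Ψ} {n} k x

-- coeff α k is the coefficient of r_{k+1} in α.
coeff : Root Ψ n → Fin (rank Ψ n) → ℕ
coeff (single [ i ⋯ j ])    k = if does (i Fin.≤? k ×-dec k Fin.≤? j) then 1 else 0
coeff (double 2[ j ]+[ i ]) k =
  if does (k Fin.≤? j) then 2 else if does (k Fin.≤? i) then 1 else 0

lastIndex : Root Ψ n → Fin (rank Ψ n)
lastIndex (single α) = Interval.last α
lastIndex (double α) = Double.last α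

-- The supports have a common term. The terms r_k and 2r_k are different.
Meet : Rel (Root Ψ n) 0ℓ
Meet α β = ∃[ k ] coeff α k ≢ 0 × coeff α k ≡ coeff β k

meet? : Decidable₂ (Meet {Ψ} {n})
meet? α β = Fin.any? λ k → ¬? (coeff α k ℕ.≟ 0) ×-dec coeff α k ℕ.≟ coeff β k

infix 4 _≟ᴵ_ _≟ᴰ_ _≟ᴿ_

_≟ᴵ_ : DecidableEquality (Interval N)
[ i ⋯ j ] ≟ᴵ [ k ⋯ l ] =
  map′ (λ { (refl , refl) → refl }) (λ { refl → refl , refl }) (i Fin.≟ k ×-dec j Fin.≟ l)

_≟ᴰ_ : DecidableEquality (Double n)
2[ i ]+[ j ] ≟ᴰ 2[ k ]+[ l ] =
  map′ (λ { (refl , refl) → refl }) (λ { refl → refl , refl }) (i Fin.≟ k ×-dec j Fin.≟ l)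

_≟ᴿ_ : DecidableEquality (Root Ψ n)
single α ≟ᴿ single β = map′ (cong single) (λ { refl → refl }) (α ≟ᴵ β)
single α ≟ᴿ double β = no λ ()
double α ≟ᴿ single β = no λ ()
double α ≟ᴿ double β = map′ (cong double) (λ { refl → refl }) (α ≟ᴰ β)

-- The operations below produce positive roots when the supports meet:
-- the union of two intervals that share an element is an interval, and
-- intersecting intervals takes the maximum of the first and the minimum
-- of the last indices.

module _ {N : ℕ} where
  open Max (Fin.≤-totalOrder N) public using (_⊔_)
  open Min (Fin.≤-totalOrder N) public using (_⊓_)

infixl 7 _∩ᴵ_ _∩_ _∩ᵈ_
infixl 6 _∪_

_∪_ : Interval N → Interval N → Interval N
[ i ⋯ j ] ∪ [ k ⋯ l ] = [ i ⊓ k ⋯ j ⊔ l ]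

_∩ᴵ_ : Interval N → Interval N → Interval N
[ i ⋯ j ] ∩ᴵ [ k ⋯ l ] = [ i ⊔ k ⋯ j ⊓ l ]

-- In the second case the set of simple roots met by the first root,
-- with multiplicities forgotten, is {r_1, …, r_i}.
_∩_ : Root B n → Interval n → Interval n
single α            ∩ β         = α ∩ᴵ β
double 2[ _ ]+[ i ] ∩ [ k ⋯ l ] = [ k ⋯ i ⊓ l ]

-- The maximum with the index of r_2. (No double roots exist when n = 1.)
from-r₂ : Fin n → Fin n
from-r₂ {suc (suc _)} zero = suc zero
from-r₂               i    = i

-- Here {r_2, …, r_j} is intersected with {r_k, …, r_l}.
_∩ᵈ_ : Double n → Interval n → Interval n
2[ j ]+[ _ ] ∩ᵈ [ k ⋯ l ] = [ from-r₂ k ⋯ j ⊓ l ]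

Incomparable : Rel (Root Ψ n) 0ℓ
Incomparable α β = ¬ (α ≼ β) × ¬ (β ≼ α)

-- Antichains, as tuples ordered by strictly increasing last index. Roots
-- with the same last index are comparable, so every antichain is listed
-- exactly once.
record NN (Ψ : Series) (n : ℕ) : Set where
  field
    roots      : List (Root Ψ n)
    positive   : All IsPositive roots
    increasing : AllPairs (Fin._<_ on lastIndex) roots
    antichain  : AllPairs Incomparable roots

open NN public using (roots)

_≈ᴺᴺ_ : Rel (NN Ψ n) 0ℓ
_≈ᴺᴺ_ = _≡_ on roots

-- [n] in type A and [±n] in type B; k in Fin n stands for k+1.
Point : Series → ℕ → Set
Point A n = Fin n
Point B n = Sign × Fin n

_≟ᴾ_ : DecidableEquality (Point Ψ n)
_≟ᴾ_ {A} = Fin._≟_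
_≟ᴾ_ {B} = ≡-dec Sign._≟_ Fin._≟_

Perm : Set → Set
Perm X = X ↔ X

infixr 7 _·_

-- Composition from right to left.
_·_ : Perm X → Perm X → Perm X
_·_ = _↔-∘_

product : List (Perm X) → Perm X
product = foldr _·_ (↔-id _)

module _ (_≟_ : DecidableEquality X) (x y : X) where

  swap : X → X
  swap z = if does (z ≟ x) then y else if does (z ≟ y) then x else z

  swap-involutive : ∀ z → swap (swap z) ≡ z
  swap-involutive z with z ≟ x
  ... | yes refl with y ≟ x
  ...   | yes y≡x = y≡x
  ...   | no  _ with y ≟ y
  ...     | yes _ = refl
  ...     | no y≢y = contradiction refl y≢y
  swap-involutive z | no z≢x with z ≟ y
  ... | yes refl with x ≟ x
  ...   | yes _ = refl
  ...   | no x≢x = contradiction refl x≢x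
  swap-involutive z | no z≢x | no z≢y with z ≟ x
  ... | yes z≡x = contradiction z≡x z≢x
  ... | no  _ with z ≟ y
  ...   | yes z≡y = contradiction z≡y z≢y
  ...   | no  _ = refl

  transposition : Perm X
  transposition = mk↔ₛ′ swap swap swap-involutive swap-involutive

⟨_,_⟩ : Point Ψ n → Point Ψ n → Perm (Point Ψ n)
⟨_,_⟩ {Ψ} {n} = transposition (_≟ᴾ_ {Ψ} {n})

-- In type B the roots with first index 1 are e_j, and r_{i+1} + ⋯ + r_j
-- is e_j - e_i.
reflection : Root Ψ n → Perm (Point Ψ n)
reflection {A} {suc m} (single [ i ⋯ j ])     = ⟨_,_⟩ {A} (inject₁ i) (suc j)
reflection {B} {n}     (single [ zero ⋯ j ])  = ⟨_,_⟩ {B} (Sign.+ , j) (Sign.- , j)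
reflection {B} {n}     (single [ suc i ⋯ j ]) =
  ⟨_,_⟩ {B} (Sign.+ , j) (Sign.+ , inject₁ i) · ⟨_,_⟩ {B} (Sign.- , j) (Sign.- , inject₁ i)
reflection {B} {n}     (double 2[ j ]+[ i ])  =
  ⟨_,_⟩ {B} (Sign.+ , i) (Sign.- , j) · ⟨_,_⟩ {B} (Sign.- , i) (Sign.+ , j)

record Partition (X : Set) : Set₁ where
  field
    _~_              : Rel X 0ℓ
    isDecEquivalence : IsDecEquivalence _~_

-- The equivalence relation of an antichain viewed as a set partition.
nonnestingBlocks : NN Ψ n → Rel (Point Ψ n) 0ℓ
nonnestingBlocks {Ψ} {n} π = EqClosure λ x y →
  Any (λ α → Inverse.to (reflection {Ψ} {n} α) x ≡ y × Inverse.to (reflection {Ψ} {n} α) y ≡ x)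
      (roots π)

size : Series → ℕ → ℕ
size A n = n
size B n = n ℕ.+ n

-- The position in the linear order 1, …, n (type A) or
-- 1, …, n, -1, …, -n (type B).
position : Point Ψ n → Fin (size Ψ n)
position {A} {n} k            = k
position {B} {n} (Sign.+ , k) = k ↑ˡ n
position {B} {n} (Sign.- , k) = n ↑ʳ k

↑ˡ≢↑ʳ : (i j : Fin n) → i ↑ˡ n ≢ n ↑ʳ j
↑ˡ≢↑ʳ {n} i j eq with trans (sym (Fin.splitAt-↑ˡ n i n))
                              (trans (cong (Fin.splitAt n) eq) (Fin.splitAt-↑ʳ n n j))
... | ()

position-injective : Injective _≡_ _≡_ (position {Ψ} {n})
position-injective {A} eq = eq
position-injective {B} {n} {Sign.+ , i} {Sign.+ , j} eq = cong (Sign.+ ,_) (Fin.↑ˡ-injective n i j eq)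
position-injective {B} {n} {Sign.- , i} {Sign.- , j} eq = cong (Sign.- ,_) (Fin.↑ʳ-injective n i j eq)
position-injective {B} {n} {Sign.+ , i} {Sign.- , j} eq = contradiction eq (↑ˡ≢↑ʳ i j)
position-injective {B} {n} {Sign.- , i} {Sign.+ , j} eq = contradiction (sym eq) (↑ˡ≢↑ʳ j i)

-- Cycles of a permutation of a set that embeds into a finite set.
module Cycles {M : ℕ} {code : X → Fin M} (code-injective : Injective _≡_ _≡_ code)
              (σ : Perm X) where

  open Inverse σ using (to; from)

  infixr 8 _^_

  _^_ : ℕ → X → X
  zero  ^ x = x
  suc k ^ x = to (k ^ x)

  SameCycle : Rel X 0ℓ
  SameCycle x y = ∃[ k ] k ^ x ≡ y

  to-injective : ∀ {x y} → to x ≡ to y → x ≡ y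
  to-injective {x} {y} eq =
    trans (sym (Inverse.strictlyInverseʳ σ x))
          (trans (cong from eq) (Inverse.strictlyInverseʳ σ y))

  ^-injective : ∀ k {x y} → k ^ x ≡ k ^ y → x ≡ y
  ^-injective zero    eq = eq
  ^-injective (suc k) eq = ^-injective k (to-injective eq)

  ^-+ : ∀ k l x → (k ℕ.+ l) ^ x ≡ k ^ (l ^ x)
  ^-+ zero    l x = refl
  ^-+ (suc k) l x = cong to (^-+ k l x)

  period : ∀ x → ∃[ p ] suc p ^ x ≡ x
  period x
    with i , j , i<j , eq ← Fin.pigeonhole (ℕ.n<1+n M) (λ (k : Fin (suc M)) → code (toℕ k ^ x))
    with p , 1+i+p≡j ← ℕ.m≤n⇒∃[o]m+o≡n i<j
    = p , sym (^-injective (toℕ i) (trans (code-injective eq)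
          (trans (cong (_^ x) (trans (sym 1+i+p≡j) (sym (ℕ.+-suc (toℕ i) p))))
                 (^-+ (toℕ i) (suc p) x))))

  module _ {x} {p} (eq : suc p ^ x ≡ x) where

    ^-* : ∀ q → (q ℕ.* suc p) ^ x ≡ x
    ^-* zero    = refl
    ^-* (suc q) = trans (^-+ (suc p) (q ℕ.* suc p) x) (trans (cong (suc p ^_) (^-* q)) eq)

    ^-% : ∀ k → k ^ x ≡ (k % suc p) ^ x
    ^-% k = trans (cong (_^ x) (m≡m%n+[m/n]*n k (suc p)))
                  (trans (^-+ (k % suc p) (k / suc p ℕ.* suc p) x)
                         (cong ((k % suc p) ^_) (^-* (k / suc p))))

  sameCycle-sym : ∀ {x y} → SameCycle x y → SameCycle y x
  sameCycle-sym {x} {y} (k , eq) with p , per ← period x =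
    k ℕ.* p ,
    trans (cong ((k ℕ.* p) ^_) (sym eq))
          (trans (sym (^-+ (k ℕ.* p) k x))
                 (trans (cong (_^ x) (trans (ℕ.+-comm (k ℕ.* p) k) (sym (ℕ.*-suc k p))))
                        (^-* per k)))

  sameCycle? : DecidableEquality X → Decidable₂ SameCycle
  sameCycle? _≟_ x y with p , per ← period x =
    map′ (λ (k , eq) → toℕ k , eq)
         (λ (k , eq) → Fin.fromℕ< (m%n<n k (suc p)) ,
                        trans (cong (_^ x) (Fin.toℕ-fromℕ< (m%n<n k (suc p))))
                              (trans (sym (^-% per k)) eq))
         (Fin.any? λ (k : Fin (suc p)) → (toℕ k ^ x) ≟ y)

  partition : DecidableEquality X → Partition X
  partition _≟_ = record
    { _~_ = SameCycle
    ; isDecEquivalence = record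
      { isEquivalence = record
        { refl  = 0 , refl
        ; sym   = sameCycle-sym
        ; trans = λ { (k , refl) (l , eq) → l ℕ.+ k , trans (^-+ l k _) eq }
        }
      ; _≟_ = sameCycle? _≟_
      }
    }

cycles : Perm (Point Ψ n) → Partition (Point Ψ n)
cycles {Ψ} {n} σ = Cycles.partition (position-injective {Ψ} {n}) σ (_≟ᴾ_ {Ψ})

Noncrossing : Rel (Point Ψ n) 0ℓ → Set
Noncrossing {Ψ} {n} _~_ =
  ∀ {a b c d} → a < b → b < c → c < d → ¬ (a ~ c × b ~ d × ¬ (a ~ b))
  where
  _<_ : Rel (Point Ψ n) 0ℓ
  _<_ = Fin._<_ on position {Ψ}

negate : Point B n → Point B n
negate (s , k) = Sign.opposite s , k

SymmetryCondition : Rel (Point Ψ n) 0ℓ → Set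
SymmetryCondition {A}     _~_ = ⊤
SymmetryCondition {B} {n} _~_ = ∀ {x y} → x ~ y → negate {n} x ~ negate {n} y

IsNC : Partition (Point Ψ n) → Set
IsNC {Ψ} {n} π = Noncrossing {Ψ} {n} _~_ × SymmetryCondition {Ψ} {n} _~_
  where open Partition π

record NC (Ψ : Series) (n : ℕ) : Set₁ where
  constructor mkNC
  field
    partition : Partition (Point Ψ n)
    isNC      : IsNC {Ψ} {n} partition

_≈ᴺᶜ_ : Rel (NC Ψ n) 0ℓ
π ≈ᴺᶜ ρ = Partition._~_ (NC.partition π) ⇔ Partition._~_ (NC.partition ρ)

module _ (_≤_ _~_ : Rel X 0ℓ) where

  LeastInBlock GreatestInBlock : Pred X 0ℓ
  LeastInBlock    x = ∀ y → x ~ y → x ≤ y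
  GreatestInBlock x = ∀ y → x ~ y → y ≤ x

_≤±_ : Rel (Point B n) 0ℓ
_≤±_ = ℤ._≤_ on λ (s , k) → s ◃ suc (toℕ k)

AllPositive Mixed : Rel (Point B n) 0ℓ → Pred (Point B n) 0ℓ
AllPositive _~_ x = ∀ y → x ~ y → proj₁ y ≡ Sign.+
Mixed       _~_ x = (∃[ k ] x ~ (Sign.+ , k)) × (∃[ k ] x ~ (Sign.- , k))

Opener : Rel (Point Ψ n) 0ℓ → Pred (Fin n) 0ℓ
Opener {A} _~_ x = LeastInBlock Fin._≤_ _~_ x
Opener {B} _~_ x = AllPositive _~_ (Sign.+ , x) × LeastInBlock _≤±_ _~_ (Sign.+ , x)

Closer : Rel (Point Ψ n) 0ℓ → Pred (Fin n) 0ℓ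
Closer {A} _~_ x = GreatestInBlock Fin._≤_ _~_ x
Closer {B} _~_ x =
  (AllPositive _~_ (Sign.+ , x) × GreatestInBlock _≤±_ _~_ (Sign.+ , x)) ⊎
  ∃[ s ] Mixed _~_ (s , x) ×
         (LeastInBlock _≤±_ _~_ (s , x) ⊎ GreatestInBlock _≤±_ _~_ (s , x))

Transient : Rel (Point Ψ n) 0ℓ → Pred (Fin n) 0ℓ
Transient {Ψ} _~_ x = ¬ Opener {Ψ} _~_ x × ¬ Closer {Ψ} _~_ x

SameTriple : Rel (Point Ψ n) 0ℓ → Rel (Point Ψ n) 0ℓ → Set
SameTriple {Ψ} R S =
  Opener {Ψ} R ≐ Opener {Ψ} S × Closer {Ψ} R ≐ Closer {Ψ} S × Transient {Ψ} R ≐ Transient {Ψ} S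

intervals : List (Root Ψ n) → List (Interval (rank Ψ n))
intervals = mapMaybe λ { (single α) → just α ; (double _) → nothing }

doubles : List (Root B n) → List (Double n)
doubles = mapMaybe λ { (single _) → nothing ; (double α) → just α }

-- Maximal runs of consecutive elements in which neighbours are related.
components : {R : Rel X 0ℓ} → Decidable₂ R → List X → List (List⁺ X)
components R? [] = []
components R? (x ∷ xs) with components R? xs
... | []              = (x ∷ []) ∷ []
... | (y ∷ ys) ∷ runs =
  if does (R? x y) then (x ∷ y ∷ ys) ∷ runs else (x ∷ []) ∷ (y ∷ ys) ∷ runs

-- f on antichains without double roots. The recursion is on a bound on
-- the number of roots, which drops by at least one when the roots of a
-- component are replaced by the intersections of its neighbours.
fSingle : ∀ Ψ n → ℕ → List (Interval (rank Ψ n)) → Perm (Point Ψ n)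
fSingle Ψ n zero    αs = ↔-id _
fSingle Ψ n (suc b) αs =
  product (map connected (components (λ α β → meet? {Ψ} {n} (single α) (single β)) αs))
  where
  connected : List⁺ (Interval (rank Ψ n)) → Perm (Point Ψ n)
  connected (α ∷ [])     = reflection {Ψ} (single α)
  connected (α ∷ β ∷ γs) =
    reflection {Ψ} (single (List⁺.foldl₁ _∪_ (α ∷ β ∷ γs)))
      · fSingle Ψ n b (zipWith _∩ᴵ_ (α ∷ β ∷ γs) (β ∷ γs))

-- f on a connected antichain αs of type B that has double roots is value.
module Linking {n : ℕ} (αs : List (Root B n)) where

  open DecMembership (_≟ᴵ_ {n}) using () renaming (_∈?_ to _∈ᴵ?_)
  open DecMembership (_≟ᴰ_ {n}) using () renaming (_∈?_ to _∈ᴰ?_)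
  open DecMembership (_≟ᴿ_ {B} {n}) using () renaming (_∈?_ to _∈ᴿ?_)
  open DecMembership (Fin._≟_ {n}) using () renaming (_∈?_ to _∈ᶠ?_)

  Γd : List (Double n)
  Γd = doubles αs

  Γ : List (Interval n)
  Γ = intervals αs

  FirstIs1 : Pred (Interval n) 0ℓ
  FirstIs1 β = toℕ (Interval.first β) ≡ 0

  firstIs1? : ∀ β → Dec (FirstIs1 β)
  firstIs1? β = toℕ (Interval.first β) ℕ.≟ 0

  -- Linked pairs (α_k , α_m′). The choice of m′ may be made by a single
  -- traversal of Γ, since an element of Γ that cannot be linked at some
  -- stage cannot be linked later: the candidates α_k only decrease.
  lLinks : List (Double n × Interval n)
  lLinks = foldr link [] Γ
    where
    link : Interval n → List (Double n × Interval n) → List (Double n × Interval n)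
    link β L with firstIs1? β
    ... | yes _ = L
    ... | no  _ = maybe′ (λ α → (α , β) ∷ L) L (List.last (filter candidate? Γd))
      where
      candidate? = λ α → coeff {B} (double α) (Interval.first β) ℕ.≟ 2
                         ×-dec ¬? (α ∈ᴰ? map proj₁ L)

  uLinks : List (Root B n × Interval n)
  uLinks = foldl link [] (filter admissible? Γ)
    where
    admissible? = λ β → ¬? (firstIs1? β) ×-dec ¬? (β ∈ᴵ? map proj₂ lLinks)

    -- α is to the left of β in αs iff its last index is smaller.
    link : List (Root B n × Interval n) → Interval n → List (Root B n × Interval n)
    link U β = maybe′ (λ α → U ∷ʳ (α , β)) U (head (filter candidate? αs))
      where
      candidate? = λ α → lastIndex α Fin.<? Interval.last β
                         ×-dec ¬? (coeff α (Interval.first β) ℕ.≟ 0)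
                         ×-dec ¬? (α ∈ᴿ? map proj₁ U)

  -- The set T, in increasing order and without repetitions.
  T : List (Fin n)
  T = filter (_∈ᶠ? (map Double.lastDouble (filter (λ α → ¬? (α ∈ᴰ? map proj₁ lLinks)) Γd) ++
                    map lastIndex (filter (λ α → ¬? (α ∈ᴿ? map proj₁ uLinks)) αs)))
             (allFin n)

  -- The roots π_1, …, π_ℓ, and the elements of the set that remain unused.
  nest : ℕ → List (Fin n) → List (Double n) × List (Fin n)
  nest zero    ts       = [] , ts
  nest (suc ℓ) []       = [] , []
  nest (suc ℓ) (t ∷ ts) with unsnoc ts
  ... | nothing        = [] , t ∷ []
  ... | just (us , t′) = map₁ (2[ t ]+[ t′ ] ∷_) (nest ℓ us)

  πs : List (Double n)
  πs = proj₁ (nest (length Γd) T)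

  -- The empty list stands for the identity.
  π₀ : List (Interval n)
  π₀ with Γ | proj₂ (nest (length Γd) T)
  ... | β ∷ _ | t ∷ [] = if does (firstIs1? β) then [ [ Interval.first β ⋯ t ] ] else []
  ... | _     | _      = []

  -- θ_1, …, θ_q
  lIntersections : List (Interval n)
  lIntersections = concatMap
    (λ α → map (λ (α , β) → α ∩ᵈ β) (filter (λ (α′ , _) → α′ ≟ᴰ α) lLinks))
    (reverse Γd)

  -- θ_{q+1}, …, θ_s; uLinks lists the links by increasing index of α_m′.
  uIntersections : List (Interval n)
  uIntersections = map (λ (α , β) → α ∩ β) uLinks

  value : Perm (Point B n)
  value = product (map (λ α → reflection (double α)) πs)
    · product (map (λ α → reflection {B} (single α)) π₀)
    · product (map (λ α → reflection {B} (single α)) lIntersections)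
    · fSingle B n (length uIntersections) uIntersections

fConnected : List⁺ (Root B n) → Perm (Point B n)
fConnected     (α ∷ []) = reflection α
fConnected {n} (α ∷ αs) with doubles (α ∷ αs)
... | []    = fSingle B n (length (α ∷ αs)) (intervals (α ∷ αs))
... | _ ∷ _ = Linking.value (α ∷ αs)

f : List (Root Ψ n) → Perm (Point Ψ n)
f {A} {n} αs = fSingle A n (length αs) (intervals αs)
f {B}     αs = product (map fConnected (components meet? αs))

{-
A list of roots is read as a diagram of arcs, on the line 1, …, n in type A
and on the line -n, …, -1, 1, …, n in type B: e_i - e_j gives the arcs (j, i)
and (-i, -j), e_i + e_j the arcs (-j, i) and (-i, j), and e_j the arc (-j, j).
As long as every point starts at most one arc and ends at most one arc, the
arcs form paths. Then the cycles of the product of the reflections, in any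
order, are these paths, because each transposition merges two cycles, and the
closers (openers) are the points that start (end) no arc.

The permutation f(π) is the product of the reflections in a list G of roots
whose arcs start and end at the same points as those of π. This gives the
triples. The arcs of G do not cross: in (a) the union of a component encloses
the other intervals; in (b) the greedy choice of the links keeps the unused
elements of T and the other links from lying under an l-link or a u-link, and
π_1, …, π_ℓ, π_0 match the elements of T with their negatives in reverse order.

An antichain is determined by the points where its arcs start and end, as
both lists of endpoints are sorted. A noncrossing partition is determined by
its openers and closers: among two different noncrossing matchings with the
same endpoints, a disagreement at x produces one at a larger point. Finally,
the endpoints of a noncrossing partition belong to an antichain, because the
increasing injection that its arcs give makes the k-th largest starting point
smaller than the k-th largest end point.
-}

module Submission where

open import Defs
import Algebra.Construct.NaturalChoice.Max as NaturalMax
import Algebra.Construct.NaturalChoice.Min as NaturalMin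
import Algebra.Properties.CommutativeMonoid.Sum as CommutativeMonoidSum
import Algebra.Properties.Semiring.Sum as SemiringSum
open import Data.Bool.Base using (true; false; if_then_else_)
open import Data.Fin.Base as Fin using (Fin; zero; suc; toℕ; inject₁)
import Data.Fin.Properties as Fin
open import Data.Integer.Base as ℤ using (ℤ; +_)
import Data.Integer.Properties as ℤ
open import Data.Integer.Tactic.RingSolver using (solve-∀)
open import Data.List.Base as List
  using (List; []; _∷_; [_]; _++_; map; mapMaybe; concatMap; filter; foldr; foldl; zipWith;
         head; length; reverse; allFin; _∷ʳ_; _∷ʳ′_; initLast)
open import Data.List.Membership.Propositional using (_∈_; _∉_; find; lose)
import Data.List.Membership.DecPropositional as DecMembership
import Data.List.Membership.Propositional.Properties as Mem
import Data.List.Properties as List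
open import Data.List.NonEmpty.Base as List⁺ using (List⁺; _∷_)
open import Data.List.Relation.Binary.BagAndSetEquality using (∼bag⇒↭)
open import Data.List.Membership.Propositional.Properties.WithK using (unique∧set⇒bag)
open import Data.List.Relation.Binary.Permutation.Propositional as Perm
  using (_↭_; ↭-refl; ↭-sym; ↭-trans; ↭-prep; ↭-reflexive)
import Data.List.Relation.Binary.Permutation.Propositional.Properties as Perm
import Data.List.Relation.Binary.Permutation.Setoid.Properties as SetoidPerm
open import Data.List.Relation.Binary.Pointwise as Pointwise using (Pointwise; []; _∷_)
open import Data.List.Relation.Binary.Subset.Propositional using () renaming (_⊆_ to _⊆ᴸ_)
open import Data.List.Relation.Unary.All as All using (All; []; _∷_)
import Data.List.Relation.Unary.All.Properties as All
open import Data.List.Relation.Unary.AllPairs as AllPairs using (AllPairs; []; _∷_)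
import Data.List.Relation.Unary.AllPairs.Properties as AllPairs
open import Data.List.Relation.Unary.Any as Any using (Any; here; there)
import Data.List.Relation.Unary.Any.Properties as Any
open import Data.List.Relation.Unary.Linked as Linked using (Linked; []; [-]; _∷_)
open import Data.List.Relation.Unary.Unique.Propositional using (Unique)
import Data.List.Relation.Unary.Unique.Propositional.Properties as Unique
open import Data.Maybe.Base using (Maybe; just; nothing; maybe′)
open import Data.Nat.Base as ℕ using (ℕ; zero; suc; _+_; _∸_; _≤_; _<_; z≤n; s≤s; NonZero)
import Data.Nat.Properties as ℕ
open import Data.Product.Base using (_×_; _,_; Σ-syntax; ∃; ∃-syntax; proj₁; proj₂; uncurry)
open import Data.Sign.Base as Sign using (Sign)
open import Data.Sum.Base using (_⊎_; inj₁; inj₂; [_,_]′) renaming (map to ⊎-map)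
open import Data.Empty using (⊥; ⊥-elim)
open import Data.Unit.Base using (tt)
open import Function.Base using (_∘_; _on_; flip; id; case_of_)
open import Function.Bundles using (Inverse; mk⇔)
open import Function.Construct.Identity using (↔-id)
open import Function.Definitions using (Injective; Bijective)
open import Level using (0ℓ)
open import Relation.Binary.Construct.Closure.Equivalence as Eq using (EqClosure)
open import Relation.Binary.Construct.Closure.ReflexiveTransitive using (Star; ε; _◅_; _◅◅_)
open import Relation.Binary.Construct.Closure.Symmetric using (SymClosure; fwd; bwd)
open import Relation.Binary.Core using (Rel; _⇒_; _⇔_)
open import Relation.Binary.Definitions using (DecidableEquality; tri<; tri≈; tri>) renaming (Decidable to Decidable₂)
open import Relation.Binary.PropositionalEquality
  using (_≡_; _≢_; refl; sym; trans; cong; cong₂; setoid; subst; subst₂; _≗_; ≢-sym; module ≡-Reasoning)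
open import Relation.Binary.Structures using (IsEquivalence; IsDecEquivalence)
open import Relation.Nullary using (¬_; Dec; yes; no; does; contradiction)
open import Relation.Nullary.Decidable using (map′; _×-dec_; _⊎-dec_; ¬?; dec-true; dec-false; decidable-stable)
open import Relation.Unary using (Pred; Decidable; _≐_; _⊆_)

-- Two linear orders of the signed points are in play. Arcs ascend in the usual order of the
-- integers (`height`), which is the order of openers and closers, whereas noncrossing refers to 1,
-- ..., n, -1, ..., -n (`pos`). Passing from one to the other reverses exactly the arcs whose left
-- end is negative. In type B only the ends at positive points are recorded, since negation permutes
-- the arcs of a root. An antichain with ℓ double roots and ε roots of first index 1 (ε is 0 or 1)
-- then has 2ℓ + ε more upper ends than lower ends. So the parity of the surplus tells whether a
-- root with first index 1 occurs, and half of it is the number of double roots. This count stands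
-- behind the size of T, behind injectivity, and behind the construction of an antichain with
-- prescribed ends.

private
  variable
    n N M : ℕ
    X Y : Set
    Ψ : Series

-- Arc diagrams and products of transpositions

module _ (h : X → ℕ) where

  record IsArcSystem (R : Rel X 0ℓ) : Set where
    field
      increasing : ∀ {x y} → R x y → h x < h y
      functional : ∀ {x y z} → R x y → R x z → y ≡ z
      injective  : ∀ {x y z} → R x z → R y z → x ≡ y

module _ {h : X → ℕ} {R : Rel X 0ℓ} (R-arcs : IsArcSystem h R) where
  open IsArcSystem R-arcs

  private
    undo : ∀ {x y z} → Star R x y → R z y → x ≡ y ⊎ Star R x z
    undo ε z→y = inj₁ refl
    undo (x→w ◅ ε) z→y with refl ← injective x→w z→y = inj₂ ε
    undo (x→w ◅ w↠y@(_ ◅ _)) z→y with undo w↠y z→y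
    ... | inj₁ refl with refl ← injective x→w z→y = inj₂ ε
    ... | inj₂ w↠z = inj₂ (x→w ◅ w↠z)

  -- Since every point has at most one outgoing and one incoming arc, the
  -- connected pieces are paths.
  comparable : ∀ {x y} → EqClosure R x y → Star R x y ⊎ Star R y x
  comparable ε = inj₁ ε
  comparable (fwd x→z ◅ z~y) with comparable z~y
  ... | inj₁ z↠y = inj₁ (x→z ◅ z↠y)
  ... | inj₂ y↠z with undo y↠z x→z
  ...   | inj₁ refl = inj₁ (x→z ◅ ε)
  ...   | inj₂ y↠x  = inj₂ y↠x
  comparable (bwd z→x ◅ z~y) with comparable z~y
  ... | inj₁ ε = inj₂ (z→x ◅ ε)
  ... | inj₁ (z→w ◅ w↠y) with refl ← functional z→x z→w = inj₁ w↠y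
  ... | inj₂ y↠z = inj₂ (y↠z ◅◅ z→x ◅ ε)

  ascending : ∀ {x y} → Star R x y → h x ≤ h y
  ascending ε           = ℕ.≤-refl
  ascending (x→y ◅ y↠z) = ℕ.≤-trans (ℕ.<⇒≤ (increasing x→y)) (ascending y↠z)

  -- The class of `x` is a single path, and a point that starts no arc can only be the end of it.
  sink-greatest : ∀ {x} → (∀ y → ¬ R x y) → ∀ {z} → EqClosure R x z → h z ≤ h x
  sink-greatest sink x~z with comparable x~z
  ... | inj₁ ε         = ℕ.≤-refl
  ... | inj₁ (x→y ◅ _) = contradiction x→y (sink _)
  ... | inj₂ z↠x       = ascending z↠x

  private
    entered : ∀ {z x} → Star R z x → z ≡ x ⊎ ∃[ w ] R w x
    entered ε = inj₁ refl
    entered (z→w ◅ w↠x) with entered w↠x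
    ... | inj₁ refl = inj₂ (_ , z→w)
    ... | inj₂ p    = inj₂ p

  source-least : ∀ {x} → (∀ y → ¬ R y x) → ∀ {z} → EqClosure R x z → h x ≤ h z
  source-least source x~z with comparable x~z
  ... | inj₁ x↠z = ascending x↠z
  ... | inj₂ z↠x with entered z↠x
  ...   | inj₁ refl      = ℕ.≤-refl
  ...   | inj₂ (_ , y→x) = contradiction y→x (source _)

record ArcList (h : X → ℕ) (L : List (X × X)) : Set where
  field
    increasing  : All (λ (x , y) → h x < h y) L
    uniqueLeft  : Unique (map proj₁ L)
    uniqueRight : Unique (map proj₂ L)

Arc : List (X × X) → Rel X 0ℓ
Arc L x y = (x , y) ∈ L

unique-map⇒injective : {f : X → Y} {xs : List X} → Unique (map f xs) →
                       ∀ {x y} → x ∈ xs → y ∈ xs → f x ≡ f y → x ≡ y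
unique-map⇒injective (_ ∷ u) (here refl) (here refl) eq = refl
unique-map⇒injective (p ∷ _) (here refl) (there y∈)  eq =
  contradiction eq (All.lookup p (Mem.∈-map⁺ _ y∈))
unique-map⇒injective (p ∷ _) (there x∈)  (here refl) eq =
  contradiction (sym eq) (All.lookup p (Mem.∈-map⁺ _ x∈))
unique-map⇒injective (_ ∷ u) (there x∈)  (there y∈)  eq = unique-map⇒injective u x∈ y∈ eq

arcSystem : {h : X → ℕ} {L : List (X × X)} → ArcList h L → IsArcSystem h (Arc L)
arcSystem {L = L} arcs = record
  { increasing = All.lookup increasing
  ; functional = λ p q → cong proj₂ (unique-map⇒injective uniqueLeft p q refl)
  ; injective  = λ p q → cong proj₁ (unique-map⇒injective uniqueRight p q refl)
  }
  where open ArcList arcs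

transpositions : DecidableEquality X → List (X × X) → Perm X
transpositions _≟_ L = product (map (λ (x , y) → transposition _≟_ x y) L)

swap-left : (_≟_ : DecidableEquality X) (x y : X) → swap _≟_ x y x ≡ y
swap-left _≟_ x y rewrite dec-true (x ≟ x) refl = refl

swap-other : (_≟_ : DecidableEquality X) {x y z : X} → z ≢ x → z ≢ y → swap _≟_ x y z ≡ z
swap-other _≟_ {x} {y} {z} z≢x z≢y
  rewrite dec-false (z ≟ x) z≢x | dec-false (z ≟ y) z≢y = refl

data SwapView {X : Set} (x y z : X) : X → Set where
  left  : z ≡ x → SwapView x y z y
  right : z ≡ y → SwapView x y z x
  other : z ≢ x → z ≢ y → SwapView x y z z

swapView : (_≟_ : DecidableEquality X) (x y z : X) → SwapView x y z (swap _≟_ x y z)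
swapView _≟_ x y z with z ≟ x
... | yes p = left p
... | no  p with z ≟ y
...   | yes q = right q
...   | no  q = other p q

module _ {code : X → Fin M} (code-injective : Injective _≡_ _≡_ code) (_≟_ : DecidableEquality X) where

  open Cycles code-injective using (SameCycle)

  sameCycle-isEquivalence : (σ : Perm X) → IsEquivalence (SameCycle σ)
  sameCycle-isEquivalence σ =
    IsDecEquivalence.isEquivalence (Partition.isDecEquivalence (Cycles.partition code-injective σ _≟_))

  sameCycle-step : (σ : Perm X) → ∀ z → SameCycle σ z (Inverse.to σ z)
  sameCycle-step σ z = 1 , refl

  sameCycle⇒ : (σ : Perm X) {R : Rel X 0ℓ} → IsEquivalence R →
               (∀ z → R z (Inverse.to σ z)) → SameCycle σ ⇒ R
  sameCycle⇒ σ {R} R-equiv step (k , refl) = go k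
    where
    open IsEquivalence R-equiv renaming (refl to ≈-refl; trans to ≈-trans)
    go : ∀ {x} k → R x (Cycles._^_ code-injective σ k x)
    go zero    = ≈-refl
    go (suc k) = ≈-trans (go k) (step _)

  -- Multiplying by (x y) merges the cycles of x and y when they differ:
  -- from x the new permutation follows g until it would return to x, and
  -- then moves to y.
  module _ (g : Perm X) {x y : X} (x≁y : ¬ SameCycle g x y) where

    private
      σ : Perm X
      σ = transposition _≟_ x y · g

      open Inverse g using (to)
      open Cycles code-injective g using (_^_; period)
      open Cycles code-injective σ using () renaming (_^_ to _^σ_)
      module σ = IsEquivalence (sameCycle-isEquivalence σ)

      follow : ∀ k → (k ^σ x ≡ k ^ x) ⊎ SameCycle σ x y
      follow zero = inj₁ refl
      follow (suc k) with follow k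
      ... | inj₂ x~y = inj₂ x~y
      ... | inj₁ eq with to (k ^ x) ≟ x | to (k ^ x) ≟ y
      ...   | yes q | _     = inj₂ (suc k , trans (cong (swap _≟_ x y ∘ to) eq)
                                            (trans (cong (swap _≟_ x y) q) (swap-left _≟_ x y)))
      ...   | no p  | yes q = contradiction (suc k , q) x≁y
      ...   | no p  | no q  = inj₁ (trans (cong (swap _≟_ x y ∘ to) eq) (swap-other _≟_ p q))

    merged : SameCycle σ x y
    merged with p , per ← period x with follow p
    ... | inj₂ x~y = x~y
    ... | inj₁ eq  = suc p , trans (cong (swap _≟_ x y ∘ to) eq)
                            (trans (cong (swap _≟_ x y) per) (swap-left _≟_ x y))

    unmerged : SameCycle g ⇒ SameCycle σ
    unmerged = sameCycle⇒ g (sameCycle-isEquivalence σ) step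
      where
      step : ∀ z → SameCycle σ z (to z)
      step z = aux (swapView _≟_ x y (to z)) refl
        where
        aux : ∀ {w} → SwapView x y (to z) w → w ≡ Inverse.to σ z → SameCycle σ z (to z)
        aux (left  eq)  w≡ = σ.trans (1 , sym w≡) (σ.trans (σ.sym merged) (0 , sym eq))
        aux (right eq)  w≡ = σ.trans (1 , sym w≡) (σ.trans merged (0 , sym eq))
        aux (other _ _) w≡ = 1 , sym w≡

  -- Induction on the list. No arc of `L` starts at `x`, so `x` is a sink there and the greatest
  -- point of its cycle. Since `h x < h y`, the point `y` lies in another cycle, and the new
  -- transposition merges the two.
  cycles-of-transpositions : {h : X → ℕ} (L : List (X × X)) → ArcList h L →
                             SameCycle (transpositions _≟_ L) ⇔ EqClosure (Arc L)
  cycles-of-transpositions [] arcs =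
    sameCycle⇒ (↔-id _) (Eq.isEquivalence _) (λ _ → ε) ,
    Eq.fold (sameCycle-isEquivalence (↔-id _)) λ ()
  cycles-of-transpositions {h} ((x , y) ∷ L) arcs = to , from
    where
    open ArcList arcs
    tail-arcs : ArcList h L
    tail-arcs = record
      { increasing  = All.tail increasing
      ; uniqueLeft  = AllPairs.tail uniqueLeft
      ; uniqueRight = AllPairs.tail uniqueRight
      }
    g σ : Perm X
    g = transpositions _≟_ L
    σ = transpositions _≟_ ((x , y) ∷ L)
    module E = IsEquivalence (Eq.isEquivalence (Arc ((x , y) ∷ L)))

    ih : SameCycle g ⇔ EqClosure (Arc L)
    ih = cycles-of-transpositions L tail-arcs

    x≁y : ¬ SameCycle g x y
    x≁y x~y = ℕ.<⇒≱ (All.head increasing)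
      (sink-greatest (arcSystem tail-arcs)
        (λ z x→z → All.lookup (AllPairs.head uniqueLeft) (Mem.∈-map⁺ proj₁ x→z) refl)
        (proj₁ ih x~y))

    xy : EqClosure (Arc ((x , y) ∷ L)) x y
    xy = Eq.return (here refl)

    to : SameCycle σ ⇒ EqClosure (Arc ((x , y) ∷ L))
    to = sameCycle⇒ σ (Eq.isEquivalence _) λ z →
      E.trans (Eq.map there (proj₁ ih (sameCycle-step g z)))
              (aux (swapView _≟_ x y (Inverse.to g z)))
      where
      aux : ∀ {z w} → SwapView x y z w → EqClosure (Arc ((x , y) ∷ L)) z w
      aux (left refl)  = xy
      aux (right refl) = E.sym xy
      aux (other _ _)  = E.refl

    from : EqClosure (Arc ((x , y) ∷ L)) ⇒ SameCycle σ
    from = Eq.fold (sameCycle-isEquivalence σ) λ where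
      (here refl) → merged g x≁y
      (there p)   → unmerged g x≁y (proj₂ ih (Eq.return p))

  sameCycle-cong : (σ τ : Perm X) → Inverse.to σ ≗ Inverse.to τ → SameCycle σ ⇔ SameCycle τ
  sameCycle-cong σ τ eq =
    sameCycle⇒ σ (sameCycle-isEquivalence τ) (λ z → 1 , sym (eq z)) ,
    sameCycle⇒ τ (sameCycle-isEquivalence σ) (λ z → 1 , eq z)

-- Noncrossing partitions

module _ {pos : X → ℕ} (pos-injective : Injective _≡_ _≡_ pos) {R : Rel X 0ℓ}
         (uncrossed : ∀ {p q r s} → pos p < pos q → pos q < pos r → pos r < pos s →
                      SymClosure R p r → ¬ SymClosure R q s) where

  private
    _~_ : Rel X 0ℓ
    _~_ = EqClosure R

    module ~ = IsEquivalence (Eq.isEquivalence R)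

    edge-sym : ∀ {u v} → SymClosure R u v → SymClosure R v u
    edge-sym (fwd r) = bwd r
    edge-sym (bwd r) = fwd r

    Inside : X → X → X → Set
    Inside u v z = pos u < pos z × pos z < pos v

    inside? : ∀ u v → Decidable (Inside u v)
    inside? u v z = (pos u ℕ.<? pos z) ×-dec (pos z ℕ.<? pos v)

    exit : {P : X → Set} → Decidable P → ∀ {x y} → x ~ y → P x → ¬ P y →
           ∃[ u ] ∃[ v ] x ~ u × SymClosure R u v × P u × ¬ P v
    exit P? ε p ¬p = contradiction p ¬p
    exit P? {x} (_◅_ {j = z} x-z z~y) p ¬p with P? z
    ... | no ¬q = x , z , ~.refl , x-z , p , ¬q
    ... | yes q with u , v , z~u , rest ← exit P? z~y q ¬p = u , v , x-z ◅ z~u , rest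

    -- The path from `w` leaves the interval between `u` and `v` along some edge. That edge crosses
    -- `u-v` unless it ends at `u` or `v`, and in that case `w` is joined to `u`.
    trapped : ∀ {u v w z} → SymClosure R u v → Inside u v w → ¬ Inside u v z →
              w ~ z → ¬ w ~ u → ⊥
    trapped {u} {v} u-v w-in z-out w~z w≁u
      with w′ , z′ , w~w′ , w′-z′ , (u<w′ , w′<v) , z′-out ← exit (inside? u v) w~z w-in z-out
      with ℕ.<-cmp (pos z′) (pos u)
    ... | tri< z′<u _ _ = uncrossed z′<u u<w′ w′<v (edge-sym w′-z′) u-v
    ... | tri≈ _ eq _   = w≁u (~.trans w~w′ (w′-z′ ◅ ~.reflexive (pos-injective eq)))
    ... | tri> _ _ u<z′ with ℕ.<-cmp (pos z′) (pos v)
    ...   | tri< z′<v _ _ = z′-out (u<z′ , z′<v)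
    ...   | tri≈ _ eq _   = w≁u (~.trans w~w′ (w′-z′ ◅ ~.trans (~.reflexive (pos-injective eq))
                                                                (edge-sym u-v ◅ ε)))
    ...   | tri> _ _ v<z′ = uncrossed u<w′ w′<v v<z′ u-v w′-z′

  -- A path from `c` to `a` leaves the interval between `b` and `d` along an edge `u-v`. If `v` is
  -- `b` or `d`, this joins `a` to `b`. Otherwise the edge separates `b` from `d`, and `trapped`
  -- applies to the path between them.
  closure-noncrossing : ∀ {a b c d} → pos a < pos b → pos b < pos c → pos c < pos d →
                        ¬ (a ~ c × b ~ d × ¬ a ~ b)
  closure-noncrossing {a} {b} {c} {d} a<b b<c c<d (a~c , b~d , a≁b)
    with u , v , c~u , u-v , (b<u , u<d) , v-out ←
         exit (inside? b d) (~.sym a~c) (b<c , c<d) (λ (b<a , _) → ℕ.<-asym a<b b<a)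
    with ℕ.<-cmp (pos v) (pos b)
  ... | tri< v<b _ _ = trapped (edge-sym u-v) (v<b , b<u) (λ (_ , d<u) → ℕ.<-asym u<d d<u) b~d
                         (λ b~v → a≁b (~.trans a~c (~.trans c~u (u-v ◅ ~.sym b~v))))
  ... | tri≈ _ eq _  = a≁b (~.trans a~c (~.trans c~u (u-v ◅ ~.reflexive (pos-injective eq))))
  ... | tri> _ _ b<v with ℕ.<-cmp (pos v) (pos d)
  ...   | tri< v<d _ _ = v-out (b<v , v<d)
  ...   | tri≈ _ eq _  = a≁b (~.trans a~c (~.trans c~u (u-v ◅
                           ~.trans (~.reflexive (pos-injective eq)) (~.sym b~d))))
  ...   | tri> _ _ d<v = trapped u-v (u<d , d<v) (λ (u<b , _) → ℕ.<-asym u<b b<u) (~.sym b~d)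
                           (λ d~u → a≁b (~.trans a~c (~.trans c~u
                             (~.trans (~.sym d~u) (~.sym b~d)))))

-- Arcs between consecutive elements of a block

Searchable : Set → Set₁
Searchable X = {P : X → Set} → Decidable P → Dec (∃ P)

module Adjacency {h : X → ℕ} (h-injective : Injective _≡_ _≡_ h) (any? : Searchable X)
                 {_~_ : Rel X 0ℓ} (~-equiv : IsDecEquivalence _~_) where

  open IsDecEquivalence ~-equiv using () renaming (isEquivalence to ~-isEquivalence; _≟_ to _~?_)
  private module ~ = IsEquivalence ~-isEquivalence

  Between : X → X → X → Set
  Between x y z = x ~ z × h x < h z × h z < h y

  -- The arc diagram of a set partition, in which each element is joined to the next higher one of
  -- its block. It turns an arbitrary partition back into an arc system.
  Adjacent : Rel X 0ℓ
  Adjacent x y = h x < h y × x ~ y × ∀ z → ¬ Between x y z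

  between? : ∀ x y → Dec (∃ (Between x y))
  between? x y = any? λ z → (x ~? z) ×-dec ((h x ℕ.<? h z) ×-dec (h z ℕ.<? h y))

  adjacent-arcs : IsArcSystem h Adjacent
  adjacent-arcs = record
    { increasing = proj₁
    ; functional = λ {x} {y} {z} → functional′ {x} {y} {z}
    ; injective  = λ {x} {y} {z} → injective′ {x} {y} {z}
    }
    where
    functional′ : ∀ {x y z} → Adjacent x y → Adjacent x z → y ≡ z
    functional′ {x} {y} {z} (x<y , x~y , gap) (x<z , x~z , gap′) with ℕ.<-cmp (h y) (h z)
    ... | tri< y<z _ _ = contradiction (x~y , x<y , y<z) (gap′ y)
    ... | tri≈ _ eq _  = h-injective eq
    ... | tri> _ _ z<y = contradiction (x~z , x<z , z<y) (gap z)
    injective′ : ∀ {x y z} → Adjacent x z → Adjacent y z → x ≡ y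
    injective′ {x} {y} {z} (x<z , x~z , gap) (y<z , y~z , gap′) with ℕ.<-cmp (h x) (h y)
    ... | tri< x<y _ _ = contradiction (~.trans x~z (~.sym y~z) , x<y , y<z) (gap y)
    ... | tri≈ _ eq _  = h-injective eq
    ... | tri> _ _ y<x = contradiction (~.trans y~z (~.sym x~z) , y<x , x<z) (gap′ x)

  successor : ∀ {x y} → x ~ y → h x < h y → ∃ (Adjacent x)
  successor {x} x~y x<y = go _ x~y x<y ℕ.≤-refl
    where
    go : ∀ k {y} → x ~ y → h x < h y → h y ≤ k → ∃ (Adjacent x)
    go zero    x~y x<y y≤k = contradiction (ℕ.<-≤-trans x<y y≤k) λ ()
    go (suc k) {y} x~y x<y y≤k with between? x y
    ... | yes (z , x~z , x<z , z<y) = go k x~z x<z (ℕ.s≤s⁻¹ (ℕ.≤-trans z<y y≤k))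
    ... | no gap = y , x<y , x~y , λ z b → gap (z , b)

  predecessor : ∀ {x y} → x ~ y → h x < h y → ∃[ z ] Adjacent z y
  predecessor {x} {y} x~y x<y = go (h y) x~y x<y (ℕ.m≤m+n (h y) (h x))
    where
    go : ∀ k {x} → x ~ y → h x < h y → h y ≤ k + h x → ∃[ z ] Adjacent z y
    go zero    x~y x<y y≤k = contradiction y≤k (ℕ.<⇒≱ x<y)
    go (suc k) {x} x~y x<y y≤k with between? x y
    ... | yes (z , x~z , x<z , z<y) =
      go k (~.trans (~.sym x~z) x~y) z<y
         (ℕ.≤-trans y≤k (ℕ.≤-trans (ℕ.≤-reflexive (sym (ℕ.+-suc k (h x)))) (ℕ.+-monoʳ-≤ k x<z)))
    ... | no gap = x , x<y , x~y , λ z b → gap (z , b)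

  generated : _~_ ⇔ EqClosure Adjacent
  generated = to , Eq.fold ~-isEquivalence (λ (_ , x~y , _) → x~y)
    where
    -- `k` bounds `h y - h x`, which drops when `x` moves to its successor.
    go : ∀ k {x y} → x ~ y → h x < h y → h y ≤ k + h x → EqClosure Adjacent x y
    go zero    x~y x<y y≤k = contradiction y≤k (ℕ.<⇒≱ x<y)
    go (suc k) {x} {y} x~y x<y y≤k with z , adj@(x<z , x~z , gap) ← successor x~y x<y
      with ℕ.<-cmp (h z) (h y)
    ... | tri< z<y _ _ =
      fwd adj ◅ go k (~.trans (~.sym x~z) x~y) z<y
        (ℕ.≤-trans y≤k (ℕ.≤-trans (ℕ.≤-reflexive (sym (ℕ.+-suc k (h x)))) (ℕ.+-monoʳ-≤ k x<z)))
    ... | tri≈ _ eq _  = Eq.return (subst (Adjacent x) (h-injective eq) adj)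
    ... | tri> _ _ y<z = contradiction (x~y , x<y , y<z) (gap y)

    to : _~_ ⇒ EqClosure Adjacent
    to {x} {y} x~y with ℕ.<-cmp (h x) (h y)
    ... | tri< x<y _ _ = go (h y) x~y x<y (ℕ.m≤m+n (h y) (h x))
    ... | tri≈ _ eq _  = IsEquivalence.reflexive (Eq.isEquivalence Adjacent) (h-injective eq)
    ... | tri> _ _ y<x = Eq.symmetric Adjacent (go (h x) (~.sym x~y) y<x (ℕ.m≤m+n (h x) (h y)))

-- In type B the unmatched points of B are the ones joined to negative
-- points, so no arc may pass over them.
record IsMatching (h : X → ℕ) (B : Pred X 0ℓ) (P : Rel X 0ℓ) : Set where
  field
    isArcSystem : IsArcSystem h P
    target      : ∀ {x y} → P x y → B y
    uncrossed   : ∀ {x y z w} → P x y → P z w → h x < h z → h z < h y → ¬ h y < h w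
    covered     : ∀ {x y b} → P x y → B b → h x < h b → h b < h y → ∃[ z ] P z b
  open IsArcSystem isArcSystem public

module _ {h : X → ℕ} (h-injective : Injective _≡_ _≡_ h) {B : Pred X 0ℓ} where

  private
    -- If x is matched with y and z and y < z, then y is matched with some w
    -- between x and y, and w is another disagreement.
    agree : {P Q : Rel X 0ℓ} → IsMatching h B P → IsMatching h B Q →
            (∀ {x} → ∃ (Q x) → ∃ (P x)) →
            ∀ k {x y z} → P x y → Q x z → h y ≤ k + h x → ¬ h y < h z
    agree P-m Q-m Q⇒P zero xPy xQz y≤k y<z = contradiction y≤k (ℕ.<⇒≱ (IsMatching.increasing P-m xPy))
    agree {P} {Q} P-m Q-m Q⇒P (suc k) {x} {y} {z} xPy xQz y≤k y<z
      with w , wQy ← IsMatching.covered Q-m xQz (IsMatching.target P-m xPy)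
                                        (IsMatching.increasing P-m xPy) y<z
      with ℕ.<-cmp (h w) (h x)
    ... | tri< w<x _ _ =
      IsMatching.uncrossed Q-m wQy xQz w<x (IsMatching.increasing P-m xPy) y<z
    ... | tri≈ _ eq _ =
      ℕ.<⇒≢ y<z (cong h (IsMatching.functional Q-m (subst (λ v → Q v y) (h-injective eq) wQy) xQz))
    ... | tri> _ _ x<w with v , wPv ← Q⇒P (y , wQy) with ℕ.<-cmp (h v) (h y)
    ...   | tri< v<y _ _ = agree P-m Q-m Q⇒P k wPv wQy
            (ℕ.≤-trans (ℕ.<⇒≤ v<y) (ℕ.≤-trans y≤k
              (ℕ.≤-trans (ℕ.≤-reflexive (sym (ℕ.+-suc k (h x)))) (ℕ.+-monoʳ-≤ k x<w)))) v<y
    ...   | tri≈ _ eq _  =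
      ℕ.<⇒≢ x<w (cong h (IsMatching.injective P-m xPy (subst (P w) (h-injective eq) wPv)))
    ...   | tri> _ _ y<v = IsMatching.uncrossed P-m xPy wPv x<w (IsMatching.increasing Q-m wQy) y<v

  matching-unique : {P Q : Rel X 0ℓ} → IsMatching h B P → IsMatching h B Q →
                    (∀ {x} → ∃ (Q x) → ∃ (P x)) → (∀ {x} → ∃ (P x) → ∃ (Q x)) → P ⇒ Q
  matching-unique {P} {Q} P-m Q-m Q⇒P P⇒Q {x} {y} xPy with z , xQz ← P⇒Q (y , xPy)
    with ℕ.<-cmp (h y) (h z)
  ... | tri< y<z _ _ = contradiction y<z (agree P-m Q-m Q⇒P (h y) xPy xQz (ℕ.m≤m+n _ _))
  ... | tri≈ _ eq _  = subst (Q x) (sym (h-injective eq)) xQz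
  ... | tri> _ _ z<y = contradiction z<y (agree Q-m P-m P⇒Q (h z) xQz xPy (ℕ.m≤m+n _ _))

-- Roots as arcs

-- In type B this is the rank in -n, ..., -1, 1, ..., n, counted from 0: the point -1 has height
-- `n ∸ 1` and the point 1 has height `n`.
height : Point Ψ n → ℕ
height {A}     k            = toℕ k
height {B} {n} (Sign.+ , k) = n + toℕ k
height {B} {n} (Sign.- , k) = n ∸ suc (toℕ k)

negative-below : (k l : Fin n) → height {B} (Sign.- , k) < height {B} {n} (Sign.+ , l)
negative-below {n} k l =
  ℕ.<-≤-trans (ℕ.∸-monoʳ-< {o = 0} (s≤s z≤n) (Fin.toℕ<n k)) (ℕ.m≤m+n n (toℕ l))

height-injective : Injective _≡_ _≡_ (height {Ψ} {n})
height-injective {A} eq = Fin.toℕ-injective eq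
height-injective {B} {n} {Sign.+ , k} {Sign.+ , l} eq =
  cong (Sign.+ ,_) (Fin.toℕ-injective (ℕ.+-cancelˡ-≡ n _ _ eq))
height-injective {B} {n} {Sign.- , k} {Sign.- , l} eq =
  cong (Sign.- ,_) (Fin.toℕ-injective (ℕ.suc-injective
    (ℕ.∸-cancelˡ-≡ (Fin.toℕ<n k) (Fin.toℕ<n l) eq)))
height-injective {B} {n} {Sign.+ , k} {Sign.- , l} eq = contradiction (sym eq) (ℕ.<⇒≢ (negative-below l k))
height-injective {B} {n} {Sign.- , k} {Sign.+ , l} eq = contradiction eq (ℕ.<⇒≢ (negative-below k l))

≤±⇒height : {x y : Point B n} → x ≤± y → height {B} x ≤ height {B} y
≤±⇒height {n} {Sign.+ , k} {Sign.+ , l} (ℤ.+≤+ (s≤s k≤l)) = ℕ.+-monoʳ-≤ n k≤l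
≤±⇒height {n} {Sign.- , k} {Sign.+ , l} _            = ℕ.<⇒≤ (negative-below k l)
≤±⇒height {n} {Sign.- , k} {Sign.- , l} (ℤ.-≤- l≤k)  = ℕ.∸-monoʳ-≤ n (s≤s l≤k)

height⇒≤± : {x y : Point B n} → height {B} x ≤ height {B} y → x ≤± y
height⇒≤± {n} {Sign.+ , k} {Sign.+ , l} p = ℤ.+≤+ (s≤s (ℕ.+-cancelˡ-≤ n _ _ p))
height⇒≤± {n} {Sign.- , k} {Sign.+ , l} p = ℤ.-≤+
height⇒≤± {n} {Sign.+ , k} {Sign.- , l} p = contradiction p (ℕ.<⇒≱ (negative-below l k))
height⇒≤± {n} {Sign.- , k} {Sign.- , l} p = ℤ.-≤- (ℕ.≮⇒≥ λ k<l → ℕ.<⇒≱ (ℕ.∸-monoʳ-< (s≤s k<l) (Fin.toℕ<n l)) p)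

negate-≤± : {x y : Point B n} → x ≤± y → negate y ≤± negate x
negate-≤± {n} {Sign.+ , k} {Sign.+ , l} (ℤ.+≤+ (s≤s k≤l)) = ℤ.-≤- k≤l
negate-≤± {n} {Sign.- , k} {Sign.+ , l} _                 = ℤ.-≤+
negate-≤± {n} {Sign.- , k} {Sign.- , l} (ℤ.-≤- l≤k)       = ℤ.+≤+ (s≤s l≤k)

point : Fin n → Point Ψ n
point {Ψ = A} k = k
point {Ψ = B} k = Sign.+ , k

-- Closers and openers in a form common to both types: only the block of the positive point `x` is
-- inspected, whatever signs occur in it.
Greatest Least : Rel (Point Ψ n) 0ℓ → Pred (Fin n) 0ℓ
Greatest {Ψ} _~_ x = ∀ y → point {Ψ = Ψ} x ~ y → height {Ψ} y ≤ height {Ψ} (point {Ψ = Ψ} x)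
Least    {Ψ} _~_ x = ∀ y → point {Ψ = Ψ} x ~ y → height {Ψ} (point {Ψ = Ψ} x) ≤ height {Ψ} y

opener⇒least : {R : Rel (Point Ψ n) 0ℓ} → Opener {Ψ} R ⊆ Least {Ψ} R
opener⇒least {A} p       = p
opener⇒least {B} (_ , p) = λ y x~y → ≤±⇒height {x = point _} {y} (p y x~y)

-- A negative element of the block would lie below `x`, so leastness already forces the block to be
-- positive.
least⇒opener : {R : Rel (Point Ψ n) 0ℓ} → Least {Ψ} R ⊆ Opener {Ψ} R
least⇒opener {A} p = p
least⇒opener {B} {R = _~_} {x} p = positive , λ y x~y → height⇒≤± {x = point x} {y} (p y x~y)
  where
  positive : AllPositive _~_ (Sign.+ , x)
  positive (Sign.+ , k) _   = refl
  positive (Sign.- , k) x~y = contradiction (p (Sign.- , k) x~y) (ℕ.<⇒≱ (negative-below k x))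

-- The least element of a mixed block is negative and the greatest is positive. If -x is the least
-- one, negation carries the block to that of `x` and makes `x` its greatest element.
closer⇒greatest : {R : Rel (Point Ψ n) 0ℓ} → SymmetryCondition {Ψ} R → Closer {Ψ} R ⊆ Greatest {Ψ} R
closer⇒greatest {A} _ p = p
closer⇒greatest {B} symm {x} (inj₁ (_ , p)) y x~y = ≤±⇒height {x = y} {point x} (p y x~y)
closer⇒greatest {B} symm {x} (inj₂ (Sign.+ , _ , inj₂ p)) y x~y = ≤±⇒height {x = y} {point x} (p y x~y)
closer⇒greatest {B} symm {x} (inj₂ (Sign.+ , (_ , (_ , x~l)) , inj₁ p)) with () ← p _ x~l
closer⇒greatest {B} symm {x} (inj₂ (Sign.- , ((_ , x~k) , _) , inj₂ p)) with () ← p _ x~k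
closer⇒greatest {B} symm {x} (inj₂ (Sign.- , _ , inj₁ p)) y x~y =
  ≤±⇒height {x = y} {point x}
    (subst (_≤± point x) (negate-involutive y) (negate-≤± {x = Sign.- , x} {negate y} (p (negate y) (symm x~y))))
  where
  negate-involutive : (y : Point B _) → negate (negate y) ≡ y
  negate-involutive (Sign.+ , _) = refl
  negate-involutive (Sign.- , _) = refl

greatest⇒closer : {R : Rel (Point Ψ n) 0ℓ} → IsDecEquivalence R → Greatest {Ψ} R ⊆ Closer {Ψ} R
greatest⇒closer {A} R-equiv p = p
greatest⇒closer {B} {R = _~_} R-equiv {x} p with Fin.any? (λ k → IsDecEquivalence._≟_ R-equiv (Sign.+ , x) (Sign.- , k))
... | yes (k , x~-k) = inj₂ (Sign.+ , ((x , IsDecEquivalence.refl R-equiv) , (k , x~-k)) ,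
                             inj₂ λ y x~y → height⇒≤± {x = y} {point x} (p y x~y))
... | no  ¬neg = inj₁ (positive , λ y x~y → height⇒≤± {x = y} {point x} (p y x~y))
  where
  positive : AllPositive _~_ (Sign.+ , x)
  positive (Sign.+ , k) _   = refl
  positive (Sign.- , k) x~y = contradiction (k , x~y) ¬neg

-- Arcs go upwards in the usual order of the integers; the root e_j is the
-- arc from -j to j.
arcs : Root Ψ n → List (Point Ψ n × Point Ψ n)
arcs {A} {suc m} (single [ i ⋯ j ])     = (inject₁ i , suc j) ∷ []
arcs {B}         (single [ zero ⋯ j ])  = ((Sign.- , j) , (Sign.+ , j)) ∷ []
arcs {B}         (single [ suc i ⋯ j ]) =
  ((Sign.+ , inject₁ i) , (Sign.+ , j)) ∷ ((Sign.- , j) , (Sign.- , inject₁ i)) ∷ []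
arcs {B}         (double 2[ j ]+[ i ])  =
  ((Sign.- , j) , (Sign.+ , i)) ∷ ((Sign.- , i) , (Sign.+ , j)) ∷ []

-- In type B these are the positive points that start, respectively end, an arc of the root. The
-- negative left ends are the negatives of the upper ends, and the negative right ends those of the
-- lower ends. The root e_j, whose arc runs from -j to j, therefore has no lower end.
lowerEnds upperEnds : Root Ψ n → List (Fin n)
lowerEnds {A} {suc m} (single [ i ⋯ j ])     = inject₁ i ∷ []
lowerEnds {B}         (single [ zero ⋯ j ])  = []
lowerEnds {B}         (single [ suc i ⋯ j ]) = inject₁ i ∷ []
lowerEnds {B}         (double _)             = []
upperEnds {A} {suc m} (single [ i ⋯ j ])     = suc j ∷ []
upperEnds {B}         (single [ i ⋯ j ])     = j ∷ []
upperEnds {B}         (double 2[ j ]+[ i ])  = j ∷ i ∷ []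

allArcs : List (Root Ψ n) → List (Point Ψ n × Point Ψ n)
allArcs = concatMap arcs

lowers uppers : List (Root Ψ n) → List (Fin n)
lowers {Ψ} = concatMap (lowerEnds {Ψ})
uppers {Ψ} = concatMap (upperEnds {Ψ})

swap-comm : (_≟_ : DecidableEquality X) (x y z : X) → swap _≟_ x y z ≡ swap _≟_ y x z
swap-comm _≟_ x y z with z ≟ x | z ≟ y
... | yes refl | yes refl = refl
... | yes _    | no  _    = refl
... | no  _    | yes _    = refl
... | no  _    | no  _    = refl

reflection-arcs : (α : Root Ψ n) → Inverse.to (reflection α) ≗ Inverse.to (transpositions (_≟ᴾ_ {Ψ}) (arcs α))
reflection-arcs {A} {suc m} (single [ i ⋯ j ])     z = refl
reflection-arcs {B} {n}     (single [ zero ⋯ j ])  z = swap-comm (_≟ᴾ_ {B} {n}) (Sign.+ , j) (Sign.- , j) z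
reflection-arcs {B} {n}     (single [ suc i ⋯ j ]) z = swap-comm (_≟ᴾ_ {B} {n}) (Sign.+ , j) (Sign.+ , inject₁ i)
  (swap (_≟ᴾ_ {B} {n}) (Sign.- , j) (Sign.- , inject₁ i) z)
reflection-arcs {B} {n}     (double 2[ j ]+[ i ])  z = swap-comm (_≟ᴾ_ {B} {n}) (Sign.+ , i) (Sign.- , j)
  (swap (_≟ᴾ_ {B} {n}) (Sign.- , i) (Sign.+ , j) z)

product-++ : (σs τs : List (Perm X)) →
             Inverse.to (product (σs ++ τs)) ≗ Inverse.to (product σs · product τs)
product-++ []       τs z = refl
product-++ (σ ∷ σs) τs z = cong (Inverse.to σ) (product-++ σs τs z)

product-arcs : (G : List (Root Ψ n)) → Inverse.to (product (map reflection G))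
                                     ≗ Inverse.to (transpositions (_≟ᴾ_ {Ψ}) (allArcs G))
product-arcs []      z = refl
product-arcs {Ψ} (α ∷ G) z = begin
  Inverse.to (reflection α) (Inverse.to (product (map reflection G)) z)
    ≡⟨ reflection-arcs α _ ⟩
  Inverse.to (product (map t (arcs α))) (Inverse.to (product (map reflection G)) z)
    ≡⟨ cong (Inverse.to (product (map t (arcs α)))) (product-arcs G z) ⟩
  Inverse.to (product (map t (arcs α)) · product (map t (allArcs G))) z
    ≡⟨ product-++ (map t (arcs α)) (map t (allArcs G)) z ⟨
  Inverse.to (product (map t (arcs α) ++ map t (allArcs G))) z
    ≡⟨ cong (λ σs → Inverse.to (product σs) z) (List.map-++ t (arcs α) (allArcs G)) ⟨
  Inverse.to (product (map t (arcs α ++ allArcs G))) z ∎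
  where
  open ≡-Reasoning
  t = λ (x , y) → transposition (_≟ᴾ_ {Ψ}) x y

++-interchange : (as bs cs ds : List X) → (as ++ bs) ++ (cs ++ ds) ↭ (as ++ cs) ++ (bs ++ ds)
++-interchange as bs cs ds = begin
  (as ++ bs) ++ (cs ++ ds) ≡⟨ List.++-assoc as bs (cs ++ ds) ⟩
  as ++ (bs ++ (cs ++ ds)) ↭⟨ Perm.++⁺ˡ as (Perm.shifts bs cs) ⟩
  as ++ (cs ++ (bs ++ ds)) ≡⟨ List.++-assoc as cs (bs ++ ds) ⟨
  (as ++ cs) ++ (bs ++ ds) ∎
  where open Perm.PermutationReasoning

minuses pluses : List (Fin n) → List (Point B n)
minuses = map (Sign.- ,_)
pluses  = map (Sign.+ ,_)

leftEnds rightEnds : (G : List (Root B n)) → List (Point B n)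
leftEnds  G = pluses (lowers G) ++ minuses (uppers G)
rightEnds G = pluses (uppers G) ++ minuses (lowers G)

private
  collect : {f : Root B n → List (Point B n × Point B n)} {g : Point B n × Point B n → Point B n}
            {l u : Root B n → List (Fin n)} →
            (∀ α → map g (f α) ↭ pluses (l α) ++ minuses (u α)) → (G : List (Root B n)) →
            map g (concatMap f G) ↭ pluses (concatMap l G) ++ minuses (concatMap u G)
  collect eq [] = ↭-refl
  collect {f = f} {g} {l} {u} eq (α ∷ G) = begin
    map g (f α ++ concatMap f G)
      ≡⟨ List.map-++ g (f α) _ ⟩
    map g (f α) ++ map g (concatMap f G)
      ↭⟨ Perm.++⁺ (eq α) (collect eq G) ⟩
    (pluses (l α) ++ minuses (u α)) ++ (pluses (concatMap l G) ++ minuses (concatMap u G))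
      ↭⟨ ++-interchange (pluses (l α)) (minuses (u α)) _ _ ⟩
    (pluses (l α) ++ pluses (concatMap l G)) ++ (minuses (u α) ++ minuses (concatMap u G))
      ≡⟨ cong₂ _++_ (List.map-++ (Sign.+ ,_) (l α) _) (List.map-++ (Sign.- ,_) (u α) _) ⟨
    pluses (l α ++ concatMap l G) ++ minuses (u α ++ concatMap u G) ∎
    where open Perm.PermutationReasoning

leftEnds-arcs : (G : List (Root B n)) → map proj₁ (allArcs G) ↭ leftEnds G
leftEnds-arcs = collect λ where
  (single [ zero ⋯ j ])  → ↭-refl
  (single [ suc i ⋯ j ]) → ↭-refl
  (double 2[ j ]+[ i ])  → ↭-refl

rightEnds-arcs : (G : List (Root B n)) → map proj₂ (allArcs G) ↭ rightEnds G
rightEnds-arcs = collect λ where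
  (single [ zero ⋯ j ])  → ↭-refl
  (single [ suc i ⋯ j ]) → ↭-refl
  (double 2[ j ]+[ i ])  → Perm.swap _ _ ↭-refl

leftEnds-arcsᴬ : (G : List (Root A n)) → map proj₁ (allArcs G) ≡ lowers {A} G
leftEnds-arcsᴬ [] = refl
leftEnds-arcsᴬ {suc m} (single _ ∷ G) = cong (_ ∷_) (leftEnds-arcsᴬ G)

rightEnds-arcsᴬ : (G : List (Root A n)) → map proj₂ (allArcs G) ≡ uppers {A} G
rightEnds-arcsᴬ [] = refl
rightEnds-arcsᴬ {suc m} (single _ ∷ G) = cong (_ ∷_) (rightEnds-arcsᴬ G)

↭-unique : {xs ys : List X} → xs ↭ ys → Unique xs → Unique ys
↭-unique xs↭ys = SetoidPerm.Unique-resp-↭ (setoid _) (Perm.↭⇒↭ₛ xs↭ys)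

signed-unique : {xs ys : List (Fin n)} → Unique xs → Unique ys → Unique (pluses xs ++ minuses ys)
signed-unique u v =
  Unique.++⁺ (Unique.map⁺ (λ { refl → refl }) u) (Unique.map⁺ (λ { refl → refl }) v) λ (p , q) →
    case Mem.∈-map⁻ _ p , Mem.∈-map⁻ _ q of λ { ((_ , _ , refl) , (_ , _ , ())) }

leftEnd⇔lower : (G : List (Root Ψ n)) (x : Fin n) →
                (point {Ψ = Ψ} x ∈ map proj₁ (allArcs G) → x ∈ lowers {Ψ} G) ×
                (x ∈ lowers {Ψ} G → point {Ψ = Ψ} x ∈ map proj₁ (allArcs G))
leftEnd⇔lower {A} G x = subst (x ∈_) (leftEnds-arcsᴬ G) , subst (x ∈_) (sym (leftEnds-arcsᴬ G))
leftEnd⇔lower {B} G x =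
  (λ p → case Mem.∈-++⁻ (pluses (lowers G)) (Perm.∈-resp-↭ (leftEnds-arcs G) p) of λ where
    (inj₁ q) → case Mem.∈-map⁻ _ q of λ { (_ , r , refl) → r }
    (inj₂ q) → case Mem.∈-map⁻ _ q of λ { (_ , _ , ()) }) ,
  (λ p → Perm.∈-resp-↭ (↭-sym (leftEnds-arcs G)) (Mem.∈-++⁺ˡ (Mem.∈-map⁺ _ p)))

rightEnd⇔upper : (G : List (Root Ψ n)) (x : Fin n) →
                 (point {Ψ = Ψ} x ∈ map proj₂ (allArcs G) → x ∈ uppers {Ψ} G) ×
                 (x ∈ uppers {Ψ} G → point {Ψ = Ψ} x ∈ map proj₂ (allArcs G))
rightEnd⇔upper {A} G x = subst (x ∈_) (rightEnds-arcsᴬ G) , subst (x ∈_) (sym (rightEnds-arcsᴬ G))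
rightEnd⇔upper {B} G x =
  (λ p → case Mem.∈-++⁻ (pluses (uppers G)) (Perm.∈-resp-↭ (rightEnds-arcs G) p) of λ where
    (inj₁ q) → case Mem.∈-map⁻ _ q of λ { (_ , r , refl) → r }
    (inj₂ q) → case Mem.∈-map⁻ _ q of λ { (_ , _ , ()) }) ,
  (λ p → Perm.∈-resp-↭ (↭-sym (rightEnds-arcs G)) (Mem.∈-++⁺ˡ (Mem.∈-map⁺ _ p)))

arcs-increasing : {α : Root Ψ n} → IsPositive α → All (λ (x , y) → height {Ψ} x < height {Ψ} y) (arcs α)
arcs-increasing {A} {suc m} (single {i = i} i≤j) = s≤s (subst (_≤ _) (sym (Fin.toℕ-inject₁ i)) i≤j) ∷ []
arcs-increasing {B} (single {i = zero} {j} i≤j) = negative-below j j ∷ []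
arcs-increasing {B} {n} (single {i = suc i} {j} i<j) =
  ℕ.+-monoʳ-< n i<j′ ∷ ℕ.∸-monoʳ-< (s≤s i<j′) (Fin.toℕ<n j) ∷ []
  where
  i<j′ : toℕ (inject₁ i) < toℕ j
  i<j′ = subst (_< toℕ j) (sym (Fin.toℕ-inject₁ i)) i<j
arcs-increasing {B} (double {j = j} {i} _) = negative-below j i ∷ negative-below i j ∷ []

-- Enough for an arc system: positivity makes the arcs ascend, and distinct ends at positive points
-- give, by negation, distinct ends at negative ones.
record IsDiagram (G : List (Root Ψ n)) : Set where
  field
    positive     : All IsPositive G
    uniqueLowers : Unique (lowers {Ψ} G)
    uniqueUppers : Unique (uppers {Ψ} G)

diagram-arcs : {G : List (Root Ψ n)} → IsDiagram G → ArcList (height {Ψ}) (allArcs G)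
diagram-arcs {Ψ} {n} {G} d = record
  { increasing  = All.concat⁺ (All.map⁺ (All.map arcs-increasing positive))
  ; uniqueLeft  = lefts {Ψ} G uniqueLowers uniqueUppers
  ; uniqueRight = rights {Ψ} G uniqueLowers uniqueUppers
  }
  where
  open IsDiagram d
  lefts : ∀ {Ψ} (G : List (Root Ψ n)) → Unique (lowers {Ψ} G) → Unique (uppers {Ψ} G) →
         Unique (map proj₁ (allArcs G))
  lefts {A} G u v = subst Unique (sym (leftEnds-arcsᴬ G)) u
  lefts {B} G u v = ↭-unique (↭-sym (leftEnds-arcs G)) (signed-unique u v)
  rights : ∀ {Ψ} (G : List (Root Ψ n)) → Unique (lowers {Ψ} G) → Unique (uppers {Ψ} G) →
          Unique (map proj₂ (allArcs G))
  rights {A} G u v = subst Unique (sym (rightEnds-arcsᴬ G)) v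
  rights {B} G u v = ↭-unique (↭-sym (rightEnds-arcs G)) (signed-unique v u)

module _ {G : List (Root Ψ n)} (d : IsDiagram G) where

  private
    arcsys : IsArcSystem (height {Ψ}) (Arc (allArcs G))
    arcsys = arcSystem (diagram-arcs d)

  module _ {R : Rel (Point Ψ n) 0ℓ} (R⇔ : R ⇔ EqClosure (Arc (allArcs G))) where

    -- An arc that starts at `x` leads to a higher element of its block; conversely, without such an
    -- arc `x` is the end of its path. The two lemmas on `Least` are the mirror image.
    greatest⇒∉lowers : ∀ {x} → Greatest {Ψ} R x → x ∉ lowers {Ψ} G
    greatest⇒∉lowers {x} g x∈ with (_ , y) , a , refl ← Mem.∈-map⁻ proj₁ (proj₂ (leftEnd⇔lower {Ψ} G x) x∈) =
      ℕ.<⇒≱ (IsArcSystem.increasing arcsys a) (g y (proj₂ R⇔ (Eq.return a)))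

    ∉lowers⇒greatest : ∀ {x} → x ∉ lowers {Ψ} G → Greatest {Ψ} R x
    ∉lowers⇒greatest {x} x∉ y x~y =
      sink-greatest arcsys (λ z a → x∉ (proj₁ (leftEnd⇔lower {Ψ} G x) (Mem.∈-map⁺ proj₁ a))) (proj₁ R⇔ x~y)

    least⇒∉uppers : ∀ {x} → Least {Ψ} R x → x ∉ uppers {Ψ} G
    least⇒∉uppers {x} l x∈ with (y , _) , a , refl ← Mem.∈-map⁻ proj₂ (proj₂ (rightEnd⇔upper {Ψ} G x) x∈) =
      ℕ.<⇒≱ (IsArcSystem.increasing arcsys a) (l y (proj₂ R⇔ (Eq.symmetric _ (Eq.return a))))

    ∉uppers⇒least : ∀ {x} → x ∉ uppers {Ψ} G → Least {Ψ} R x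
    ∉uppers⇒least {x} x∉ y x~y =
      source-least arcsys (λ z a → x∉ (proj₁ (rightEnd⇔upper {Ψ} G x) (Mem.∈-map⁺ proj₂ a))) (proj₁ R⇔ x~y)

open CommutativeMonoidSum ℤ.+-0-commutativeMonoid using (sum; sum-cong-≗; ∑-distrib-+; ∑-comm)
open SemiringSum ℤ.+-*-semiring using (*-distribˡ-sum)

-- The root order

-- Incomparability in terms of indices, for positive roots of which the first has the smaller last
-- index. A root without double roots lies below every double root with a larger last index, so no
-- constructor puts it in front of one.
data Before : Rel (Root Ψ n) 0ℓ where
  single-single : ∀ {Ψ n} {i j k l : Fin (rank Ψ n)} → i Fin.< k → j Fin.< l →
            Before {Ψ} {n} (single [ i ⋯ j ]) (single [ k ⋯ l ])
  double-double : ∀ {n} {j i l k : Fin n} → l Fin.< j → i Fin.< k →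
            Before (double 2[ j ]+[ i ]) (double 2[ l ]+[ k ])
  double-single : ∀ {n} {j i k l : Fin n} → i Fin.< l → Before (double 2[ j ]+[ i ]) (single [ k ⋯ l ])

before⇒last< : {α β : Root Ψ n} → Before α β → lastIndex α Fin.< lastIndex β
before⇒last< (single-single _ j<l) = j<l
before⇒last< (double-double _ i<k) = i<k
before⇒last< (double-single i<l) = i<l

sum-0 : ∀ n → sum {n} (λ _ → + 0) ≡ + 0
sum-0 zero    = refl
sum-0 (suc n) = trans (ℤ.+-identityˡ _) (sum-0 n)

sum-e : (w : Fin n → ℤ) (j : Fin n) → sum (λ x → w x ℤ.* e j x) ≡ w j
sum-e {suc n} w zero = begin
  w zero ℤ.* + 1 ℤ.+ sum (λ x → w (suc x) ℤ.* + 0)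
    ≡⟨ cong₂ ℤ._+_ (ℤ.*-identityʳ (w zero))
         (trans (sum-cong-≗ (λ x → ℤ.*-zeroʳ (w (suc x)))) (sum-0 n)) ⟩
  w zero ℤ.+ + 0
    ≡⟨ ℤ.+-identityʳ (w zero) ⟩
  w zero ∎
  where open ≡-Reasoning
sum-e {suc n} w (suc j) = begin
  w zero ℤ.* + 0 ℤ.+ sum (λ x → w (suc x) ℤ.* e j x)
    ≡⟨ cong₂ ℤ._+_ (ℤ.*-zeroʳ (w zero)) (sum-e (w ∘ suc) j) ⟩
  + 0 ℤ.+ w (suc j)
    ≡⟨ ℤ.+-identityˡ _ ⟩
  w (suc j) ∎
  where open ≡-Reasoning

-- α ≼ β is Nonneg (⟦ β ⟧ - ⟦ α ⟧).
Nonneg : (Ψ : Series) (n : ℕ) → (Fin n → ℤ) → Set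
Nonneg Ψ n v = Σ[ c ∈ (Fin (rank Ψ n) → ℕ) ] ∀ x → v x ≡ sum λ k → + (c k) ℤ.* simple {Ψ} {n} k x

nonneg-≗ : {u v : Fin n → ℤ} → u ≗ v → Nonneg Ψ n v → Nonneg Ψ n u
nonneg-≗ eq (c , p) = c , λ x → trans (eq x) (p x)

nonneg-+ : {u v : Fin n → ℤ} → Nonneg Ψ n u → Nonneg Ψ n v → Nonneg Ψ n (λ x → u x ℤ.+ v x)
nonneg-+ {n} {Ψ} (c , p) (d , q) = (λ k → c k + d k) , λ x → begin
  _ ≡⟨ cong₂ ℤ._+_ (p x) (q x) ⟩
  sum (λ k → + (c k) ℤ.* s k x) ℤ.+ sum (λ k → + (d k) ℤ.* s k x)
    ≡⟨ ∑-distrib-+ (λ k → + (c k) ℤ.* s k x) (λ k → + (d k) ℤ.* s k x) ⟨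
  sum (λ k → + (c k) ℤ.* s k x ℤ.+ + (d k) ℤ.* s k x)
    ≡⟨ sum-cong-≗ (λ k → trans (sym (ℤ.*-distribʳ-+ (s k x) (+ (c k)) (+ (d k))))
                               (cong (ℤ._* s k x) (sym (ℤ.pos-+ (c k) (d k))))) ⟩
  sum (λ k → + (c k + d k) ℤ.* s k x) ∎
  where
  open ≡-Reasoning
  s = simple {Ψ} {n}

nonneg-0 : Nonneg Ψ n (λ _ → + 0)
nonneg-0 {Ψ} {n} = (λ _ → 0) , λ x →
  sym (trans (sum-cong-≗ λ k → ℤ.*-zeroˡ (simple {Ψ} {n} k x)) (sum-0 (rank Ψ n)))

nonneg-simple : (j : Fin (rank Ψ n)) → Nonneg Ψ n (simple {Ψ} {n} j)
nonneg-simple {Ψ} {n} j = (λ k → if does (j Fin.≟ k) then 1 else 0) , λ x → sym (begin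
  sum (λ k → + (if does (j Fin.≟ k) then 1 else 0) ℤ.* s k x)
    ≡⟨ sum-cong-≗ (λ k → trans (cong (ℤ._* s k x) (pos-if (does (j Fin.≟ k)))) (ℤ.*-comm (e j k) (s k x))) ⟩
  sum (λ k → s k x ℤ.* e j k)
    ≡⟨ sum-e (λ k → s k x) j ⟩
  s j x ∎)
  where
  open ≡-Reasoning
  s = simple {Ψ} {n}
  pos-if : ∀ b → + (if b then 1 else 0) ≡ (if b then ℤ.1ℤ else ℤ.0ℤ)
  pos-if true  = refl
  pos-if false = refl

simpleDifference : ∀ Ψ {m} (k : Fin m) → Nonneg Ψ (suc m) (λ x → e (suc k) x ℤ.- e (inject₁ k) x)
simpleDifference A k = nonneg-simple {A} k
simpleDifference B k = nonneg-simple {B} (suc k)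

-- Telescoping: consecutive basis vectors differ by a simple root.
nonneg-difference : ∀ {n} {a b : Fin n} → a Fin.≤ b → Nonneg Ψ n (λ x → e b x ℤ.- e a x)
nonneg-difference {Ψ} {n} {a} {b} a≤b = go (toℕ b ∸ toℕ a) b (sym (ℕ.m∸n+n≡m a≤b))
  where
  regroup : ∀ p q r → p ℤ.- r ≡ (p ℤ.- q) ℤ.+ (q ℤ.- r)
  regroup = solve-∀
  go : ∀ {n} {a : Fin n} d b → toℕ b ≡ d + toℕ a → Nonneg Ψ n (λ x → e b x ℤ.- e a x)
  go {a = a} zero b eq with refl ← Fin.toℕ-injective eq = nonneg-≗ {Ψ = Ψ} (λ x → ℤ.+-inverseʳ (e a x)) (nonneg-0 {Ψ})
  go {a = a} (suc d) (suc b) eq = nonneg-≗ {Ψ = Ψ} (λ x → regroup (e (suc b) x) (e (inject₁ b) x) (e a x))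
    (nonneg-+ {Ψ = Ψ} (simpleDifference Ψ b) (go d (inject₁ b) (trans (Fin.toℕ-inject₁ b) (ℕ.suc-injective eq))))

nonneg-e : (b : Fin n) → Nonneg B n (e b)
nonneg-e {suc m} b = nonneg-≗ {Ψ = B} (λ x → regroup (e b x) (e zero x))
  (nonneg-+ {Ψ = B} (nonneg-difference {B} {a = zero} {b} z≤n) (nonneg-simple {B} zero))
  where
  regroup : ∀ p q → p ≡ (p ℤ.- q) ℤ.+ q
  regroup = solve-∀

inject₁-mono : {i k : Fin n} → i Fin.≤ k → inject₁ i Fin.≤ inject₁ k
inject₁-mono {i = i} {k} = subst₂ _≤_ (sym (Fin.toℕ-inject₁ i)) (sym (Fin.toℕ-inject₁ k))

≼-single : {i j k l : Fin (rank Ψ n)} → k Fin.≤ i → j Fin.≤ l →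
           _≼_ {Ψ} {n} (single [ i ⋯ j ]) (single [ k ⋯ l ])
≼-single {A} {suc m} {i} {j} {k} {l} k≤i j≤l =
  nonneg-≗ {Ψ = A} (λ x → regroup (e (suc l) x) (e (inject₁ k) x) (e (suc j) x) (e (inject₁ i) x))
    (nonneg-+ {Ψ = A} (nonneg-difference {A} (s≤s j≤l)) (nonneg-difference {A} (inject₁-mono k≤i)))
  where
  regroup : ∀ a b c d → (a ℤ.- b) ℤ.- (c ℤ.- d) ≡ (a ℤ.- c) ℤ.+ (d ℤ.- b)
  regroup = solve-∀
≼-single {B} {n} {zero}  {j} {zero}  {l} k≤i j≤l = nonneg-difference {B} j≤l
≼-single {B} {n} {suc i} {j} {zero}  {l} k≤i j≤l =
  nonneg-≗ {Ψ = B} (λ x → regroup (e l x) (e j x) (e (inject₁ i) x))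
    (nonneg-+ {Ψ = B} (nonneg-difference {B} j≤l) (nonneg-e (inject₁ i)))
  where
  regroup : ∀ a c d → a ℤ.- (c ℤ.- d) ≡ (a ℤ.- c) ℤ.+ d
  regroup = solve-∀
≼-single {B} {n} {suc i} {j} {suc k} {l} k≤i j≤l =
  nonneg-≗ {Ψ = B} (λ x → regroup (e l x) (e (inject₁ k) x) (e j x) (e (inject₁ i) x))
    (nonneg-+ {Ψ = B} (nonneg-difference {B} j≤l) (nonneg-difference {B} (inject₁-mono (ℕ.s≤s⁻¹ k≤i))))
  where
  regroup : ∀ a b c d → (a ℤ.- b) ℤ.- (c ℤ.- d) ≡ (a ℤ.- c) ℤ.+ (d ℤ.- b)
  regroup = solve-∀

≼-double : {j i l k : Fin n} → j Fin.≤ l → i Fin.≤ k → double 2[ j ]+[ i ] ≼ double 2[ l ]+[ k ]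
≼-double {n} {j} {i} {l} {k} j≤l i≤k =
  nonneg-≗ {Ψ = B} (λ x → regroup (e k x) (e l x) (e i x) (e j x))
    (nonneg-+ {Ψ = B} (nonneg-difference {B} i≤k) (nonneg-difference {B} j≤l))
  where
  regroup : ∀ a b c d → (a ℤ.+ b) ℤ.- (c ℤ.+ d) ≡ (a ℤ.- c) ℤ.+ (b ℤ.- d)
  regroup = solve-∀

≼-single-double : {i j l k : Fin n} → j Fin.≤ k → single [ i ⋯ j ] ≼ double 2[ l ]+[ k ]
≼-single-double {n} {zero}  {j} {l} {k} j≤k =
  nonneg-≗ {Ψ = B} (λ x → regroup (e k x) (e l x) (e j x))
    (nonneg-+ {Ψ = B} (nonneg-difference {B} j≤k) (nonneg-e l))
  where
  regroup : ∀ a b c → (a ℤ.+ b) ℤ.- c ≡ (a ℤ.- c) ℤ.+ b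
  regroup = solve-∀
≼-single-double {n} {suc i} {j} {l} {k} j≤k =
  nonneg-≗ {Ψ = B} (λ x → regroup (e k x) (e l x) (e j x) (e (inject₁ i) x))
    (nonneg-+ {Ψ = B} (nonneg-+ {Ψ = B} (nonneg-difference {B} j≤k) (nonneg-e l)) (nonneg-e (inject₁ i)))
  where
  regroup : ∀ a b c d → (a ℤ.+ b) ℤ.- (c ℤ.- d) ≡ ((a ℤ.- c) ℤ.+ b) ℤ.+ d
  regroup = solve-∀

-- Contraposition: when a required inequality of indices fails, one of the lemmas above gives
-- `α ≼ β`.
incomparable⇒before : {α β : Root Ψ n} → lastIndex α Fin.< lastIndex β → Incomparable α β → Before α β
incomparable⇒before {Ψ} {n} {single [ i ⋯ j ]} {single [ k ⋯ l ]} j<l (α⋠β , _) =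
  single-single (ℕ.≰⇒> λ k≤i → α⋠β (≼-single {Ψ} {n} k≤i (ℕ.<⇒≤ j<l))) j<l
incomparable⇒before {α = single [ i ⋯ j ]} {double 2[ l ]+[ k ]} j<k (α⋠β , _) =
  contradiction (≼-single-double {i = i} {j} {l} {k} (ℕ.<⇒≤ j<k)) α⋠β
incomparable⇒before {α = double 2[ j ]+[ i ]} {single [ k ⋯ l ]} i<l _ = double-single i<l
incomparable⇒before {α = double 2[ j ]+[ i ]} {double 2[ l ]+[ k ]} i<k (α⋠β , _) =
  double-double (ℕ.≰⇒> λ j≤l → α⋠β (≼-double {j = j} {i} {l} {k} j≤l (ℕ.<⇒≤ i<k))) i<k

-- Pairing with the indicator of {x : t ≤ x} separates roots that are not
-- comparable: it is nonnegative on simple roots.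
weight : Fin n → Fin n → ℤ
weight t x = if does (t Fin.≤? x) then + 1 else + 0

weight-1 : {t x : Fin n} → t Fin.≤ x → weight t x ≡ + 1
weight-1 {t = t} {x} t≤x rewrite dec-true (t Fin.≤? x) t≤x = refl

weight-0 : {t x : Fin n} → x Fin.< t → weight t x ≡ + 0
weight-0 {t = t} {x} x<t rewrite dec-false (t Fin.≤? x) (ℕ.<⇒≱ x<t) = refl

weight-nonneg : (t x : Fin n) → + 0 ℤ.≤ weight t x
weight-nonneg t x with does (t Fin.≤? x)
... | true  = ℤ.+≤+ z≤n
... | false = ℤ.+≤+ z≤n

weight-mono : (t x y : Fin n) → x Fin.≤ y → + 0 ℤ.≤ weight t y ℤ.- weight t x
weight-mono t x y x≤y with ℕ.<-≤-connex (toℕ x) (toℕ t)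
... | inj₁ x<t rewrite weight-0 {t = t} x<t | ℤ.+-identityʳ (weight t y) = weight-nonneg t y
... | inj₂ t≤x rewrite weight-1 {t = t} t≤x | weight-1 {t = t} (ℕ.≤-trans t≤x x≤y) = ℤ.+≤+ z≤n

evaluate : (Fin n → ℤ) → Root Ψ n → ℤ
evaluate {suc m} {A} w (single [ i ⋯ j ])     = w (suc j) ℤ.- w (inject₁ i)
evaluate {n}     {B} w (single [ zero ⋯ j ])  = w j
evaluate {n}     {B} w (single [ suc i ⋯ j ]) = w j ℤ.- w (inject₁ i)
evaluate {n}     {B} w (double 2[ j ]+[ i ])  = w i ℤ.+ w j

pair : (w v : Fin n → ℤ) → ℤ
pair w v = sum λ x → w x ℤ.* v x

pair-+ : (w u v : Fin n → ℤ) → pair w (λ x → u x ℤ.+ v x) ≡ pair w u ℤ.+ pair w v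
pair-+ w u v = trans (sum-cong-≗ λ x → ℤ.*-distribˡ-+ (w x) (u x) (v x))
                     (∑-distrib-+ (λ x → w x ℤ.* u x) (λ x → w x ℤ.* v x))

pair-- : (w u v : Fin n → ℤ) → pair w (λ x → u x ℤ.- v x) ≡ pair w u ℤ.- pair w v
pair-- {n} w u v = begin
  pair w (λ x → u x ℤ.- v x)                        ≡⟨ regroup _ (pair w v) ⟩
  (pair w (λ x → u x ℤ.- v x) ℤ.+ pair w v) ℤ.- pair w v
    ≡⟨ cong (ℤ._- pair w v) (pair-+ w (λ x → u x ℤ.- v x) v) ⟨
  pair w (λ x → (u x ℤ.- v x) ℤ.+ v x) ℤ.- pair w v
    ≡⟨ cong (ℤ._- pair w v) (sum-cong-≗ λ x → cong (w x ℤ.*_) (cancel (u x) (v x))) ⟩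
  pair w u ℤ.- pair w v ∎
  where
  open ≡-Reasoning
  regroup : ∀ p q → p ≡ (p ℤ.+ q) ℤ.- q
  regroup = solve-∀
  cancel : ∀ p q → (p ℤ.- q) ℤ.+ q ≡ p
  cancel = solve-∀

pair-root : (w : Fin n → ℤ) (α : Root Ψ n) → pair w ⟦ α ⟧ ≡ evaluate w α
pair-root {suc m} {A} w (single [ i ⋯ j ])     = trans (pair-- w (e (suc j)) (e (inject₁ i)))
  (cong₂ ℤ._-_ (sum-e w (suc j)) (sum-e w (inject₁ i)))
pair-root {n}     {B} w (single [ zero ⋯ j ])  = sum-e w j
pair-root {n}     {B} w (single [ suc i ⋯ j ]) = trans (pair-- w (e j) (e (inject₁ i)))
  (cong₂ ℤ._-_ (sum-e w j) (sum-e w (inject₁ i)))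
pair-root {n}     {B} w (double 2[ j ]+[ i ])  = trans (pair-+ w (e i) (e j))
  (cong₂ ℤ._+_ (sum-e w i) (sum-e w j))

sum-nonneg : (v : Fin n → ℤ) → (∀ x → + 0 ℤ.≤ v x) → + 0 ℤ.≤ sum v
sum-nonneg {zero}  v p = ℤ.≤-refl
sum-nonneg {suc n} v p = ℤ.+-mono-≤ (p zero) (sum-nonneg (v ∘ suc) (p ∘ suc))

pair-nonneg : (w v : Fin n → ℤ) → (∀ k → + 0 ℤ.≤ pair w (simple {Ψ} {n} k)) → Nonneg Ψ n v → + 0 ℤ.≤ pair w v
pair-nonneg {n} {Ψ} w v w-nonneg (c , p) = subst (+ 0 ℤ.≤_) (sym swapped)
  (sum-nonneg (λ k → + c k ℤ.* pair w (s k)) λ k →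
    subst (ℤ._≤ + c k ℤ.* pair w (s k)) (ℤ.*-zeroʳ (+ c k)) (ℤ.*-monoˡ-≤-nonNeg (+ c k) (w-nonneg k)))
  where
  open ≡-Reasoning
  s = simple {Ψ} {n}
  exchange : ∀ a b c → a ℤ.* (b ℤ.* c) ≡ b ℤ.* (a ℤ.* c)
  exchange = solve-∀
  swapped : pair w v ≡ sum λ k → + c k ℤ.* pair w (s k)
  swapped = begin
    sum (λ x → w x ℤ.* v x)
      ≡⟨ sum-cong-≗ (λ x → cong (w x ℤ.*_) (p x)) ⟩
    sum (λ x → w x ℤ.* sum (λ k → + c k ℤ.* s k x))
      ≡⟨ sum-cong-≗ (λ x → *-distribˡ-sum (w x) (λ k → + c k ℤ.* s k x)) ⟩
    sum (λ x → sum (λ k → w x ℤ.* (+ c k ℤ.* s k x)))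
      ≡⟨ ∑-comm (λ x k → w x ℤ.* (+ c k ℤ.* s k x)) ⟩
    sum (λ k → sum (λ x → w x ℤ.* (+ c k ℤ.* s k x)))
      ≡⟨ sum-cong-≗ (λ k → trans (sum-cong-≗ (λ x → exchange (w x) (+ c k) (s k x)))
                                 (sym (*-distribˡ-sum (+ c k) (λ x → w x ℤ.* s k x)))) ⟩
    sum (λ k → + c k ℤ.* pair w (s k)) ∎

weight-simple : (t : Fin n) (k : Fin (rank Ψ n)) → + 0 ℤ.≤ pair (weight t) (simple {Ψ} {n} k)
weight-simple {n} {Ψ} t k = subst (+ 0 ℤ.≤_) (sym (pair-root {Ψ = Ψ} (weight t) (single [ k ⋯ k ]))) (value {Ψ} t k)
  where
  value : ∀ {Ψ n} (t : Fin n) (k : Fin (rank Ψ n)) → + 0 ℤ.≤ evaluate {Ψ = Ψ} (weight t) (single [ k ⋯ k ])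
  value {A} {suc m} t k       = weight-mono t (inject₁ k) (suc k) (subst (_≤ suc (toℕ k)) (sym (Fin.toℕ-inject₁ k)) (ℕ.n≤1+n _))
  value {B}         t zero    = weight-nonneg t zero
  value {B}         t (suc k) = weight-mono t (inject₁ k) (suc k) (subst (_≤ suc (toℕ k)) (sym (Fin.toℕ-inject₁ k)) (ℕ.n≤1+n _))

≼⇒weight : {α β : Root Ψ n} → α ≼ β → ∀ t → + 0 ℤ.≤ evaluate (weight t) β ℤ.- evaluate (weight t) α
≼⇒weight {Ψ} {n} {α} {β} α≼β t =
  subst (+ 0 ℤ.≤_) (trans (pair-- (weight t) ⟦ β ⟧ ⟦ α ⟧)
                          (cong₂ ℤ._-_ (pair-root (weight t) β) (pair-root (weight t) α)))
        (pair-nonneg {Ψ = Ψ} (weight t) _ (weight-simple {Ψ = Ψ} t) α≼β)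

separated : {α β : Root Ψ n} (t : Fin n) {p q : ℤ} → evaluate (weight t) α ≡ p →
            evaluate (weight t) β ≡ q → ¬ (+ 0 ℤ.≤ q ℤ.- p) → ¬ α ≼ β
separated {α = α} {β} t refl refl p≰q α≼β = p≰q (≼⇒weight {α = α} {β} α≼β t)

weight-inject₁-1 : {t : Fin (suc n)} {k : Fin n} → toℕ t ≤ toℕ k → weight t (inject₁ k) ≡ + 1
weight-inject₁-1 {t = t} {k} t≤k = weight-1 {t = t} {inject₁ k} (subst (toℕ t ≤_) (sym (Fin.toℕ-inject₁ k)) t≤k)

weight-inject₁-0 : {t : Fin (suc n)} {k : Fin n} → toℕ k < toℕ t → weight t (inject₁ k) ≡ + 0
weight-inject₁-0 {t = t} {k} k<t = weight-0 {t = t} {inject₁ k} (subst (_< toℕ t) (sym (Fin.toℕ-inject₁ k)) k<t)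

lastPoint : Root Ψ n → Fin n
lastPoint {A} {suc m} (single [ i ⋯ j ]) = suc j
lastPoint {B}         α = lastIndex α

lastPoint-mono : {α β : Root Ψ n} → lastIndex α Fin.< lastIndex β → lastPoint α Fin.< lastPoint β
lastPoint-mono {A} {suc m} {single _} {single _} p = s≤s p
lastPoint-mono {B}                             p = p

weight-at-last : {α : Root Ψ n} → IsPositive α → evaluate (weight (lastPoint α)) α ≡ + 1
weight-at-last {A} {suc m} {single [ i ⋯ j ]} (single i≤j) =
  cong₂ ℤ._-_ (weight-1 {t = suc j} {suc j} ℕ.≤-refl) (weight-inject₁-0 {t = suc j} {i} (s≤s i≤j))
weight-at-last {B} {n} {single [ zero ⋯ j ]} (single _) = weight-1 {t = j} {j} ℕ.≤-refl
weight-at-last {B} {n} {single [ suc i ⋯ j ]} (single i<j) =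
  cong₂ ℤ._-_ (weight-1 {t = j} {j} ℕ.≤-refl) (weight-inject₁-0 {t = j} {i} i<j)
weight-at-last {B} {n} {double 2[ j ]+[ i ]} (double j<i) =
  cong₂ ℤ._+_ (weight-1 {t = i} {i} ℕ.≤-refl) (weight-0 {t = i} {j} j<i)

weight-above-last : {α : Root Ψ n} → IsPositive α → ∀ {t} → lastPoint α Fin.< t → evaluate (weight t) α ≡ + 0
weight-above-last {A} {suc m} {single [ i ⋯ j ]} (single i≤j) {t} j<t =
  cong₂ ℤ._-_ (weight-0 {t = t} {suc j} j<t) (weight-inject₁-0 {t = t} {i} (ℕ.≤-trans (s≤s (ℕ.m≤n⇒m≤1+n i≤j)) j<t))
weight-above-last {B} {n} {single [ zero ⋯ j ]} (single _) {t} j<t = weight-0 {t = t} {j} j<t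
weight-above-last {B} {n} {single [ suc i ⋯ j ]} (single i<j) {t} j<t =
  cong₂ ℤ._-_ (weight-0 {t = t} {j} j<t) (weight-inject₁-0 {t = t} {i} (ℕ.<-trans i<j j<t))
weight-above-last {B} {n} {double 2[ j ]+[ i ]} (double j<i) {t} i<t =
  cong₂ ℤ._+_ (weight-0 {t = t} {i} i<t) (weight-0 {t = t} {j} (ℕ.<-trans j<i i<t))

-- The threshold is placed where `α` weighs more. For two intervals it lies just above the lower end
-- of `α`, which makes the weights 1 and 0; for two double roots it is the smaller end of `α`, with
-- weights 2 and 1. At threshold `zero` the weight is the coordinate sum: 2 for a double root, 1 for
-- e_j and 0 for e_j - e_i.
before⇒⋠ : {α β : Root Ψ n} → IsPositive α → IsPositive β → Before α β → ¬ α ≼ β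
before⇒⋠ {A} {suc m} (single {i = i} {j} i≤j) (single {i = k} {l} k≤l) (single-single i<k j<l) =
  separated {A} {α = single [ i ⋯ j ]} {single [ k ⋯ l ]} (suc i)
    (cong₂ ℤ._-_ (weight-1 {t = suc i} {suc j} (s≤s i≤j)) (weight-inject₁-0 {t = suc i} {i} ℕ.≤-refl))
    (cong₂ ℤ._-_ (weight-1 {t = suc i} {suc l} (s≤s (ℕ.≤-trans (ℕ.<⇒≤ i<k) k≤l)))
                 (weight-inject₁-1 {t = suc i} {k} i<k))
    λ ()
before⇒⋠ {B} {suc m} (single {i = zero} {j} i≤j) (single {i = suc k} {l} k≤l) (single-single i<k j<l) =
  separated {B} {α = single [ zero ⋯ j ]} {single [ suc k ⋯ l ]} zero
    (weight-1 {t = zero {m}} {j} z≤n)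
    (cong₂ ℤ._-_ (weight-1 {t = zero {m}} {l} z≤n) (weight-inject₁-1 {t = zero} {k} z≤n))
    λ ()
before⇒⋠ {B} {suc m} (single {i = suc i} {j} i<j) (single {i = suc k} {l} k<l) (single-single (s≤s i<k) j<l) =
  separated {B} {α = single [ suc i ⋯ j ]} {single [ suc k ⋯ l ]} (suc i)
    (cong₂ ℤ._-_ (weight-1 {t = suc i} {j} i<j) (weight-inject₁-0 {t = suc i} {i} ℕ.≤-refl))
    (cong₂ ℤ._-_ (weight-1 {t = suc i} {l} (ℕ.≤-trans (s≤s (ℕ.<⇒≤ i<k)) k<l))
                 (weight-inject₁-1 {t = suc i} {k} i<k))
    λ ()
before⇒⋠ (double {j = j} {i} j<i) (double {j = l} {k} l<k) (double-double l<j i<k) =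
  separated {B} {α = double 2[ j ]+[ i ]} {double 2[ l ]+[ k ]} j
    (cong₂ ℤ._+_ (weight-1 {t = j} {i} (ℕ.<⇒≤ j<i)) (weight-1 {t = j} {j} ℕ.≤-refl))
    (cong₂ ℤ._+_ (weight-1 {t = j} {k} (ℕ.<⇒≤ (ℕ.<-trans j<i i<k))) (weight-0 {t = j} {l} l<j))
    λ ()
before⇒⋠ {n = suc m} (double {j = j} {i} j<i) (single {i = zero} {l} _) (double-single i<l) =
  separated {B} {α = double 2[ j ]+[ i ]} {single [ zero ⋯ l ]} zero
    (cong₂ ℤ._+_ (weight-1 {t = zero {m}} {i} z≤n) (weight-1 {t = zero {m}} {j} z≤n))
    (weight-1 {t = zero {m}} {l} z≤n)
    λ ()
before⇒⋠ {n = suc m} (double {j = j} {i} j<i) (single {i = suc k} {l} _) (double-single i<l) =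
  separated {B} {α = double 2[ j ]+[ i ]} {single [ suc k ⋯ l ]} zero
    (cong₂ ℤ._+_ (weight-1 {t = zero {m}} {i} z≤n) (weight-1 {t = zero {m}} {j} z≤n))
    (cong₂ ℤ._-_ (weight-1 {t = zero {m}} {l} z≤n) (weight-inject₁-1 {t = zero} {k} z≤n))
    λ ()

-- For the other direction the threshold is the last point of `β`: there `β` has weight 1, while all
-- of `α` lies below.
before⇒incomparable : {α β : Root Ψ n} → IsPositive α → IsPositive β → Before α β → Incomparable α β
before⇒incomparable {α = α} {β} α⁺ β⁺ α<β =
  before⇒⋠ α⁺ β⁺ α<β ,
  separated {α = β} {α} (lastPoint β) (weight-at-last β⁺)
    (weight-above-last α⁺ (lastPoint-mono {α = α} {β} (before⇒last< α<β))) λ ()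

nonnesting-before : (π : NN Ψ n) → AllPairs Before (roots π)
nonnesting-before π =
  AllPairs.zipWith (λ (p , q) → incomparable⇒before p q) (NN.increasing π , NN.antichain π)

allPairs-zipAll : {P : Pred X 0ℓ} {R S : Rel X 0ℓ} → (∀ {x y} → P x → P y → R x y → S x y) →
                  {xs : List X} → All P xs → AllPairs R xs → AllPairs S xs
allPairs-zipAll g []       []       = []
allPairs-zipAll g (p ∷ ps) (r ∷ rs) =
  All.zipWith (λ (q , s) → g p q s) (ps , r) ∷ allPairs-zipAll g ps rs

antichainOf : (αs : List (Root Ψ n)) → All IsPositive αs → AllPairs Before αs → NN Ψ n
antichainOf αs pos ord = record
  { roots      = αs
  ; positive   = pos
  ; increasing = AllPairs.map before⇒last< ord
  ; antichain  = allPairs-zipAll before⇒incomparable pos ord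
  }

-- Intervals: the map f without double roots

allPairs-++⁻ : {R : Rel X 0ℓ} (xs : List X) {ys : List X} → AllPairs R (xs ++ ys) →
               AllPairs R xs × AllPairs R ys × All (λ x → All (R x) ys) xs
allPairs-++⁻ []       r       = [] , r , []
allPairs-++⁻ (x ∷ xs) (p ∷ r) with rxs , rys , rxy ← allPairs-++⁻ xs r =
  All.++⁻ˡ xs p ∷ rxs , rys , All.++⁻ʳ xs p ∷ rxy

flatten : List (List⁺ X) → List X
flatten = concatMap List⁺.toList

module _ {R : Rel X 0ℓ} (R? : Decidable₂ R) where

  flatten-components : (xs : List X) → flatten (components R? xs) ≡ xs
  flatten-components [] = refl
  flatten-components (x ∷ xs) with components R? xs | flatten-components xs
  ... | []              | refl = refl
  ... | (y ∷ ys) ∷ runs | refl with does (R? x y)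
  ...   | true  = refl
  ...   | false = refl

  components-linked : (xs : List X) → All (Linked R ∘ List⁺.toList) (components R? xs)
  components-linked [] = []
  components-linked (x ∷ xs) with components R? xs | components-linked xs
  ... | []              | []     = [-] ∷ []
  ... | (y ∷ ys) ∷ runs | l ∷ ls with R? x y
  ...   | yes r = (r ∷ l) ∷ ls
  ...   | no  _ = [-] ∷ l ∷ ls

  module _ {_⊰_ S : Rel X 0ℓ} (gap : ∀ {x y} → x ⊰ y → ¬ R x y → S x y)
           (extendˡ : ∀ {x y z} → x ⊰ y → S y z → S x z)
           (extendʳ : ∀ {x y z} → S x y → y ⊰ z → S x z) where

    private
      Separated : Rel (List⁺ X) 0ℓ
      Separated c d = All (λ x → All (S x) (List⁺.toList d)) (List⁺.toList c)

    -- Only neighbours in the list are tested. `gap` settles the two roots at a break between runs,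
    -- and `extendˡ` and `extendʳ` propagate this to all earlier and all later roots.
    components-separated : {xs : List X} → AllPairs _⊰_ xs → AllPairs Separated (components R? xs)
    components-separated [] = []
    components-separated {x ∷ xs} (p ∷ ps)
      with components R? xs | flatten-components xs | components-separated ps
    ... | []              | refl | [] = [] ∷ []
    ... | (y ∷ ys) ∷ runs | refl | s ∷ ss with R? x y
    ...   | yes r = All.map (λ t → All.map (extendˡ (All.head p)) (All.head t) ∷ t) s ∷ ss
    ...   | no ¬r = (All.map (_∷ []) (near All.∷ All.map (λ {d} t → far {d} (All.head t)) s)) ∷ s ∷ ss
      where
      near : All (S x) (y ∷ ys)
      near = gap (All.head p) ¬r ∷
             All.map (extendʳ (gap (All.head p) ¬r)) (All.++⁻ˡ ys (AllPairs.head ps))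
      far : ∀ {d} → All (S y) (List⁺.toList d) → All (S x) (List⁺.toList d)
      far = All.map (extendˡ (All.head p))

coeff-single : {i j : Fin (rank Ψ n)} (k : Fin (rank Ψ n)) →
               coeff {Ψ} {n} (single [ i ⋯ j ]) k ≢ 0 → i Fin.≤ k × k Fin.≤ j
coeff-single {Ψ} {n} {i = i} {j} k nz with i Fin.≤? k | k Fin.≤? j
... | yes p | yes q = p , q
... | no ¬p | _     = contradiction zeroˡ nz
  where
  zeroˡ : coeff {Ψ} {n} (single [ i ⋯ j ]) k ≡ 0
  zeroˡ rewrite dec-false (i Fin.≤? k) ¬p = refl
... | yes p | no ¬q = contradiction zeroʳ nz
  where
  zeroʳ : coeff {Ψ} {n} (single [ i ⋯ j ]) k ≡ 0
  zeroʳ rewrite dec-true (i Fin.≤? k) p | dec-false (k Fin.≤? j) ¬q = refl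

coeff-single-1 : {i j k : Fin (rank Ψ n)} → i Fin.≤ k → k Fin.≤ j →
                 coeff {Ψ} {n} (single [ i ⋯ j ]) k ≡ 1
coeff-single-1 {i = i} {j} {k} i≤k k≤j rewrite dec-true (i Fin.≤? k) i≤k | dec-true (k Fin.≤? j) k≤j = refl

meet-singles⇒ : {i j k l : Fin (rank Ψ n)} → Meet {Ψ} {n} (single [ i ⋯ j ]) (single [ k ⋯ l ]) → k Fin.≤ j
meet-singles⇒ {Ψ} {n} {i} {j} {k} {l} (t , nz , eq) =
  ℕ.≤-trans (proj₁ (coeff-single {Ψ} {n} {k} {l} t (nz ∘ trans eq)))
            (proj₂ (coeff-single {Ψ} {n} {i} {j} t nz))

meet-singles : {i j k l : Fin (rank Ψ n)} → i Fin.≤ k → k Fin.≤ j → k Fin.≤ l →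
               Meet {Ψ} {n} (single [ i ⋯ j ]) (single [ k ⋯ l ])
meet-singles {Ψ} {n} {k = k} i≤k k≤j k≤l =
  k , (λ eq → case trans (sym (coeff-single-1 {Ψ} {n} i≤k k≤j)) eq of λ ()) ,
  trans (coeff-single-1 {Ψ} {n} i≤k k≤j) (sym (coeff-single-1 {Ψ} {n} ℕ.≤-refl k≤l))

-- Noncrossing re-pairings of the endpoints of intervals

open Interval

private
  firsts lasts : List (Interval N) → List (Fin N)
  firsts = map first
  lasts  = map last

Valid : Pred (Interval N) 0ℓ
Valid α = first α Fin.≤ last α

infix 4 _⊏_
_⊏_ : Rel (Interval N) 0ℓ
α ⊏ β = first α Fin.< first β × last α Fin.< last β

Contains : Interval N → Pred (Fin N) 0ℓ
Contains α t = first α Fin.≤ t × t Fin.≤ last α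

-- In type A the interval `[ i ⋯ j ]` is the arc from the point `i` to `j + 1`; in type B, for
-- `i > 0`, it is the arc from `i - 1` to `j`. So the middle inequality is strict between points and
-- weak between indices.
Crossing : Rel (Interval N) 0ℓ
Crossing α β = first α Fin.< first β × first β Fin.≤ last α × last α Fin.< last β

Apart : Rel (Interval N) 0ℓ
Apart α β = last α Fin.< first β

record Untangles (αs G : List (Interval N)) : Set where
  field
    firsts-↭  : firsts G ↭ firsts αs
    lasts-↭   : lasts G ↭ lasts αs
    valid     : All Valid G
    uncrossed : ∀ {γ δ} → γ ∈ G → δ ∈ G → ¬ Crossing γ δ
    covered   : ∀ {γ} → γ ∈ G → ∀ t → Contains γ t → Any (λ α → Contains α t) αs

module _ {αs G : List (Interval N)} (u : Untangles αs G) where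
  open Untangles u

  first∈ : ∀ {γ} → γ ∈ G → first γ ∈ firsts αs
  first∈ γ∈ = Perm.∈-resp-↭ firsts-↭ (Mem.∈-map⁺ first γ∈)

  last∈ : ∀ {γ} → γ ∈ G → last γ ∈ lasts αs
  last∈ γ∈ = Perm.∈-resp-↭ lasts-↭ (Mem.∈-map⁺ last γ∈)

all-firsts : {P : Pred (Fin N) 0ℓ} {αs G : List (Interval N)} → Untangles αs G →
             All (P ∘ first) αs → ∀ {γ} → γ ∈ G → P (first γ)
all-firsts u p γ∈ = All.lookup (All.map⁺ p) (first∈ u γ∈)

all-lasts : {P : Pred (Fin N) 0ℓ} {αs G : List (Interval N)} → Untangles αs G →
            All (P ∘ last) αs → ∀ {γ} → γ ∈ G → P (last γ)
all-lasts u p γ∈ = All.lookup (All.map⁺ p) (last∈ u γ∈)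

untangles-[] : Untangles {N} [] []
untangles-[] = record
  { firsts-↭ = ↭-refl ; lasts-↭ = ↭-refl ; valid = [] ; uncrossed = λ () ; covered = λ () }

untangles-single : {α : Interval N} → Valid α → Untangles [ α ] [ α ]
untangles-single v = record
  { firsts-↭  = ↭-refl
  ; lasts-↭   = ↭-refl
  ; valid     = v ∷ []
  ; uncrossed = λ { (here refl) (here refl) (i<i , _) → ℕ.<-irrefl refl i<i }
  ; covered   = λ { (here refl) t c → here c }
  }

untangles-++ : {αs βs G H : List (Interval N)} → Untangles αs G → Untangles βs H →
               All (λ α → All (Apart α) βs) αs → Untangles (αs ++ βs) (G ++ H)
untangles-++ {αs = αs} {βs} {G} {H} u v sep = record
  { firsts-↭  = mapped first u.firsts-↭ v.firsts-↭
  ; lasts-↭   = mapped last u.lasts-↭ v.lasts-↭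
  ; valid     = All.++⁺ u.valid v.valid
  ; uncrossed = λ γ∈ δ∈ → uncrossed (Mem.∈-++⁻ G γ∈) (Mem.∈-++⁻ G δ∈)
  ; covered   = λ γ∈ t c → [ (λ p → Any.++⁺ˡ (u.covered p t c)) , (λ p → Any.++⁺ʳ αs (v.covered p t c)) ]′
                             (Mem.∈-++⁻ G γ∈)
  }
  where
  module u = Untangles u
  module v = Untangles v
  mapped : (g : Interval _ → Fin _) → map g G ↭ map g αs → map g H ↭ map g βs →
           map g (G ++ H) ↭ map g (αs ++ βs)
  mapped g p q = ↭-trans (↭-reflexive (List.map-++ g G H))
                   (↭-trans (Perm.++⁺ p q) (↭-reflexive (sym (List.map-++ g αs βs))))
  apart : ∀ {γ δ} → γ ∈ G → δ ∈ H → last γ Fin.< first δ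
  apart {γ} γ∈ δ∈ = all-firsts {P = λ t → last γ Fin.< t} v
    (All.tabulate λ β∈ → all-lasts {P = Fin._< _} u (All.map (λ a → All.lookup a β∈) sep) γ∈) δ∈
  uncrossed : ∀ {γ δ} → γ ∈ G ⊎ γ ∈ H → δ ∈ G ⊎ δ ∈ H → ¬ Crossing γ δ
  uncrossed (inj₁ p) (inj₁ q) x             = u.uncrossed p q x
  uncrossed (inj₂ p) (inj₂ q) x             = v.uncrossed p q x
  uncrossed (inj₁ p) (inj₂ q) (_ , k≤j , _) = ℕ.<⇒≱ (apart p q) k≤j
  uncrossed (inj₂ p) (inj₁ q) (i<k , k≤j , j<l) =
    ℕ.<-asym j<l (ℕ.<-≤-trans (apart q p) (All.lookup v.valid p))

-- The union and the overlaps of a connected run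

open Interval

overlaps : Interval N → List (Interval N) → List (Interval N)
overlaps α []       = []
overlaps α (β ∷ βs) = [ first β ⋯ last α ] ∷ overlaps β βs

finalLast : Fin N → List (Interval N) → Fin N
finalLast z []       = z
finalLast z (β ∷ βs) = finalLast (last β) βs

module _ {N : ℕ} where
  open NaturalMax (Fin.≤-totalOrder N) using (x≤y⇒x⊔y≈y)
  open NaturalMin (Fin.≤-totalOrder N) using (x≤y⇒x⊓y≈x)

  ∩-overlap : {α β : Interval N} → α ⊏ β → α ∩ᴵ β ≡ [ first β ⋯ last α ]
  ∩-overlap {[ i ⋯ j ]} {[ k ⋯ l ]} (i<k , j<l) =
    cong₂ [_⋯_] (x≤y⇒x⊔y≈y (ℕ.<⇒≤ i<k)) (x≤y⇒x⊓y≈x (ℕ.<⇒≤ j<l))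

  zipWith-∩ : (α : Interval N) (βs : List (Interval N)) → AllPairs _⊏_ (α ∷ βs) →
              zipWith _∩ᴵ_ (α ∷ βs) βs ≡ overlaps α βs
  zipWith-∩ α []       _                = refl
  zipWith-∩ α (β ∷ βs) ((p ∷ _) ∷ sorted) = cong₂ _∷_ (∩-overlap p) (zipWith-∩ β βs sorted)

  ∪-hull : (i j : Fin N) (βs : List (Interval N)) → All (λ β → i Fin.< first β) βs →
           AllPairs _⊏_ ([ i ⋯ j ] ∷ βs) → foldl _∪_ [ i ⋯ j ] βs ≡ [ i ⋯ finalLast j βs ]
  ∪-hull i j []               _          _                        = refl
  ∪-hull i j ([ k ⋯ l ] ∷ βs) (i<k ∷ ps) ((j⊏l ∷ _) ∷ (q ∷ sorted)) =
    trans (cong (λ γ → foldl _∪_ γ βs)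
                (cong₂ [_⋯_] (x≤y⇒x⊓y≈x (ℕ.<⇒≤ i<k)) (x≤y⇒x⊔y≈y (ℕ.<⇒≤ (proj₂ j⊏l)))))
          (∪-hull i l βs ps (All.zipWith (λ (i<f , (_ , l<l′)) → i<f , l<l′) (ps , q) ∷ sorted))

Touching : Rel (Interval N) 0ℓ
Touching α β = first β Fin.≤ last α

firsts-overlaps : (α : Interval N) (βs : List (Interval N)) → map first (overlaps α βs) ≡ map first βs
firsts-overlaps α []       = refl
firsts-overlaps α (β ∷ βs) = cong (first β ∷_) (firsts-overlaps β βs)

lasts-overlaps : (α : Interval N) (βs : List (Interval N)) →
                 map last (overlaps α βs) ∷ʳ finalLast (last α) βs ≡ map last (α ∷ βs)
lasts-overlaps α []       = refl
lasts-overlaps α (β ∷ βs) = cong (last α ∷_) (lasts-overlaps β βs)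

length-overlaps : (α : Interval N) (βs : List (Interval N)) → length (overlaps α βs) ≡ length βs
length-overlaps α []       = refl
length-overlaps α (β ∷ βs) = cong suc (length-overlaps β βs)

valid-overlaps : {α : Interval N} {βs : List (Interval N)} → Linked Touching (α ∷ βs) → All Valid (overlaps α βs)
valid-overlaps [-]     = []
valid-overlaps (p ∷ l) = p ∷ valid-overlaps l

module _ {P : Pred (Fin N) 0ℓ} where

  overlaps-first : {α : Interval N} {βs : List (Interval N)} → All (P ∘ first) βs →
                   All (P ∘ first) (overlaps α βs)
  overlaps-first []       = []
  overlaps-first (p ∷ ps) = p ∷ overlaps-first ps

  overlaps-last : {α : Interval N} {βs : List (Interval N)} → All (P ∘ last) (α ∷ βs) →
                  All (P ∘ last) (overlaps α βs)
  overlaps-last (p ∷ [])     = []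
  overlaps-last (p ∷ q ∷ qs) = p ∷ overlaps-last (q ∷ qs)

sorted-overlaps : {α : Interval N} {βs : List (Interval N)} → AllPairs _⊏_ (α ∷ βs) →
                  AllPairs _⊏_ (overlaps α βs)
sorted-overlaps (_ ∷ []) = []
sorted-overlaps {α = α} ((p ∷ ps) ∷ sorted@(q ∷ _)) =
  All.zip (overlaps-first (All.map proj₁ q) , overlaps-last (proj₂ p ∷ All.map proj₂ ps)) ∷
  sorted-overlaps sorted

overlaps-covered : {α γ : Interval N} {βs : List (Interval N)} → AllPairs _⊏_ (α ∷ βs) →
                   γ ∈ overlaps α βs → ∀ t → Contains γ t → Any (λ β → Contains β t) (α ∷ βs)
overlaps-covered {βs = β ∷ βs} ((p ∷ _) ∷ _) (here refl) t (k≤t , t≤j) =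
  here (ℕ.≤-trans (ℕ.<⇒≤ (proj₁ p)) k≤t , t≤j)
overlaps-covered {βs = β ∷ βs} (_ ∷ sorted) (there γ∈) t c = there (overlaps-covered sorted γ∈ t c)

-- Neighbours that touch leave no hole in the union.
hull-covered : {α : Interval N} {βs : List (Interval N)} → Linked Touching (α ∷ βs) → ∀ t →
               first α Fin.≤ t → t Fin.≤ finalLast (last α) βs → Any (λ β → Contains β t) (α ∷ βs)
hull-covered [-] t p q = here (p , q)
hull-covered {α = α} (touch ∷ l) t p q with ℕ.≤-<-connex (toℕ t) (toℕ (last α))
... | inj₁ t≤ = here (p , t≤)
... | inj₂ <t = there (hull-covered l t (ℕ.≤-trans touch (ℕ.<⇒≤ <t)) q)

finalLast-≤ : (α : Interval N) {βs : List (Interval N)} → AllPairs _⊏_ (α ∷ βs) →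
              last α Fin.≤ finalLast (last α) βs
finalLast-≤ α (_ ∷ [])                = ℕ.≤-refl
finalLast-≤ α ((p ∷ _) ∷ sorted@(_ ∷ _)) = ℕ.≤-trans (ℕ.<⇒≤ (proj₂ p)) (finalLast-≤ _ sorted)

overlaps-below : (α : Interval N) {βs : List (Interval N)} → AllPairs _⊏_ (α ∷ βs) →
                 All (λ γ → last γ Fin.< finalLast (last α) βs) (overlaps α βs)
overlaps-below α (_ ∷ []) = []
overlaps-below α {β ∷ _} ((p ∷ _) ∷ sorted) =
  ℕ.<-≤-trans (proj₂ p) (finalLast-≤ β sorted) ∷ overlaps-below β sorted

-- The union takes the first index of the leftmost interval and the last index of the rightmost one.
-- The overlaps keep all other first and last indices and lie strictly inside these two, so nothing
-- crosses the union.
untangles-hull : {α : Interval N} {βs G : List (Interval N)} → Valid α → AllPairs _⊏_ (α ∷ βs) →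
                 Linked Touching (α ∷ βs) → Untangles (overlaps α βs) G →
                 Untangles (α ∷ βs) ([ first α ⋯ finalLast (last α) βs ] ∷ G)
untangles-hull {α = α} {βs} {G} α-valid sorted@(above ∷ _) linked u = record
  { firsts-↭  = ↭-prep (first α) (↭-trans firsts-↭ (↭-reflexive (firsts-overlaps α βs)))
  ; lasts-↭   = ↭-trans (↭-prep z lasts-↭)
                  (↭-trans (Perm.∷↭∷ʳ z (map last (overlaps α βs))) (↭-reflexive (lasts-overlaps α βs)))
  ; valid     = ℕ.≤-trans α-valid (finalLast-≤ α sorted) ∷ valid
  ; uncrossed = λ where
      (here refl) (here refl) (i<i , _)   → ℕ.<-irrefl refl i<i
      (here refl) (there δ∈) (_ , _ , z<) →
        ℕ.<-asym z< (all-lasts {P = Fin._< z} u (overlaps-below α sorted) δ∈)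
      (there γ∈) (here refl) (<a , _)     →
        ℕ.<-asym <a (all-firsts {P = first α Fin.<_} u (overlaps-first (All.map proj₁ above)) γ∈)
      (there γ∈) (there δ∈)               → uncrossed γ∈ δ∈
  ; covered   = λ where
      (here refl) t (p , q) → hull-covered linked t p q
      (there γ∈) t c        → spread t (covered γ∈ t c)
  }
  where
  open Untangles u
  z = finalLast (last α) βs
  spread : ∀ t → Any (λ γ → Contains γ t) (overlaps α βs) → Any (λ β → Contains β t) (α ∷ βs)
  spread t any with γ , γ∈ , c ← find any = overlaps-covered sorted γ∈ t c

product-concatMap : {Z : Set} (r : Y → Perm X) (g : Z → List Y) {k : Z → Perm X} →
                    ∀ cs → All (λ c → Inverse.to (k c) ≗ Inverse.to (product (map r (g c)))) cs →
                    Inverse.to (product (map k cs)) ≗ Inverse.to (product (map r (concatMap g cs)))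
product-concatMap r g []       []         z = refl
product-concatMap r g {k} (c ∷ cs) (eq ∷ eqs) z = begin
  Inverse.to (k c) (Inverse.to (product (map k cs)) z)
    ≡⟨ eq _ ⟩
  Inverse.to (product (map r (g c))) (Inverse.to (product (map k cs)) z)
    ≡⟨ cong (Inverse.to (product (map r (g c)))) (product-concatMap r g cs eqs z) ⟩
  Inverse.to (product (map r (g c)) · product (map r (concatMap g cs))) z
    ≡⟨ product-++ (map r (g c)) (map r (concatMap g cs)) z ⟨
  Inverse.to (product (map r (g c) ++ map r (concatMap g cs))) z
    ≡⟨ cong (λ σs → Inverse.to (product σs) z) (List.map-++ r (g c) _) ⟨
  Inverse.to (product (map r (g c ++ concatMap g cs))) z ∎
  where open ≡-Reasoning

module _ (Ψ : Series) (n : ℕ) where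

  private
    near? : Decidable₂ (λ α β → Meet {Ψ} {n} (single α) (single β))
    near? α β = meet? {Ψ} {n} (single α) (single β)

  -- Runs the recursion of `fSingle` but keeps the roots instead of multiplying their reflections.
  untangle : ℕ → List (Interval (rank Ψ n)) → List (Interval (rank Ψ n))
  untangleRun : ℕ → List⁺ (Interval (rank Ψ n)) → List (Interval (rank Ψ n))

  untangle zero    αs = []
  untangle (suc b) αs = concatMap (untangleRun b) (components near? αs)

  untangleRun b (α ∷ [])     = [ α ]
  untangleRun b (α ∷ β ∷ γs) =
    List⁺.foldl₁ _∪_ (α ∷ β ∷ γs) ∷ untangle b (zipWith _∩ᴵ_ (α ∷ β ∷ γs) (β ∷ γs))

  reflections : List (Interval (rank Ψ n)) → Perm (Point Ψ n)
  reflections αs = product (map (λ α → reflection {Ψ} {n} (single α)) αs)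

  reflections-++ : ∀ αs βs → Inverse.to (reflections (αs ++ βs)) ≗ Inverse.to (reflections αs · reflections βs)
  reflections-++ αs βs z =
    trans (cong (λ σs → Inverse.to (product σs) z) (List.map-++ (λ α → reflection {Ψ} {n} (single α)) αs βs))
          (product-++ (map (λ α → reflection {Ψ} {n} (single α)) αs) (map (λ α → reflection {Ψ} {n} (single α)) βs) z)

  fSingle-reflections : ∀ b αs → Inverse.to (fSingle Ψ n b αs) ≗ Inverse.to (reflections (untangle b αs))
  fSingle-reflections zero    αs z = refl
  fSingle-reflections (suc b) αs =
    product-concatMap (λ α → reflection {Ψ} {n} (single α)) (untangleRun b)
      (components near? αs) (All.universal (λ where
      (α ∷ [])     z → refl
      (α ∷ β ∷ γs) z → cong (Inverse.to (reflection (single (List⁺.foldl₁ _∪_ (α ∷ β ∷ γs)))))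
                            (fSingle-reflections b (zipWith _∩ᴵ_ (α ∷ β ∷ γs) (β ∷ γs)) z))
      (components near? αs))

  -- Different components lie apart and can be treated one by one. A component has one overlap less
  -- than it has intervals, so the smaller bound suffices for the recursive call.
  untangle-untangles : ∀ b αs → length αs ≤ b → All Valid αs → AllPairs _⊏_ αs → Untangles αs (untangle b αs)
  untangle-untangles zero    []       _ _ _ = untangles-[]
  untangle-untangles (suc b) αs len valid sorted =
    subst (λ βs → Untangles βs (untangle (suc b) αs)) flat
      (go (components near? αs)
        (subst (λ βs → length βs ≤ suc b) (sym flat) len)
        (subst (All Valid) (sym flat) valid)
        (subst (AllPairs _⊏_) (sym flat) sorted)
        (All.map (Linked.map (λ {α} {β} → meet-singles⇒ {Ψ} {n} {first α} {last α} {first β} {last β})) (components-linked near? αs))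
        (components-separated near? {_⊰_ = λ α β → α ⊏ β × Valid β} {Apart}
          (λ {α} {β} ((i<k , _) , k≤l) ¬meet → ℕ.≰⇒> λ k≤j → ¬meet (meet-singles {Ψ} {n} (ℕ.<⇒≤ i<k) k≤j k≤l))
          (λ ((_ , j<l) , _) a → ℕ.<-trans j<l a)
          (λ a ((i<k , _) , _) → ℕ.<-trans a i<k)
          (withValid valid sorted)))
    where
    flat = flatten-components near? αs
    withValid : ∀ {αs} → All Valid αs → AllPairs _⊏_ αs → AllPairs (λ α β → α ⊏ β × Valid β) αs
    withValid = allPairs-zipAll λ _ v p → p , v
    go : ∀ cs → length (flatten cs) ≤ suc b → All Valid (flatten cs) → AllPairs _⊏_ (flatten cs) →
         All (Linked Touching ∘ List⁺.toList) cs →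
         AllPairs (λ c d → All (λ α → All (Apart α) (List⁺.toList d)) (List⁺.toList c)) cs →
         Untangles (flatten cs) (concatMap (untangleRun b) cs)
    go [] _ _ _ _ _ = untangles-[]
    go (c ∷ cs) len valid sorted (linked ∷ linkeds) (sep ∷ seps)
      with sorted-c , sorted-cs , _ ← allPairs-++⁻ (List⁺.toList c) sorted =
      untangles-++ (run c len-c (All.++⁻ˡ (List⁺.toList c) valid) sorted-c linked)
                   (go cs len-cs (All.++⁻ʳ (List⁺.toList c) valid) sorted-cs linkeds seps)
                   (All.map (All.concat⁺ ∘ All.map⁺) (All.All-swap sep))
      where
      len-++ : length (List⁺.toList c) + length (flatten cs) ≤ suc b
      len-++ = subst (_≤ suc b) (List.length-++ (List⁺.toList c)) len
      len-c : length (List⁺.toList c) ≤ suc b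
      len-c = ℕ.m+n≤o⇒m≤o _ len-++
      len-cs : length (flatten cs) ≤ suc b
      len-cs = ℕ.m+n≤o⇒n≤o (length (List⁺.toList c)) len-++
      run : ∀ c → length (List⁺.toList c) ≤ suc b → All Valid (List⁺.toList c) →
            AllPairs _⊏_ (List⁺.toList c) → Linked Touching (List⁺.toList c) →
            Untangles (List⁺.toList c) (untangleRun b c)
      run (α ∷ []) _ (v ∷ []) _ _ = untangles-single v
      run (α ∷ β ∷ γs) (s≤s len) (v ∷ _) sorted linked =
        subst₂ (λ u o → Untangles (α ∷ β ∷ γs) (u ∷ untangle b o))
          (sym (∪-hull (first α) (last α) (β ∷ γs) (All.map proj₁ (AllPairs.head sorted)) sorted))
          (sym (zipWith-∩ α (β ∷ γs) sorted))
          (untangles-hull v sorted linked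
            (untangle-untangles b (overlaps α (β ∷ γs))
              (subst (_≤ b) (sym (length-overlaps α (β ∷ γs))) len)
              (valid-overlaps linked) (sorted-overlaps sorted)))

open Interval
open Double renaming (last to lastᴰ)

-- Links

allPairs-compare : {R : Rel X 0ℓ} {xs : List X} → AllPairs R xs → ∀ {x y} → x ∈ xs → y ∈ xs →
                   x ≡ y ⊎ R x y ⊎ R y x
allPairs-compare (p ∷ ps) (here refl) (here refl) = inj₁ refl
allPairs-compare (p ∷ ps) (here refl) (there y∈)  = inj₂ (inj₁ (All.lookup p y∈))
allPairs-compare (p ∷ ps) (there x∈)  (here refl) = inj₂ (inj₂ (All.lookup p x∈))
allPairs-compare (p ∷ ps) (there x∈)  (there y∈)  = allPairs-compare ps x∈ y∈

last-greatest : {R : Rel X 0ℓ} {xs : List X} → AllPairs R xs → ∀ {y} → List.last xs ≡ just y →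
                y ∈ xs × (∀ {x} → x ∈ xs → x ≡ y ⊎ R x y)
last-greatest {xs = _ ∷ []} _ refl = here refl , λ { (here refl) → inj₁ refl }
last-greatest {xs = x ∷ xs@(_ ∷ _)} (p ∷ ps) eq with y∈ , greatest ← last-greatest ps eq =
  there y∈ , λ { (here refl) → inj₂ (All.lookup p y∈) ; (there z∈) → greatest z∈ }

last-nothing : {xs : List X} → List.last xs ≡ nothing → xs ≡ []
last-nothing {xs = []}           _  = refl
last-nothing {xs = _ ∷ xs@(_ ∷ _)} eq with () ← last-nothing {xs = xs} eq

head-least : {R : Rel X 0ℓ} {xs : List X} → AllPairs R xs → ∀ {y} → head xs ≡ just y →
             y ∈ xs × (∀ {x} → x ∈ xs → x ≡ y ⊎ R y x)
head-least (p ∷ _) refl = here refl , λ { (here refl) → inj₁ refl ; (there x∈) → inj₂ (All.lookup p x∈) }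

unique-↭ : {xs ys : List X} → Unique xs → Unique ys → (∀ {x} → x ∈ xs → x ∈ ys) →
           (∀ {x} → x ∈ ys → x ∈ xs) → xs ↭ ys
unique-↭ u v to from = ∼bag⇒↭ (unique∧set⇒bag u v (mk⇔ to from))

foldr-ind : {Z : Set} (P : List X → Z → Set) {g : X → Z → Z} {z : Z} → P [] z →
            (∀ x xs y → P xs y → P (x ∷ xs) (g x y)) → ∀ xs → P xs (foldr g z xs)
foldr-ind P base step []       = base
foldr-ind P base step (x ∷ xs) = step x xs _ (foldr-ind P base step xs)

-- The invariant speaks of the prefix already consumed, because the u-links are made from left to
-- right.
foldl-ind : {Z : Set} (P : List X → Z → Set) {g : Z → X → Z} {z : Z} → P [] z →
            (∀ xs x y → P xs y → P (xs ∷ʳ x) (g y x)) → ∀ xs → P xs (foldl g z xs)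
foldl-ind {X} P {g} base step xs = go [] _ base xs
  where
  go : ∀ pre y → P pre y → ∀ xs → P (pre ++ xs) (foldl g y xs)
  go pre y p []       = subst (λ l → P l y) (sym (List.++-identityʳ pre)) p
  go pre y p (x ∷ xs) = subst (λ l → P l (foldl g (g y x) xs)) (List.++-assoc pre [ x ] xs)
                          (go (pre ∷ʳ x) (g y x) (step pre x y p) xs)

coeff-double⇒ : (δ : Double n) (k : Fin n) → coeff (double δ) k ≡ 2 → k Fin.≤ lastDouble δ
coeff-double⇒ 2[ j ]+[ i ] k eq = case k Fin.≤? j of λ where
    (yes p) → p
    (no ¬p) → contradiction (trans (sym (at-most-one ¬p)) eq) (if-≢2 (does (k Fin.≤? i)))
  where
  at-most-one : ¬ k Fin.≤ j → coeff (double 2[ j ]+[ i ]) k ≡ (if does (k Fin.≤? i) then 1 else 0)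
  at-most-one ¬p rewrite dec-false (k Fin.≤? j) ¬p = refl
  if-≢2 : ∀ b → (if b then 1 else 0) ≢ 2
  if-≢2 true  ()
  if-≢2 false ()

coeff-double : (δ : Double n) (k : Fin n) → k Fin.≤ lastDouble δ → coeff (double δ) k ≡ 2
coeff-double 2[ j ]+[ i ] k p rewrite dec-true (k Fin.≤? j) p = refl

Link : ℕ → Set
Link n = Double n × Interval n

infix 4 _⊐_
_⊐_ : Rel (Double n) 0ℓ
δ ⊐ η = lastDouble η Fin.< lastDouble δ × lastᴰ δ Fin.< lastᴰ η

module LLinks {n : ℕ} (Γd : List (Double n)) (Γd-sorted : AllPairs _⊐_ Γd) where

  open DecMembership (_≟ᴰ_ {n}) using () renaming (_∈?_ to _∈ᴰ?_)

  candidate? : (β : Interval n) (L : List (Link n)) →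
               Decidable (λ δ → coeff {B} (double δ) (first β) ≡ 2 × ¬ δ ∈ map proj₁ L)
  candidate? β L δ = coeff {B} (double δ) (first β) ℕ.≟ 2 ×-dec ¬? (δ ∈ᴰ? map proj₁ L)

  addLink : Interval n → List (Link n) → Maybe (Double n) → List (Link n)
  addLink β L = maybe′ (λ δ → (δ , β) ∷ L) L

  link : Interval n → List (Link n) → List (Link n)
  link [ zero ⋯ l ]    L = L
  link β@([ suc k ⋯ l ]) L = addLink β L (List.last (filter (candidate? β L) Γd))

  Movable : Pred (Interval n) 0ℓ
  Movable β = 1 ≤ toℕ (first β)

  -- The field greedy is all that the proofs need to know about the order
  -- in which the links are chosen.
  record IsGreedy (βs : List (Interval n)) (L : List (Link n)) : Set where
    field
      linked : ∀ {δ β} → (δ , β) ∈ L → δ ∈ Γd × β ∈ βs × Movable β × first β Fin.≤ lastDouble δ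
      sorted : AllPairs (_⊏_ on proj₂) L
      unique : Unique (map proj₁ L)
      greedy : ∀ {β δ} → β ∈ βs → Movable β → δ ∈ Γd → first β Fin.≤ lastDouble δ →
               (∃[ β′ ] (δ , β′) ∈ L × first β Fin.< first β′) ⊎
               (∃[ δ′ ] (δ′ , β) ∈ L × lastDouble δ′ Fin.≤ lastDouble δ)

  skip : ∀ {β βs L} → (Movable β → ∀ {δ} → δ ∈ Γd → first β Fin.≤ lastDouble δ →
                        ∃[ β′ ] (δ , β′) ∈ L × first β Fin.< first β′) →
         IsGreedy βs L → IsGreedy (β ∷ βs) L
  skip taken g = record
    { linked = λ p → let δ∈ , β∈ , rest = linked p in δ∈ , there β∈ , rest
    ; sorted = sorted
    ; unique = unique
    ; greedy = λ { (here refl) m δ∈ q → inj₁ (taken m δ∈ q) ; (there β∈) → greedy β∈ }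
    }
    where open IsGreedy g

  -- The links are made from right to left, so a double root already in `L` serves an interval that
  -- starts further right than `β`. Last double indices decrease along `Γd`, hence the last
  -- candidate has the smallest one that still reaches `β`.
  link-greedy : ∀ β βs L → (AllPairs _⊏_ βs → IsGreedy βs L) →
                AllPairs _⊏_ (β ∷ βs) → IsGreedy (β ∷ βs) (link β L)
  link-greedy [ zero ⋯ l ] βs L ih (_ ∷ βs-sorted) = skip (λ ()) (ih βs-sorted)
  link-greedy β@([ suc k ⋯ l ]) βs L ih (above ∷ βs-sorted) = choose _ refl
    where
    g = ih βs-sorted
    open IsGreedy g
    used : ∀ {δ} → δ ∈ map proj₁ L → ∃[ β′ ] (δ , β′) ∈ L × first β Fin.< first β′
    used δ∈ with (_ , β′) , p , refl ← Mem.∈-map⁻ proj₁ δ∈ =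
      β′ , p , proj₁ (All.lookup above (proj₁ (proj₂ (linked p))))
    choose : ∀ m → List.last (filter (candidate? β L) Γd) ≡ m → IsGreedy (β ∷ βs) (addLink β L m)
    choose nothing eq = skip (λ _ {δ} δ∈ q → case δ ∈ᴰ? map proj₁ L of λ where
      (yes δ∈L) → used δ∈L
      (no  δ∉L) → contradiction
        (subst (δ ∈_) (last-nothing eq)
          (Mem.∈-filter⁺ (candidate? β L) δ∈ (coeff-double δ (first β) q , δ∉L))) λ ()) g
    choose (just δ₀) eq
      with δ₀∈ , latest ← last-greatest (AllPairs.filter⁺ (candidate? β L) Γd-sorted) eq
      with δ₀∈Γd , coeff≡2 , δ₀∉L ← Mem.∈-filter⁻ (candidate? β L) {xs = Γd} δ₀∈ = record
      { linked = λ where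
          (here refl) → δ₀∈Γd , here refl , s≤s z≤n , coeff-double⇒ δ₀ (first β) coeff≡2
          (there p)   → let δ∈ , β∈ , rest = linked p in δ∈ , there β∈ , rest
      ; sorted = All.tabulate (λ p → All.lookup above (proj₁ (proj₂ (linked p)))) ∷ sorted
      ; unique = All.tabulate (λ { δ∈ refl → δ₀∉L δ∈ }) ∷ unique
      ; greedy = λ where
          (here refl) _ δ∈ q → closest δ∈ q
          (there β∈) m δ∈ q → ⊎-map (λ (β′ , p , lt) → β′ , there p , lt)
                                    (λ (δ′ , p , le) → δ′ , there p , le) (greedy β∈ m δ∈ q)
      }
      where
      closest : ∀ {δ} → δ ∈ Γd → first β Fin.≤ lastDouble δ →
                (∃[ β′ ] (δ , β′) ∈ (δ₀ , β) ∷ L × first β Fin.< first β′) ⊎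
                (∃[ δ′ ] (δ′ , β) ∈ (δ₀ , β) ∷ L × lastDouble δ′ Fin.≤ lastDouble δ)
      closest {δ} δ∈ q with δ ∈ᴰ? map proj₁ L
      ... | yes δ∈L = let β′ , p , lt = used δ∈L in inj₁ (β′ , there p , lt)
      ... | no  δ∉L = inj₂ (δ₀ , here refl ,
        [ (λ { refl → ℕ.≤-refl }) , (λ δ⊐δ₀ → ℕ.<⇒≤ (proj₁ δ⊐δ₀)) ]′
          (latest (Mem.∈-filter⁺ (candidate? β L) δ∈ (coeff-double δ (first β) q , δ∉L))))

  links : List (Interval n) → List (Link n)
  links = foldr link []

  links-greedy : ∀ βs → AllPairs _⊏_ βs → IsGreedy βs (links βs)
  links-greedy = foldr-ind (λ βs L → AllPairs _⊏_ βs → IsGreedy βs L)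
    (λ _ → record { linked = λ () ; sorted = [] ; unique = [] ; greedy = λ () }) link-greedy

-- `LLinks.link` matches on the first index where the algorithm tests it; in each case both reduce
-- to the same list.
lLinks-links : (αs : List (Root B n)) (s : AllPairs _⊐_ (Linking.Γd αs)) →
               Linking.lLinks αs ≡ LLinks.links (Linking.Γd αs) s (Linking.Γ αs)
lLinks-links αs s = List.foldr-cong (λ where
  [ zero ⋯ l ]  L → refl
  [ suc k ⋯ l ] L → refl) refl (Linking.Γ αs)

-- The u-links

open Interval
open Double renaming (last to lastᴰ)

lastIndex-injective : {αs : List (Root Ψ n)} → AllPairs Before αs → ∀ {α β} → α ∈ αs → β ∈ αs →
                      lastIndex α ≡ lastIndex β → α ≡ β
lastIndex-injective ordered α∈ β∈ eq with allPairs-compare ordered α∈ β∈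
... | inj₁ α≡β        = α≡β
... | inj₂ (inj₁ α<β) = contradiction (cong toℕ eq) (ℕ.<⇒≢ (before⇒last< α<β))
... | inj₂ (inj₂ β<α) = contradiction (cong toℕ (sym eq)) (ℕ.<⇒≢ (before⇒last< β<α))

last<⇒before : {αs : List (Root Ψ n)} → AllPairs Before αs → ∀ {α β} → α ∈ αs → β ∈ αs →
               lastIndex α Fin.< lastIndex β → Before α β
last<⇒before ordered α∈ β∈ lt with allPairs-compare ordered α∈ β∈
... | inj₁ refl       = contradiction lt (ℕ.<-irrefl refl)
... | inj₂ (inj₁ α<β) = α<β
... | inj₂ (inj₂ β<α) = contradiction lt (ℕ.<-asym (before⇒last< β<α))

coeff-double-0 : (δ : Double n) (k : Fin n) → lastDouble δ Fin.< lastᴰ δ → coeff (double δ) k ≢ 0 →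
                 k Fin.≤ lastᴰ δ
coeff-double-0 2[ j ]+[ i ] k j<i nz with k Fin.≤? i
... | yes k≤i = k≤i
... | no  k≰i = contradiction vanishes nz
  where
  vanishes : coeff (double 2[ j ]+[ i ]) k ≡ 0
  vanishes rewrite dec-false (k Fin.≤? j) (λ k≤j → k≰i (ℕ.≤-trans k≤j (ℕ.<⇒≤ j<i)))
                 | dec-false (k Fin.≤? i) k≰i = refl

coeff-nonzero⇒ : {α : Root B n} → IsPositive α → (k : Fin n) → coeff α k ≢ 0 → k Fin.≤ lastIndex α
coeff-nonzero⇒ {n} {single [ i ⋯ j ]} (single i≤j) k nz = proj₂ (coeff-single {B} {n} {i} {j} k nz)
coeff-nonzero⇒ {n} {double δ}         (double j<i) k nz = coeff-double-0 δ k j<i nz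

coeff-nonzero : {α : Root B n} {β : Interval n} → Before α (single β) → first β Fin.≤ lastIndex α →
                coeff α (first β) ≢ 0
coeff-nonzero {n} {single [ i ⋯ j ]} {β} (single-single i<k _) k≤j eq =
  case trans (sym (coeff-single-1 {B} {n} {i} {j} {first β} (ℕ.<⇒≤ i<k) k≤j)) eq of λ ()
coeff-nonzero {n} {double 2[ j ]+[ i ]} {β} (double-single _) k≤i eq with first β Fin.≤? j
... | yes k≤j = case trans (sym (coeff-double 2[ j ]+[ i ] (first β) k≤j)) eq of λ ()
... | no  k≰j = case trans (sym once) eq of λ ()
  where
  once : coeff (double 2[ j ]+[ i ]) (first β) ≡ 1
  once rewrite dec-false (first β Fin.≤? j) k≰j | dec-true (first β Fin.≤? i) k≤i = refl

module ULinks {n : ℕ} (αs : List (Root B n)) (positive : All IsPositive αs)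
              (ordered : AllPairs Before αs) where

  open DecMembership (_≟ᴿ_ {B} {n}) using () renaming (_∈?_ to _∈ᴿ?_)

  ULink : Set
  ULink = Root B n × Interval n

  -- The candidate condition in terms of indices: for a root to the left of `β`, its coefficient at
  -- the first index of `β` is nonzero iff its last index is at least that index.
  Reaches : Interval n → Pred (Root B n) 0ℓ
  Reaches β α = lastIndex α Fin.< last β × first β Fin.≤ lastIndex α

  candidate? : (β : Interval n) (U : List ULink) →
    Decidable (λ α → lastIndex α Fin.< last β × ¬ coeff α (first β) ≡ 0 × ¬ α ∈ map proj₁ U)
  candidate? β U α = lastIndex α Fin.<? last β
                     ×-dec ¬? (coeff α (first β) ℕ.≟ 0)
                     ×-dec ¬? (α ∈ᴿ? map proj₁ U)

  addLink : List ULink → Interval n → Maybe (Root B n) → List ULink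
  addLink U β = maybe′ (λ α → U ∷ʳ (α , β)) U

  link : List ULink → Interval n → List ULink
  link U β = addLink U β (head (filter (candidate? β U) αs))

  links : List (Interval n) → List ULink
  links = foldl link []

  -- The left neighbour of `β` in a connected antichain. It is still free when the turn of `β`
  -- comes, so every admissible interval is u-linked; this is what the field `targets` of `IsGreedy`
  -- relies on.
  record HasPredecessor (β : Interval n) : Set where
    field
      member      : single β ∈ αs
      predecessor : Root B n
      pred∈       : predecessor ∈ αs
      reaches     : Reaches β predecessor
      greatest    : ∀ {γ} → γ ∈ αs → lastIndex γ Fin.< last β → lastIndex γ Fin.≤ lastIndex predecessor

  _⊏ᵁ_ : Rel ULink 0ℓ
  (α , β) ⊏ᵁ (γ , δ) = first β Fin.< first δ × lastIndex α Fin.< lastIndex γ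

  record IsGreedy (βs : List (Interval n)) (U : List ULink) : Set where
    field
      linked  : ∀ {α β} → (α , β) ∈ U → α ∈ αs × β ∈ βs × Reaches β α
      targets : map proj₂ U ≡ βs
      sorted  : AllPairs _⊏ᵁ_ U
      greedy  : ∀ {α β} → β ∈ βs → α ∈ αs → Reaches β α →
                (∃[ β′ ] (α , β′) ∈ U × first β′ Fin.< first β) ⊎
                (∃[ α′ ] (α′ , β) ∈ U × lastIndex α′ Fin.≤ lastIndex α)

    target-unique : ∀ {α α′ β} → (α , β) ∈ U → (α′ , β) ∈ U → α ≡ α′
    target-unique p q with allPairs-compare sorted p q
    ... | inj₁ refl              = refl
    ... | inj₂ (inj₁ (lt , _)) = contradiction lt (ℕ.<-irrefl refl)
    ... | inj₂ (inj₂ (lt , _)) = contradiction lt (ℕ.<-irrefl refl)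

  private
    candidate⁺ : ∀ {α β} U → single β ∈ αs → α ∈ αs → Reaches β α → α ∉ map proj₁ U →
                 α ∈ filter (candidate? β U) αs
    candidate⁺ {α} {β} U β∈ α∈ (lt , le) α∉ =
      Mem.∈-filter⁺ (candidate? β U) α∈ (lt , coeff-nonzero (last<⇒before ordered α∈ β∈ lt) le , α∉)

    candidate⁻ : ∀ {α β} U → α ∈ filter (candidate? β U) αs → α ∈ αs × Reaches β α × α ∉ map proj₁ U
    candidate⁻ {α} {β} U p with α∈ , lt , nz , α∉ ← Mem.∈-filter⁻ (candidate? β U) {xs = αs} p =
      α∈ , (lt , coeff-nonzero⇒ (All.lookup positive α∈) (first β) nz) , α∉

  -- Candidates keep the order of `αs`, so their head is the leftmost one. The sources increase
  -- together with the targets, which makes the u-intersections a sorted list to which `untangle`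
  -- applies.
  link-greedy : ∀ βs β U → IsGreedy βs U → All HasPredecessor βs → HasPredecessor β →
                All (_⊏ β) βs → IsGreedy (βs ∷ʳ β) (link U β)
  link-greedy βs β U g preds p below = choose _ refl
    where
    open IsGreedy g
    open HasPredecessor p

    used : ∀ {α} → α ∈ map proj₁ U → ∃[ β′ ] (α , β′) ∈ U × β′ ⊏ β
    used α∈ with (_ , β′) , q , refl ← Mem.∈-map⁻ proj₁ α∈ =
      β′ , q , All.lookup below (proj₁ (proj₂ (linked q)))

    -- An earlier link of the predecessor would lead to an interval that
    -- ends strictly between the predecessor and β.
    predecessor-free : predecessor ∉ map proj₁ U
    predecessor-free q with β′ , q′ , (_ , lt) ← used q with _ , β′∈ , (lt′ , _) ← linked q′ =
      ℕ.<⇒≱ lt′ (greatest (HasPredecessor.member (All.lookup preds β′∈)) lt)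

    choose : ∀ m → head (filter (candidate? β U) αs) ≡ m → IsGreedy (βs ∷ʳ β) (addLink U β m)
    choose nothing eq with filter (candidate? β U) αs | candidate⁺ U member pred∈ reaches predecessor-free
    ... | [] | ()
    choose (just α₀) eq
      with α₀∈ , least ← head-least (AllPairs.filter⁺ (candidate? β U) ordered) eq
      with α₀∈αs , reach₀ , α₀∉U ← candidate⁻ U α₀∈ = record
      { linked  = λ q → linked′ (Mem.∈-++⁻ U q)
      ; targets = trans (List.map-++ proj₂ U _) (cong (_∷ʳ β) targets)
      ; sorted  = AllPairs.++⁺ sorted ([] ∷ []) (All.tabulate λ q → precedes q ∷ [])
      ; greedy  = λ q → greedy′ (Mem.∈-++⁻ βs q)
      }
      where
      linked′ : ∀ {α γ} → (α , γ) ∈ U ⊎ (α , γ) ∈ [ α₀ , β ] → α ∈ αs × γ ∈ βs ∷ʳ β × Reaches γ α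
      linked′ (inj₁ q) = let α∈ , γ∈ , r = linked q in α∈ , Mem.∈-++⁺ˡ γ∈ , r
      linked′ (inj₂ (here refl)) = α₀∈αs , Mem.∈-++⁺ʳ βs (here refl) , reach₀

      -- If `α₀` ends before `γ`, then it reached `γ` as well and was free at that time. The greedy
      -- choice therefore gave `γ` a source no further right than `α₀`, and a different one since
      -- `α₀` is still free.
      precedes : ∀ {p} → p ∈ U → p ⊏ᵁ (α₀ , β)
      precedes {α , γ} q with α∈ , γ∈ , (lt , le) ← linked q
        with γ⊏β ← All.lookup below γ∈
        with ℕ.<-≤-connex (toℕ (lastIndex α₀)) (toℕ (last γ))
      ... | inj₂ γ≤α₀ = proj₁ γ⊏β , ℕ.<-≤-trans lt γ≤α₀
      ... | inj₁ α₀<γ with greedy γ∈ α₀∈αs (α₀<γ , ℕ.≤-trans (ℕ.<⇒≤ (proj₁ γ⊏β)) (proj₂ reach₀))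
      ...   | inj₁ (_ , q′ , _) = contradiction (Mem.∈-map⁺ proj₁ q′) α₀∉U
      ...   | inj₂ (α′ , q′ , le′) with refl ← target-unique q q′ =
        proj₁ γ⊏β , ℕ.≤∧≢⇒< le′ (λ eq → α₀∉U (subst (_∈ map proj₁ U)
          (lastIndex-injective ordered α∈ α₀∈αs (Fin.toℕ-injective eq)) (Mem.∈-map⁺ proj₁ q)))

      greedy′ : ∀ {α γ} → γ ∈ βs ⊎ γ ∈ [ β ] → α ∈ αs → Reaches γ α →
                (∃[ β′ ] (α , β′) ∈ U ∷ʳ (α₀ , β) × first β′ Fin.< first γ) ⊎
                (∃[ α′ ] (α′ , γ) ∈ U ∷ʳ (α₀ , β) × lastIndex α′ Fin.≤ lastIndex α)
      greedy′ (inj₁ γ∈) α∈ r = ⊎-map (λ (β′ , q , lt) → β′ , Mem.∈-++⁺ˡ q , lt)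
                                     (λ (α′ , q , le) → α′ , Mem.∈-++⁺ˡ q , le) (greedy γ∈ α∈ r)
      greedy′ {α} (inj₂ (here refl)) α∈ r with α ∈ᴿ? map proj₁ U
      ... | yes α∈U = let β′ , q , lt = used α∈U in inj₁ (β′ , Mem.∈-++⁺ˡ q , proj₁ lt)
      ... | no  α∉U = inj₂ (α₀ , Mem.∈-++⁺ʳ U (here refl) ,
        [ (λ { refl → ℕ.≤-refl }) , (λ α₀<α → ℕ.<⇒≤ (before⇒last< α₀<α)) ]′
          (least (candidate⁺ U member α∈ r α∉U)))

  links-greedy : ∀ βs → AllPairs _⊏_ βs → All HasPredecessor βs → IsGreedy βs (links βs)
  links-greedy = foldl-ind (λ βs U → AllPairs _⊏_ βs → All HasPredecessor βs → IsGreedy βs U)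
    (λ _ _ → record { linked = λ () ; targets = refl ; sorted = [] ; greedy = λ () })
    λ βs β U ih βs-sorted preds →
      let sorted , _ , below = allPairs-++⁻ βs βs-sorted
      in link-greedy βs β U (ih sorted (All.++⁻ˡ βs preds)) (All.++⁻ˡ βs preds)
           (All.head (All.++⁻ʳ βs preds)) (All.map All.head below)

-- Connectedness makes a root meet its left neighbour, and as last indices increase along the list,
-- no last index lies between those of the two.
predecessor : {αs : List (Root B n)} (positive : All IsPositive αs) (ordered : AllPairs Before αs) →
              Linked Meet αs → ∀ {β} → single β ∈ αs → ¬ head αs ≡ just (single β) →
              ULinks.HasPredecessor αs positive ordered β
predecessor {n} {αs} positive ordered linked {β} β∈ not-head =
  let γ , γ∈ , γ<β , touch , greatest = go positive ordered linked β∈ not-head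
  in record { member = β∈ ; predecessor = γ ; pred∈ = γ∈ ; reaches = γ<β , touch ; greatest = greatest }
  where
  meet⇒touch : ∀ {α} → IsPositive α → Meet α (single β) → first β Fin.≤ lastIndex α
  meet⇒touch α⁺ (k , nz , eq) =
    ℕ.≤-trans (proj₁ (coeff-single {B} {n} {first β} {last β} k (nz ∘ trans eq))) (coeff-nonzero⇒ α⁺ k nz)
  go : ∀ {αs} → All IsPositive αs → AllPairs Before αs → Linked Meet αs → single β ∈ αs →
       ¬ head αs ≡ just (single β) →
       ∃[ γ ] γ ∈ αs × lastIndex γ Fin.< last β × first β Fin.≤ lastIndex γ ×
              (∀ {α} → α ∈ αs → lastIndex α Fin.< last β → lastIndex α Fin.≤ lastIndex γ)
  go {x ∷ []} _ _ _ (here refl) h = contradiction refl h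
  go {x ∷ y ∷ αs} _ _ _ (here refl) h = contradiction refl h
  go {x ∷ y ∷ αs} (x⁺ ∷ _) ((x<y ∷ _) ∷ (y< ∷ _)) (m ∷ _) (there (here refl)) h =
    x , here refl , before⇒last< x<y , meet⇒touch x⁺ m , λ where
      (here refl)         _  → ℕ.≤-refl
      (there (here refl)) lt → contradiction lt (ℕ.<-irrefl refl)
      (there (there z∈))  lt → contradiction lt (ℕ.<-asym (before⇒last< (All.lookup y< z∈)))
  go {x ∷ y ∷ αs} (_ ∷ ⁺s) (x< ∷ y-ordered@(y< ∷ _)) (_ ∷ l) (there β∈@(there β∈′)) h =
    let γ , γ∈ , γ<β , touch , greatest = go ⁺s y-ordered l β∈ (λ { refl → ℕ.<-irrefl refl (before⇒last< (All.lookup y< β∈′)) })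
    in γ , there γ∈ , γ<β , touch , λ where
      (here refl) _ → ℕ.<⇒≤ (before⇒last< (All.lookup x< γ∈))
      (there z∈)    → greatest z∈

-- Splitting antichains into double roots and intervals; nested pairs

open Interval
open Double renaming (last to lastᴰ)

∈-intervals⁻ : {xs : List (Root Ψ n)} → ∀ {β} → β ∈ intervals xs → single β ∈ xs
∈-intervals⁻ {xs = single α ∷ xs} (here refl) = here refl
∈-intervals⁻ {xs = single α ∷ xs} (there β∈)  = there (∈-intervals⁻ β∈)
∈-intervals⁻ {xs = double α ∷ xs} β∈          = there (∈-intervals⁻ β∈)

∈-intervals⁺ : {xs : List (Root Ψ n)} → ∀ {β} → single β ∈ xs → β ∈ intervals xs
∈-intervals⁺ {xs = single α ∷ xs} (here refl) = here refl
∈-intervals⁺ {xs = single α ∷ xs} (there β∈)  = there (∈-intervals⁺ β∈)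
∈-intervals⁺ {xs = double α ∷ xs} (there β∈)  = ∈-intervals⁺ β∈

∈-doubles⁻ : {xs : List (Root B n)} → ∀ {δ} → δ ∈ doubles xs → double δ ∈ xs
∈-doubles⁻ {xs = double α ∷ xs} (here refl) = here refl
∈-doubles⁻ {xs = double α ∷ xs} (there δ∈)  = there (∈-doubles⁻ δ∈)
∈-doubles⁻ {xs = single α ∷ xs} δ∈          = there (∈-doubles⁻ δ∈)

∈-doubles⁺ : {xs : List (Root B n)} → ∀ {δ} → double δ ∈ xs → δ ∈ doubles xs
∈-doubles⁺ {xs = double α ∷ xs} (here refl) = here refl
∈-doubles⁺ {xs = double α ∷ xs} (there δ∈)  = there (∈-doubles⁺ δ∈)
∈-doubles⁺ {xs = single α ∷ xs} (there δ∈)  = ∈-doubles⁺ δ∈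

intervals-sorted : {xs : List (Root Ψ n)} → AllPairs Before xs → AllPairs _⊏_ (intervals xs)
intervals-sorted {xs = []}            []       = []
intervals-sorted {xs = single α ∷ xs} (p ∷ ps) =
  All.tabulate (λ β∈ → case All.lookup p (∈-intervals⁻ β∈) of λ { (single-single i<k j<l) → i<k , j<l })
  ∷ intervals-sorted ps
intervals-sorted {xs = double α ∷ xs} (p ∷ ps) = intervals-sorted ps

doubles-sorted : {xs : List (Root B n)} → AllPairs Before xs → AllPairs _⊐_ (doubles xs)
doubles-sorted {xs = []}            []       = []
doubles-sorted {xs = double α ∷ xs} (p ∷ ps) =
  All.tabulate (λ β∈ → case All.lookup p (∈-doubles⁻ β∈) of λ { (double-double l<j i<k) → l<j , i<k })
  ∷ doubles-sorted ps
doubles-sorted {xs = single α ∷ xs} (p ∷ ps) = doubles-sorted ps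

intervals-valid : {xs : List (Root Ψ n)} → All IsPositive xs → All Valid (intervals xs)
intervals-valid pos = All.tabulate λ β∈ → case All.lookup pos (∈-intervals⁻ β∈) of λ { (single v) → v }

roots-of : List (Double n) → List (Interval n) → List (Root B n)
roots-of ds is = map double ds ++ map single is

singles-only : (xs : List (Root B n)) → doubles xs ≡ [] → map single (intervals xs) ≡ xs
singles-only []              _  = refl
singles-only (single α ∷ xs) eq = cong (single α ∷_) (singles-only xs eq)

-- By the constructors of `Before` nothing but intervals can follow an interval, so the double roots
-- form an initial segment.
roots-split : {xs : List (Root B n)} → AllPairs Before xs → roots-of (doubles xs) (intervals xs) ≡ xs
roots-split {xs = []}            []       = refl
roots-split {xs = double α ∷ xs} (p ∷ ps) = cong (double α ∷_) (roots-split ps)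
roots-split {xs = single α ∷ xs} (p ∷ ps) = trans (cong (λ ds → roots-of ds (intervals (single α ∷ xs))) (none xs p))
                                                (cong (single α ∷_) (singles-only xs (none xs p)))
  where
  none : ∀ xs → All (Before (single α)) xs → doubles xs ≡ []
  none []              []       = refl
  none (single β ∷ xs) (_ ∷ ps) = none xs ps

intervals-of : (ds : List (Double n)) (is : List (Interval n)) → intervals (roots-of ds is) ≡ is
intervals-of (d ∷ ds) is       = intervals-of ds is
intervals-of []       []       = refl
intervals-of []       (i ∷ is) = cong (i ∷_) (intervals-of [] is)

doubles-of : (ds : List (Double n)) (is : List (Interval n)) → doubles (roots-of ds is) ≡ ds
doubles-of (d ∷ ds) is       = cong (d ∷_) (doubles-of ds is)
doubles-of []       []       = refl
doubles-of []       (i ∷ is) = doubles-of [] is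

uppers-↭ : (xs : List (Root B n)) → uppers xs ↭ map lastDouble (doubles xs) ++ map lastIndex xs
uppers-↭ [] = ↭-refl
uppers-↭ (single α ∷ xs) = ↭-trans (↭-prep _ (uppers-↭ xs))
  (↭-sym (Perm.shift (last α) (map lastDouble (doubles xs)) (map lastIndex xs)))
uppers-↭ (double α ∷ xs) = ↭-prep _ (↭-trans (↭-prep _ (uppers-↭ xs))
  (↭-sym (Perm.shift (lastᴰ α) (map lastDouble (doubles xs)) (map lastIndex xs))))

lastIndices-of : (ds : List (Double n)) (is : List (Interval n)) →
                 map lastIndex (roots-of ds is) ≡ map lastᴰ ds ++ map last is
lastIndices-of (d ∷ ds) is       = cong (lastᴰ d ∷_) (lastIndices-of ds is)
lastIndices-of []       []       = refl
lastIndices-of []       (i ∷ is) = cong (last i ∷_) (lastIndices-of [] is)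

uppers-of : (ds : List (Double n)) (is : List (Interval n)) →
            uppers (roots-of ds is) ↭ map lastDouble ds ++ map lastᴰ ds ++ map last is
uppers-of ds is = ↭-trans (uppers-↭ (roots-of ds is))
  (↭-reflexive (cong₂ _++_ (cong (map lastDouble) (doubles-of ds is)) (lastIndices-of ds is)))

record IsNesting (ℓ r : ℕ) (ts : List (Fin n)) (ps : List (Double n)) (rest : List (Fin n)) : Set where
  field
    elements    : map lastDouble ps ++ map lastᴰ ps ++ rest ↭ ts
    length-ps   : length ps ≡ ℓ
    length-rest : length rest ≡ r
    positive    : All (λ δ → lastDouble δ Fin.< lastᴰ δ) ps
    inner       : All (λ δ → All (λ t → lastDouble δ Fin.< t × t Fin.< lastᴰ δ) rest) ps
    nested      : AllPairs (flip _⊐_) ps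

-- The length keeps `nest` from running out of elements, so it makes exactly `ℓ` pairs. Each pair
-- consists of the two ends of a sorted list, and all later elements lie strictly between them.
nest-nesting : {αs : List (Root B n)} → ∀ ℓ {r} ts → AllPairs Fin._<_ ts → length ts ≡ (ℓ + ℓ) + r →
               IsNesting ℓ r ts (proj₁ (Linking.nest αs ℓ ts)) (proj₂ (Linking.nest αs ℓ ts))
nest-nesting zero ts _ len = record
  { elements = ↭-refl ; length-ps = refl ; length-rest = len ; positive = [] ; inner = [] ; nested = [] }
nest-nesting {αs = αs} (suc ℓ) {r} (t ∷ ts) (t< ∷ sorted) len with initLast ts
... | [] with () ← trans (ℕ.suc-injective len) (cong (_+ r) (ℕ.+-suc ℓ ℓ))
... | us ∷ʳ′ t′ = record
  { elements    = begin
      t ∷ (map lastDouble ps ++ t′ ∷ (map lastᴰ ps ++ rest))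
        ↭⟨ ↭-prep t (Perm.shift t′ (map lastDouble ps) (map lastᴰ ps ++ rest)) ⟩
      t ∷ t′ ∷ (map lastDouble ps ++ map lastᴰ ps ++ rest)
        ↭⟨ ↭-prep t (↭-prep t′ elements) ⟩
      t ∷ t′ ∷ us
        ↭⟨ ↭-prep t (Perm.∷↭∷ʳ t′ us) ⟩
      t ∷ us ∷ʳ t′ ∎
  ; length-ps   = cong suc length-ps
  ; length-rest = length-rest
  ; positive    = All.head (All.++⁻ʳ us t<) ∷ positive
  ; inner       = All.tabulate (λ s∈ → between (rest⊆ s∈)) ∷ inner
  ; nested      = All.tabulate (λ δ∈ → proj₁ (between (left⊆ (Mem.∈-map⁺ lastDouble δ∈))) ,
                                       proj₂ (between (right⊆ (Mem.∈-map⁺ lastᴰ δ∈)))) ∷ nested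
  }
  where
  split = allPairs-++⁻ us sorted
  length-us : length us ≡ (ℓ + ℓ) + r
  length-us = ℕ.suc-injective (trans (sym (ℕ.+-comm (length us) 1))
    (trans (sym (List.length-++ us)) (trans (ℕ.suc-injective len) (cong (_+ r) (ℕ.+-suc ℓ ℓ)))))
  ps = proj₁ (Linking.nest αs ℓ us)
  rest = proj₂ (Linking.nest αs ℓ us)
  open IsNesting (nest-nesting {αs = αs} ℓ us (proj₁ split) length-us)
  open Perm.PermutationReasoning
  between : ∀ {s} → s ∈ us → t Fin.< s × s Fin.< t′
  between s∈ = All.lookup (All.++⁻ˡ us t<) s∈ , All.head (All.lookup (proj₂ (proj₂ split)) s∈)
  left⊆ : ∀ {s} → s ∈ map lastDouble ps → s ∈ us
  left⊆ s∈ = Perm.∈-resp-↭ elements (Mem.∈-++⁺ˡ s∈)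
  right⊆ : ∀ {s} → s ∈ map lastᴰ ps → s ∈ us
  right⊆ s∈ = Perm.∈-resp-↭ elements (Mem.∈-++⁺ʳ (map lastDouble ps) (Mem.∈-++⁺ˡ s∈))
  rest⊆ : ∀ {s} → s ∈ rest → s ∈ us
  rest⊆ s∈ = Perm.∈-resp-↭ elements (Mem.∈-++⁺ʳ (map lastDouble ps) (Mem.∈-++⁺ʳ (map lastᴰ ps) s∈))

module _ {D I Z : Set} (_≟_ : DecidableEquality D) (g : D × I → Z) where

  private
    bucket : List (D × I) → D → List Z
    bucket L d = map g (filter (λ (d′ , _) → d′ ≟ d) L)

    absent : ∀ d₀ i L Ds → d₀ ∉ Ds → concatMap (bucket ((d₀ , i) ∷ L)) Ds ≡ concatMap (bucket L) Ds
    absent d₀ i L []       _   = refl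
    absent d₀ i L (d ∷ Ds) d₀∉ with d₀ ≟ d
    ... | yes refl = contradiction (here refl) d₀∉
    ... | no  _    = cong (bucket L d ++_) (absent d₀ i L Ds (d₀∉ ∘ there))

    insert : ∀ d₀ i L Ds → Unique Ds → d₀ ∈ Ds →
             concatMap (bucket ((d₀ , i) ∷ L)) Ds ↭ g (d₀ , i) ∷ concatMap (bucket L) Ds
    insert d₀ i L (d ∷ Ds) (d∉ ∷ u) d₀∈ with d₀ ≟ d
    ... | yes refl = ↭-prep _ (↭-reflexive (cong (bucket L d ++_) (absent d₀ i L Ds (λ p → All.lookup d∉ p refl))))
    ... | no  d₀≢d = ↭-trans
      (Perm.++⁺ˡ (bucket L d) (insert d₀ i L Ds u (Any.tail d₀≢d d₀∈)))
      (Perm.shift (g (d₀ , i)) (bucket L d) (concatMap (bucket L) Ds))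

    empty : ∀ Ds → concatMap (bucket []) Ds ≡ []
    empty []       = refl
    empty (d ∷ Ds) = empty Ds

  -- For `lIntersections`, which collects the links double root by double root: each link falls into
  -- exactly one bucket, so the regrouping only permutes.
  buckets-↭ : ∀ L Ds → Unique Ds → (∀ {d i} → (d , i) ∈ L → d ∈ Ds) →
              concatMap (λ d → map g (filter (λ (d′ , _) → d′ ≟ d) L)) Ds ↭ map g L
  buckets-↭ []            Ds u ⊆ = ↭-reflexive (empty Ds)
  buckets-↭ ((d , i) ∷ L) Ds u ⊆ = ↭-trans (insert d i L Ds u (⊆ (here refl)))
                                           (↭-prep _ (buckets-↭ L Ds u (⊆ ∘ there)))

without-↭ : (_≟_ : DecidableEquality X) → let open DecMembership _≟_ using (_∈?_) in
            {xs ys : List X} → Unique xs → Unique ys → (∀ {y} → y ∈ ys → y ∈ xs) →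
            filter (λ x → ¬? (x ∈? ys)) xs ++ ys ↭ xs
without-↭ _≟_ {xs} {ys} u v ys⊆ = unique-↭
  (Unique.++⁺ (Unique.filter⁺ out? u) v λ (p , q) → proj₂ (Mem.∈-filter⁻ out? {xs = xs} p) q) u
  (λ p → [ (λ q → proj₁ (Mem.∈-filter⁻ out? {xs = xs} q)) , ys⊆ ]′ (Mem.∈-++⁻ (filter out? xs) p))
  (λ {x} p → case x ∈? ys of λ where
    (yes q) → Mem.∈-++⁺ʳ (filter out? xs) q
    (no ¬q) → Mem.∈-++⁺ˡ (Mem.∈-filter⁺ out? p ¬q))
  where
  open DecMembership _≟_ using (_∈?_)
  out? = λ x → ¬? (x ∈? ys)

-- The endpoints used by the links and those left in T

open Interval
open Double renaming (last to lastᴰ)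

-- For a positive first index the arc of `γ` starts one point before `first γ`, so the excluded
-- points are those strictly under the arc.
Clear : Interval n → Pred (Fin n) 0ℓ
Clear γ t = ¬ (first γ Fin.≤ t × t Fin.< last γ)

-- In between, γ has first index 1 and is the arc from -t to t.
record Unspanned (δ : Double n) (γ : Interval n) : Set where
  field
    clear-left  : 1 ≤ toℕ (first γ) → Clear γ (lastDouble δ)
    clear-right : 1 ≤ toℕ (first γ) → Clear γ (lastᴰ δ)
    between     : toℕ (first γ) ≡ 0 → lastDouble δ Fin.< last γ × last γ Fin.< lastᴰ δ

-- The counterpart of `Untangles` in the presence of double roots. Two pairs of arcs coming from
-- double roots avoid each other when they are nested. The field `no-doubles` serves the gluing of
-- components, of which only the first can contain double roots.
record Rearranges (αs G : List (Root B n)) : Set where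
  field
    firsts-↭   : map first (intervals G) ↭ map first (intervals αs)
    uppers-≈   : uppers G ↭ uppers αs
    positive   : All IsPositive G
    uncrossed  : ∀ {γ γ′} → single γ ∈ G → single γ′ ∈ G → ¬ Crossing γ γ′
    unspanned  : ∀ {δ γ} → double δ ∈ G → single γ ∈ G → Unspanned δ γ
    nested     : ∀ {δ η} → double δ ∈ G → double η ∈ G → lastDouble δ Fin.< lastDouble η → lastᴰ η Fin.< lastᴰ δ
    no-doubles : doubles αs ≡ [] → doubles G ≡ []

-- Along an antichain last double indices decrease and last indices increase, and in each double
-- root the former is the smaller one. Hence the two kinds of indices never mix.
lastDouble<last : {αs : List (Root B n)} → All IsPositive αs → AllPairs Before αs →
                  ∀ {δ α} → double δ ∈ αs → α ∈ αs → lastDouble δ Fin.< lastIndex α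
lastDouble<last pos ord δ∈ α∈ with allPairs-compare ord δ∈ α∈ | All.lookup pos δ∈ | All.lookup pos α∈
... | inj₁ refl                              | double j<i | _ = j<i
... | inj₂ (inj₁ δ<α)                        | double j<i | _ = ℕ.<-trans j<i (before⇒last< δ<α)
... | inj₂ (inj₂ (double-double l<j i<k)) | _ | double l<k = ℕ.<-trans l<j l<k

uShape : Root B n × Interval n → Interval n
uShape (α , β) = [ first β ⋯ lastIndex α ]

lShape : Double n × Interval n → Interval n
lShape (δ , β) = [ first β ⋯ lastDouble δ ]

One : Pred (Interval n) 0ℓ
One β = toℕ (first β) ≡ 0

one? : Decidable (One {n})
one? β = toℕ (first β) ℕ.≟ 0

admissible? : (L : List (Link n)) → Decidable (λ β → ¬ One β × ¬ β ∈ map proj₂ L)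
admissible? L β = ¬? (one? β) ×-dec ¬? (β ∈ᴵ? map proj₂ L)
  where open DecMembership _≟ᴵ_ using () renaming (_∈?_ to _∈ᴵ?_)

-- What Linking computes from αs, with its properties. (The proofs about it
-- would otherwise unfold the algorithm.)
record LinkData (αs : List (Root B n)) (positive : All IsPositive αs) (ordered : AllPairs Before αs) : Set where
  field
    lLinks               : List (Link n)
    lGreedy              : LLinks.IsGreedy (doubles αs) (doubles-sorted ordered) (intervals αs) lLinks
    uLinks               : List (Root B n × Interval n)
    uGreedy              : ULinks.IsGreedy αs positive ordered (filter (admissible? lLinks) (intervals αs)) uLinks
    lIntersections       : List (Interval n)
    lIntersections-shape : lIntersections ↭ map lShape lLinks
    uIntersections       : List (Interval n)
    uIntersections-shape : uIntersections ≡ map uShape uLinks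
    H                    : List (Interval n)
    H-untangles          : Untangles uIntersections H

module Value {n : ℕ} {αs : List (Root B n)} {positive : All IsPositive αs} {ordered : AllPairs Before αs}
             (d : LinkData αs positive ordered) where

  open LinkData d public
  open DecMembership (_≟ᴵ_ {n}) using () renaming (_∈?_ to _∈ᴵ?_)
  open DecMembership (_≟ᴰ_ {n}) using () renaming (_∈?_ to _∈ᴰ?_)
  open DecMembership (_≟ᴿ_ {B} {n}) using () renaming (_∈?_ to _∈ᴿ?_)
  open DecMembership (Fin._≟_ {n}) using () renaming (_∈?_ to _∈ᶠ?_)

  module L = LLinks.IsGreedy lGreedy
  module U = ULinks.IsGreedy uGreedy
  module H = Untangles H-untangles

  Γd : List (Double n)
  Γd = doubles αs

  Γ : List (Interval n)
  Γ = intervals αs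

  Γd-sorted : AllPairs _⊐_ Γd
  Γd-sorted = doubles-sorted ordered

  Γ-sorted : AllPairs _⊏_ Γ
  Γ-sorted = intervals-sorted ordered

  Adm : List (Interval n)
  Adm = filter (admissible? lLinks) Γ

  Adm⁻ : ∀ {β} → β ∈ Adm → β ∈ Γ × ¬ One β × β ∉ map proj₂ lLinks
  Adm⁻ = Mem.∈-filter⁻ (admissible? lLinks) {xs = Γ}

  movable : {β : Interval n} → ¬ One β → 1 ≤ toℕ (first β)
  movable = ℕ.n≢0⇒n>0

  unmovable : {β : Interval n} → One β → ¬ 1 ≤ toℕ (first β)
  unmovable eq m = ℕ.<⇒≢ m (sym eq)

  unique-⊐ : AllPairs _⊐_ Γd → Unique Γd
  unique-⊐ = AllPairs.map λ { (lt , _) refl → ℕ.<-irrefl refl lt }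

  unique-⊏ : ∀ {βs : List (Interval n)} → AllPairs _⊏_ βs → Unique βs
  unique-⊏ = AllPairs.map λ { (lt , _) refl → ℕ.<-irrefl refl lt }

  unique-αs : Unique αs
  unique-αs = AllPairs.map (λ { x<y refl → ℕ.<-irrefl refl (before⇒last< x<y) }) ordered

  firsts-u : map first uIntersections ≡ map first Adm
  firsts-u = trans (cong (map first) uIntersections-shape)
    (trans (sym (List.map-∘ uLinks)) (trans (List.map-∘ uLinks) (cong (map first) U.targets)))

  lasts-u : map last uIntersections ≡ map lastIndex (map proj₁ uLinks)
  lasts-u = trans (cong (map last) uIntersections-shape) (trans (sym (List.map-∘ uLinks)) (List.map-∘ uLinks))

  firsts-l : map first lIntersections ↭ map first (map proj₂ lLinks)
  firsts-l = ↭-trans (Perm.map⁺ first lIntersections-shape)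
    (↭-reflexive (trans (sym (List.map-∘ lLinks)) (List.map-∘ lLinks)))

  lasts-l : map last lIntersections ↭ map lastDouble (map proj₁ lLinks)
  lasts-l = ↭-trans (Perm.map⁺ last lIntersections-shape)
    (↭-reflexive (trans (sym (List.map-∘ lLinks)) (List.map-∘ lLinks)))

  fixed : List (Interval n)
  fixed = filter one? Γ

  unique-targets : Unique (map proj₂ lLinks)
  unique-targets = unique-⊏ (AllPairs.map⁺ L.sorted)

  -- Each interval passes its first index on to exactly one kind of root of the value: to `π₀`, to
  -- an l-intersection, or to a u-intersection.
  Γ-parts : fixed ++ map proj₂ lLinks ++ Adm ↭ Γ
  Γ-parts = unique-↭
    (Unique.++⁺ (Unique.filter⁺ one? uΓ)
      (Unique.++⁺ unique-targets (Unique.filter⁺ (admissible? lLinks) uΓ) λ (p , q) → proj₂ (proj₂ (Adm⁻ q)) p)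
      λ (p , q) → fixed-disjoint (proj₂ (Mem.∈-filter⁻ one? {xs = Γ} p)) (Mem.∈-++⁻ (map proj₂ lLinks) q))
    uΓ
    (λ p → [ (λ q → proj₁ (Mem.∈-filter⁻ one? {xs = Γ} q))
           , (λ q → [ (λ r → proj₁ (target∈ r)) , (λ r → proj₁ (Adm⁻ r)) ]′ (Mem.∈-++⁻ (map proj₂ lLinks) q)) ]′
           (Mem.∈-++⁻ fixed p))
    place
    where
    uΓ = unique-⊏ Γ-sorted
    target∈ : ∀ {β} → β ∈ map proj₂ lLinks → β ∈ Γ × 1 ≤ toℕ (first β)
    target∈ p with _ , q , refl ← Mem.∈-map⁻ proj₂ p = let _ , β∈ , m , _ = L.linked q in β∈ , m
    fixed-disjoint : ∀ {β} → One β → ¬ (β ∈ map proj₂ lLinks ⊎ β ∈ Adm)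
    fixed-disjoint {β} one (inj₁ p) = unmovable {β} one (proj₂ (target∈ p))
    fixed-disjoint one (inj₂ p) = proj₁ (proj₂ (Adm⁻ p)) one
    place : ∀ {β} → β ∈ Γ → β ∈ fixed ++ map proj₂ lLinks ++ Adm
    place {β} β∈ with one? β | β ∈ᴵ? map proj₂ lLinks
    ... | yes one | _     = Mem.∈-++⁺ˡ (Mem.∈-filter⁺ one? β∈ one)
    ... | no _    | yes p = Mem.∈-++⁺ʳ fixed (Mem.∈-++⁺ˡ p)
    ... | no ¬one | no ¬p = Mem.∈-++⁺ʳ fixed (Mem.∈-++⁺ʳ (map proj₂ lLinks)
                              (Mem.∈-filter⁺ (admissible? lLinks) β∈ (¬one , ¬p)))

  freeΓd : List (Double n)
  freeΓd = filter (λ δ → ¬? (δ ∈ᴰ? map proj₁ lLinks)) Γd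

  freeαs : List (Root B n)
  freeαs = filter (λ α → ¬? (α ∈ᴿ? map proj₁ uLinks)) αs

  freeΓd⁻ : ∀ {δ} → δ ∈ freeΓd → δ ∈ Γd × δ ∉ map proj₁ lLinks
  freeΓd⁻ = Mem.∈-filter⁻ (λ δ → ¬? (δ ∈ᴰ? map proj₁ lLinks)) {xs = Γd}

  freeαs⁻ : ∀ {α} → α ∈ freeαs → α ∈ αs × α ∉ map proj₁ uLinks
  freeαs⁻ = Mem.∈-filter⁻ (λ α → ¬? (α ∈ᴿ? map proj₁ uLinks)) {xs = αs}

  free : List (Fin n)
  free = map lastDouble freeΓd ++ map lastIndex freeαs

  unique-free : Unique free
  unique-free = Unique.++⁺
    (AllPairs.map⁺ (AllPairs.map (λ { (lt , _) eq → ℕ.<⇒≢ lt (cong toℕ (sym eq)) })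
                                 (AllPairs.filter⁺ _ Γd-sorted)))
    (AllPairs.map⁺ (AllPairs.map (λ x<y eq → ℕ.<⇒≢ (before⇒last< x<y) (cong toℕ eq))
                                 (AllPairs.filter⁺ _ ordered)))
    λ (p , q) → case Mem.∈-map⁻ lastDouble p , Mem.∈-map⁻ lastIndex q of λ where
      ((δ , δ∈ , refl) , (α , α∈ , eq)) →
        ℕ.<⇒≢ (lastDouble<last positive ordered (∈-doubles⁻ (proj₁ (freeΓd⁻ δ∈))) (proj₁ (freeαs⁻ α∈)))
              (cong toℕ eq)

  T : List (Fin n)
  T = filter (_∈ᶠ? free) (allFin n)

  T-sorted : AllPairs Fin._<_ T
  T-sorted = AllPairs.filter⁺ (_∈ᶠ? free) (AllPairs.tabulate⁺-< id)

  T⁻ : ∀ {t} → t ∈ T → t ∈ free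
  T⁻ t∈ = proj₂ (Mem.∈-filter⁻ (_∈ᶠ? free) {xs = allFin n} t∈)

  T-free : T ↭ free
  T-free = unique-↭ (AllPairs.map (λ { lt refl → ℕ.<-irrefl refl lt }) T-sorted) unique-free T⁻
    λ t∈ → Mem.∈-filter⁺ (_∈ᶠ? free) (Mem.∈-allFin _) t∈

  Γd-parts : freeΓd ++ map proj₁ lLinks ↭ Γd
  Γd-parts = without-↭ _≟ᴰ_ (unique-⊐ Γd-sorted) L.unique
    λ p → case Mem.∈-map⁻ proj₁ p of λ { (_ , q , refl) → proj₁ (L.linked q) }

  αs-parts : freeαs ++ map proj₁ uLinks ↭ αs
  αs-parts = without-↭ _≟ᴿ_ unique-αs
    (AllPairs.map⁺ (AllPairs.map (λ { (_ , lt) refl → ℕ.<-irrefl refl lt }) U.sorted))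
    λ p → case Mem.∈-map⁻ proj₁ p of λ { (_ , q , refl) → proj₁ (U.linked q) }

  -- An l-link uses up the last double index of its source and a u-link the last index of its
  -- source; T holds what is left.
  all-ends : T ++ map last lIntersections ++ map last H ↭ uppers αs
  all-ends = begin
    T ++ map last lIntersections ++ map last H
      ↭⟨ Perm.++⁺ T-free (Perm.++⁺ lasts-l (↭-trans H.lasts-↭ (↭-reflexive lasts-u))) ⟩
    (map lastDouble freeΓd ++ map lastIndex freeαs) ++
      (map lastDouble (map proj₁ lLinks) ++ map lastIndex (map proj₁ uLinks))
      ↭⟨ ++-interchange (map lastDouble freeΓd) _ _ _ ⟩
    (map lastDouble freeΓd ++ map lastDouble (map proj₁ lLinks)) ++
      (map lastIndex freeαs ++ map lastIndex (map proj₁ uLinks))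
      ≡⟨ cong₂ _++_ (List.map-++ lastDouble freeΓd _) (List.map-++ lastIndex freeαs _) ⟨
    map lastDouble (freeΓd ++ map proj₁ lLinks) ++ map lastIndex (freeαs ++ map proj₁ uLinks)
      ↭⟨ Perm.++⁺ (Perm.map⁺ lastDouble Γd-parts) (Perm.map⁺ lastIndex αs-parts) ⟩
    map lastDouble Γd ++ map lastIndex αs
      ↭⟨ uppers-↭ αs ⟨
    uppers αs ∎
    where open Perm.PermutationReasoning

  -- The antichain has 2ℓ + |Γ| upper ends, and each link uses up one of them together with one
  -- interval of Γ. Every interval is linked except those with first index 1. So T is exactly
  -- exhausted by the pairs of `nest` and `π₀`.
  count : length T ≡ (length Γd + length Γd) + length fixed
  count = ℕ.+-cancelʳ-≡ (length lLinks + length Adm) _ _ (begin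
    length T + (length lLinks + length Adm)
      ≡⟨ cong₂ (λ p q → length T + (p + q))
           (trans (sym (List.length-map lShape lLinks)) (trans (sym (Perm.↭-length lIntersections-shape)) (sym (List.length-map last lIntersections))))
           (trans (sym (List.length-map first Adm)) (trans (cong length (sym firsts-u))
             (trans (sym (Perm.↭-length H.firsts-↭)) (trans (List.length-map first H) (sym (List.length-map last H)))))) ⟩
    length T + (length (map last lIntersections) + length (map last H))
      ≡⟨ trans (List.length-++ T) (cong (λ m → length T + m) (List.length-++ (map last lIntersections))) ⟨
    length (T ++ map last lIntersections ++ map last H)
      ≡⟨ Perm.↭-length (↭-trans all-ends (uppers-↭ αs)) ⟩
    length (map lastDouble Γd ++ map lastIndex αs)
      ≡⟨ trans (List.length-++ (map lastDouble Γd)) (cong₂ _+_ (List.length-map lastDouble Γd) (List.length-map lastIndex αs)) ⟩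
    length Γd + length αs
      ≡⟨ cong (λ xs → length Γd + length xs) (roots-split ordered) ⟨
    length Γd + length (roots-of Γd Γ)
      ≡⟨ cong (λ m → length Γd + m) (trans (List.length-++ (map double Γd)) (cong₂ _+_ (List.length-map double Γd) (List.length-map single Γ))) ⟩
    length Γd + (length Γd + length Γ)
      ≡⟨ cong (λ m → length Γd + (length Γd + m)) (trans (sym (Perm.↭-length Γ-parts))
           (trans (List.length-++ fixed) (cong (λ m → length fixed + m) (trans (List.length-++ (map proj₂ lLinks))
             (cong (λ m → m + length Adm) (List.length-map proj₂ lLinks)))))) ⟩
    length Γd + (length Γd + (length fixed + (length lLinks + length Adm)))
      ≡⟨ ℕ.+-assoc (length Γd) (length Γd) _ ⟨
    (length Γd + length Γd) + (length fixed + (length lLinks + length Adm))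
      ≡⟨ ℕ.+-assoc (length Γd + length Γd) (length fixed) _ ⟨
    ((length Γd + length Γd) + length fixed) + (length lLinks + length Adm) ∎)
    where open ≡-Reasoning

from-r₂-suc : (k : Fin n) → 1 ≤ toℕ k → from-r₂ k ≡ k
from-r₂-suc {suc (suc _)} (suc k) _ = refl

map-cong-∈ : {g h : X → Y} (xs : List X) → (∀ {x} → x ∈ xs → g x ≡ h x) → map g xs ≡ map h xs
map-cong-∈ []       eq = refl
map-cong-∈ (x ∷ xs) eq = cong₂ _∷_ (eq (here refl)) (map-cong-∈ xs (eq ∘ there))

module _ {n : ℕ} {αs : List (Root B n)} {positive : All IsPositive αs} {ordered : AllPairs Before αs}
         {lLinks : List (Link n)} (lGreedy : LLinks.IsGreedy (doubles αs) (doubles-sorted ordered) (intervals αs) lLinks)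
         {uLinks : List (Root B n × Interval n)}
         (uGreedy : ULinks.IsGreedy αs positive ordered (filter (admissible? lLinks) (intervals αs)) uLinks) where

  private
    module L = LLinks.IsGreedy lGreedy
    module U = ULinks.IsGreedy uGreedy
    open NaturalMax (Fin.≤-totalOrder n) using (x≤y⇒x⊔y≈y)
    open NaturalMin (Fin.≤-totalOrder n) using (x≤y⇒x⊓y≈x)

    uInter lInter : List (Interval n)
    uInter = map (λ (α , β) → α ∩ β) uLinks
    lInter = concatMap (λ α → map (λ (α , β) → α ∩ᵈ β) (filter (λ (α′ , _) → α′ ≟ᴰ α) lLinks)) (reverse (doubles αs))

    uShape-∩ : ∀ {α β} → (α , β) ∈ uLinks → α ∩ β ≡ uShape (α , β)
    uShape-∩ {α} {β} p with α∈ , β∈ , (lt , _) ← U.linked p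
      with last<⇒before ordered α∈ (∈-intervals⁻ (proj₁ (Mem.∈-filter⁻ (admissible? lLinks) {xs = intervals αs} β∈))) lt
    ... | single-single i<k _ = cong₂ [_⋯_] (x≤y⇒x⊔y≈y (ℕ.<⇒≤ i<k)) (x≤y⇒x⊓y≈x (ℕ.<⇒≤ lt))
    ... | double-single _     = cong [ first β ⋯_] (x≤y⇒x⊓y≈x (ℕ.<⇒≤ lt))

    lShape-∩ : ∀ {δ β} → (δ , β) ∈ lLinks → δ ∩ᵈ β ≡ lShape (δ , β)
    lShape-∩ {δ} {β} p with δ∈ , β∈ , m , _ ← L.linked p =
      cong₂ [_⋯_] (from-r₂-suc (first β) m)
        (x≤y⇒x⊓y≈x (ℕ.<⇒≤ (lastDouble<last positive ordered (∈-doubles⁻ δ∈) (∈-intervals⁻ β∈))))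

    uInter-shape : uInter ≡ map uShape uLinks
    uInter-shape = map-cong-∈ uLinks uShape-∩

  linkData : LinkData αs positive ordered
  linkData = record
    { lGreedy              = lGreedy
    ; uGreedy              = uGreedy
    ; lIntersections       = lInter
    ; lIntersections-shape = ↭-trans
        (buckets-↭ _≟ᴰ_ (λ (δ , β) → δ ∩ᵈ β) lLinks (reverse (doubles αs))
          (↭-unique (↭-sym (Perm.↭-reverse (doubles αs)))
            (AllPairs.map (λ { (lt , _) refl → ℕ.<-irrefl refl lt }) (doubles-sorted ordered)))
          (λ p → Perm.∈-resp-↭ (↭-sym (Perm.↭-reverse (doubles αs))) (proj₁ (L.linked p))))
        (↭-reflexive (map-cong-∈ lLinks lShape-∩))
    ; uIntersections       = uInter
    ; uIntersections-shape = uInter-shape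
    ; H                    = untangle B n (length uInter) uInter
    ; H-untangles          = untangle-untangles B n _ uInter ℕ.≤-refl
        (subst (All Valid) (sym uInter-shape) (All.map⁺ (All.tabulate λ p → proj₂ (proj₂ (proj₂ (U.linked p))))))
        (subst (AllPairs _⊏_) (sym uInter-shape) (AllPairs.map⁺ U.sorted))
    }

-- The roots of the value on a connected antichain with double roots

open Interval
open Double renaming (last to lastᴰ)

pick : List (Interval n) → List (Fin n) → List (Interval n)
pick (β ∷ _) (t ∷ []) = if does (one? β) then [ [ first β ⋯ t ] ] else []
pick _       _        = []

initial : List (Interval n) → List (Interval n)
initial []      = []
initial (β ∷ _) = if does (one? β) then [ β ] else []

-- First indices strictly increase, so only the first interval can have first index 1.
filter-initial : {βs : List (Interval n)} → AllPairs _⊏_ βs → filter one? βs ≡ initial βs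
filter-initial [] = refl
filter-initial {βs = β ∷ βs} (above ∷ _) with toℕ (first β) ℕ.≡ᵇ 0
... | true  = cong (β ∷_) (List.filter-none one? (All.map (λ { (lt , _) eq → ℕ.n≮0 (subst (_ <_) eq lt) }) above))
... | false = List.filter-none one? (All.map (λ { (lt , _) eq → ℕ.n≮0 (subst (_ <_) eq lt) }) above)

pick-lasts : (βs : List (Interval n)) (ts : List (Fin n)) → length ts ≡ length (initial βs) →
             map last (pick βs ts) ≡ ts
pick-lasts []                 []       _ = refl
pick-lasts ([ zero  ⋯ l ] ∷ _) (t ∷ []) _ = refl
pick-lasts ([ suc k ⋯ l ] ∷ _) []       _ = refl

pick-firsts : (βs : List (Interval n)) (ts : List (Fin n)) → length ts ≡ length (initial βs) →
              map first (pick βs ts) ≡ map first (initial βs)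
pick-firsts []                 []       _ = refl
pick-firsts ([ zero  ⋯ l ] ∷ _) (t ∷ []) _ = refl
pick-firsts ([ suc k ⋯ l ] ∷ _) []       _ = refl

pick∈ : (βs : List (Interval n)) (ts : List (Fin n)) → ∀ {γ} → γ ∈ pick βs ts → toℕ (first γ) ≡ 0 × last γ ∈ ts
pick∈ ([ zero ⋯ l ] ∷ _) (t ∷ []) (here refl) = refl , here refl

π₀-pick : (αs : List (Root B n)) → Linking.π₀ αs ≡
          pick (Linking.Γ αs) (proj₂ (Linking.nest αs (length (Linking.Γd αs)) (Linking.T αs)))
π₀-pick αs with Linking.Γ αs | proj₂ (Linking.nest αs (length (Linking.Γd αs)) (Linking.T αs))
... | []    | []        = refl
... | []    | _ ∷ _     = refl
... | _ ∷ _ | []        = refl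
... | _ ∷ _ | _ ∷ []    = refl
... | _ ∷ _ | _ ∷ _ ∷ _ = refl

module ValueDiagram {n : ℕ} {αs : List (Root B n)} {positive : All IsPositive αs} {ordered : AllPairs Before αs}
                    (d : LinkData αs positive ordered)
                    {πs : List (Double n)} {rest : List (Fin n)}
                    (nesting : IsNesting (length (doubles αs)) (length (Value.fixed d)) (Value.T d) πs rest)
                    {π₀ : List (Interval n)} (lasts-π₀ : map last π₀ ≡ rest)
                    (firsts-π₀ : map first π₀ ≡ map first (Value.fixed d))
                    (π₀∈ : ∀ {γ} → γ ∈ π₀ → toℕ (first γ) ≡ 0 × last γ ∈ rest)
                    (head-double : ∃[ δ ] head αs ≡ just (double δ)) where

  open Value d
  module N = IsNesting nesting

  data LView : Interval n → Set where
    shape : ∀ {δ β} → (δ , β) ∈ lLinks → LView (lShape (δ , β))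

  lView : ∀ {γ} → γ ∈ lIntersections → LView γ
  lView γ∈ with _ , p , refl ← Mem.∈-map⁻ lShape (Perm.∈-resp-↭ lIntersections-shape γ∈) = shape p

  l-target-unique : ∀ {δ δ′ β} → (δ , β) ∈ lLinks → (δ′ , β) ∈ lLinks → δ ≡ δ′
  l-target-unique p q with allPairs-compare L.sorted p q
  ... | inj₁ refl              = refl
  ... | inj₂ (inj₁ (lt , _)) = contradiction lt (ℕ.<-irrefl refl)
  ... | inj₂ (inj₂ (lt , _)) = contradiction lt (ℕ.<-irrefl refl)

  l-source-unique : ∀ {δ β β′} → (δ , β) ∈ lLinks → (δ , β′) ∈ lLinks → β ≡ β′
  l-source-unique p q = cong proj₂ (unique-map⇒injective L.unique p q refl)

  l<last : ∀ {δ β α} → (δ , β) ∈ lLinks → α ∈ αs → lastDouble δ Fin.< lastIndex α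
  l<last p = lastDouble<last positive ordered (∈-doubles⁻ (proj₁ (L.linked p)))

  -- A last index is too large to lie under an l-intersection. The last double index of an unlinked
  -- root under it would make that root reach `β`, and the greedy choice would have given `β` a
  -- source with last double index at most `t`.
  lShape-clear : ∀ {δ β t} → (δ , β) ∈ lLinks → t ∈ free → Clear (lShape (δ , β)) t
  lShape-clear p t∈ (β≤t , t<δ) with Mem.∈-++⁻ (map lastDouble freeΓd) t∈
  ... | inj₂ q with α , α∈ , refl ← Mem.∈-map⁻ lastIndex q =
    ℕ.<-asym t<δ (l<last p (proj₁ (freeαs⁻ α∈)))
  ... | inj₁ q with δ′ , δ′∈ , refl ← Mem.∈-map⁻ lastDouble q
    with δ′∈Γd , δ′-free ← freeΓd⁻ δ′∈ | _ , β∈ , m , _ ← L.linked p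
    with L.greedy β∈ m δ′∈Γd β≤t
  ...   | inj₁ (_ , r , _) = δ′-free (Mem.∈-map⁺ proj₁ r)
  ...   | inj₂ (δ″ , r , le) with refl ← l-target-unique p r = ℕ.<⇒≱ t<δ le

  lIntersection-clear : ∀ {γ t} → γ ∈ lIntersections → t ∈ free → Clear γ t
  lIntersection-clear γ∈ t∈ with shape p ← lView γ∈ = lShape-clear p t∈

  -- The other greedy alternative would l-link `β`, which is excluded for admissible intervals.
  adm-greedy : ∀ {β δ} → β ∈ Adm → δ ∈ Γd → first β Fin.≤ lastDouble δ →
               ∃[ β′ ] (δ , β′) ∈ lLinks × first β Fin.< first β′
  adm-greedy {β} β∈ δ∈ le with β∈Γ , ¬one , β∉ ← Adm⁻ β∈ with L.greedy β∈Γ (movable {β} ¬one) δ∈ le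
  ... | inj₁ r           = r
  ... | inj₂ (_ , r , _) = contradiction (Mem.∈-map⁺ proj₂ r) β∉

  -- The right end is included here because `H` is only known to be covered by the u-intersections.
  -- A free last double index contradicts `adm-greedy`. For a free last index, the leftmost choice
  -- shows that the root it belongs to is the source `α` itself, which is linked.
  uShape-clear : ∀ {α β t} → (α , β) ∈ uLinks → t ∈ free → ¬ Contains (uShape (α , β)) t
  uShape-clear {α} p t∈ (β≤t , t≤α)
    with α∈ , β∈ , (α<β , _) ← U.linked p
    with Mem.∈-++⁻ (map lastDouble freeΓd) t∈
  ... | inj₁ q with δ′ , δ′∈ , refl ← Mem.∈-map⁻ lastDouble q
    with δ′∈Γd , δ′-free ← freeΓd⁻ δ′∈
    with _ , r , _ ← adm-greedy β∈ δ′∈Γd β≤t = δ′-free (Mem.∈-map⁺ proj₁ r)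
  ... | inj₂ q with α′ , α′∈ , refl ← Mem.∈-map⁻ lastIndex q
    with α′∈αs , α′-free ← freeαs⁻ α′∈
    with U.greedy β∈ α′∈αs (ℕ.≤-<-trans t≤α α<β , β≤t)
  ...   | inj₁ (_ , r , _) = α′-free (Mem.∈-map⁺ proj₁ r)
  ...   | inj₂ (_ , r , le) with refl ← U.target-unique p r =
    α′-free (subst (_∈ map proj₁ uLinks)
      (lastIndex-injective ordered α∈ α′∈αs (Fin.toℕ-injective (ℕ.≤-antisym le t≤α))) (Mem.∈-map⁺ proj₁ p))

  H-clear : ∀ {γ t} → γ ∈ H → t ∈ free → Clear γ t
  H-clear {γ} {t} γ∈ t∈ (≤t , t<)
    with u , u∈ , c ← find (H.covered γ∈ t (≤t , ℕ.<⇒≤ t<))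
    with _ , p , refl ← Mem.∈-map⁻ uShape (subst (u ∈_) uIntersections-shape u∈) = uShape-clear p t∈ c

  H-first : ∀ {γ} → γ ∈ H → ∃[ β ] β ∈ Adm × first γ ≡ first β
  H-first {γ} γ∈ = Mem.∈-map⁻ first (subst (first γ ∈_) firsts-u (first∈ H-untangles γ∈))

  H-last : ∀ {γ} → γ ∈ H → ∃[ α ] α ∈ αs × last γ ≡ lastIndex α
  H-last {γ} γ∈ with α , α∈ , eq ← Mem.∈-map⁻ lastIndex (subst (last γ ∈_) lasts-u (last∈ H-untangles γ∈))
    with _ , p , refl ← Mem.∈-map⁻ proj₁ α∈ = α , proj₁ (U.linked p) , eq

  links : List (Interval n)
  links = lIntersections ++ H

  links-clear : ∀ {γ t} → γ ∈ links → t ∈ free → Clear γ t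
  links-clear γ∈ = [ lIntersection-clear , H-clear ]′ (Mem.∈-++⁻ lIntersections γ∈)

  links-movable : ∀ {γ} → γ ∈ links → 1 ≤ toℕ (first γ)
  links-movable γ∈ with Mem.∈-++⁻ lIntersections γ∈
  ... | inj₁ p with shape q ← lView p = proj₁ (proj₂ (proj₂ (L.linked q)))
  ... | inj₂ p with β , β∈ , eq ← H-first p =
    subst (λ k → 1 ≤ toℕ k) (sym eq) (movable {β} (proj₁ (proj₂ (Adm⁻ β∈))))

  -- In a crossing the source of the left link also reaches the target of the right one. Then either
  -- that source is linked further right than it is, or the right target has a source with a smaller
  -- or equal last double index; the crossing contradicts both.
  l-uncrossed : ∀ {γ γ′} → γ ∈ lIntersections → γ′ ∈ lIntersections → ¬ Crossing γ γ′
  l-uncrossed γ∈ γ′∈ (lt , le , lt′) with shape p ← lView γ∈ | shape q ← lView γ′∈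
    with _ , β∈ , m , _ ← L.linked q
    with L.greedy β∈ m (proj₁ (L.linked p)) le
  ... | inj₁ (_ , r , lt″) with refl ← l-source-unique p r = ℕ.<-asym lt lt″
  ... | inj₂ (_ , r , le′) with refl ← l-target-unique q r = ℕ.<⇒≱ lt′ le′

  -- Here the source of the l-link reaches an admissible interval, so by `adm-greedy` its link
  -- starts further right than that interval, against the crossing.
  lH-uncrossed : ∀ {γ γ′} → γ ∈ lIntersections → γ′ ∈ H → ¬ Crossing γ γ′
  lH-uncrossed γ∈ γ′∈ (lt , le , _) with shape p ← lView γ∈ | β , β∈ , eq ← H-first γ′∈
    with _ , r , lt′ ← adm-greedy β∈ (proj₁ (L.linked p)) (subst (Fin._≤ _) eq le)
    with refl ← l-source-unique p r = ℕ.<-asym lt (subst (Fin._< _) (sym eq) lt′)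

  Hl-uncrossed : ∀ {γ γ′} → γ ∈ H → γ′ ∈ lIntersections → ¬ Crossing γ γ′
  Hl-uncrossed γ∈ γ′∈ (_ , _ , lt) with shape p ← lView γ′∈ | α , α∈ , eq ← H-last γ∈ =
    ℕ.<-asym (subst (Fin._< _) eq lt) (l<last p α∈)

  links-uncrossed : ∀ {γ γ′} → γ ∈ links → γ′ ∈ links → ¬ Crossing γ γ′
  links-uncrossed γ∈ γ′∈ with Mem.∈-++⁻ lIntersections γ∈ | Mem.∈-++⁻ lIntersections γ′∈
  ... | inj₁ p | inj₁ q = l-uncrossed p q
  ... | inj₁ p | inj₂ q = lH-uncrossed p q
  ... | inj₂ p | inj₁ q = Hl-uncrossed p q
  ... | inj₂ p | inj₂ q = H.uncrossed p q

  rest⊆ : ∀ {t} → t ∈ rest → t ∈ free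
  rest⊆ t∈ = T⁻ (Perm.∈-resp-↭ N.elements (Mem.∈-++⁺ʳ (map lastDouble πs) (Mem.∈-++⁺ʳ (map lastᴰ πs) t∈)))

  πs-left : ∀ {δ} → δ ∈ πs → lastDouble δ ∈ free
  πs-left δ∈ = T⁻ (Perm.∈-resp-↭ N.elements (Mem.∈-++⁺ˡ (Mem.∈-map⁺ lastDouble δ∈)))

  πs-right : ∀ {δ} → δ ∈ πs → lastᴰ δ ∈ free
  πs-right δ∈ = T⁻ (Perm.∈-resp-↭ N.elements (Mem.∈-++⁺ʳ (map lastDouble πs) (Mem.∈-++⁺ˡ (Mem.∈-map⁺ lastᴰ δ∈))))

  singles : List (Interval n)
  singles = π₀ ++ links

  singles-uncrossed : ∀ {γ γ′} → γ ∈ singles → γ′ ∈ singles → ¬ Crossing γ γ′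
  singles-uncrossed γ∈ γ′∈ x@(lt , le , lt′) with Mem.∈-++⁻ π₀ γ∈ | Mem.∈-++⁻ π₀ γ′∈
  ... | inj₂ p | inj₂ q = links-uncrossed p q x
  ... | inj₁ p | inj₂ q = links-clear q (rest⊆ (proj₂ (π₀∈ p))) (le , lt′)
  ... | _      | inj₁ q = ℕ.n≮0 (subst (_ <_) (proj₁ (π₀∈ q)) lt)

  singles-valid : All Valid singles
  singles-valid = All.++⁺ (All.tabulate λ {γ} γ∈ → subst (_≤ toℕ (last γ)) (sym (proj₁ (π₀∈ γ∈))) z≤n)
    (All.++⁺ (All.tabulate λ γ∈ → case lView γ∈ of λ { (shape p) → proj₂ (proj₂ (proj₂ (L.linked p))) }) H.valid)

  G : List (Root B n)
  G = roots-of πs singles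

  private
    in-singles : ∀ {γ} → single γ ∈ G → γ ∈ singles
    in-singles γ∈ = subst (_ ∈_) (intervals-of πs singles) (∈-intervals⁺ γ∈)

    in-πs : ∀ {δ} → double δ ∈ G → δ ∈ πs
    in-πs δ∈ = subst (_ ∈_) (doubles-of πs singles) (∈-doubles⁺ δ∈)

  rearranges : Rearranges αs G
  rearranges = record
    { firsts-↭   = begin
        map first (intervals G)
          ≡⟨ cong (map first) (intervals-of πs singles) ⟩
        map first (π₀ ++ lIntersections ++ H)
          ≡⟨ trans (List.map-++ first π₀ links) (cong₂ _++_ firsts-π₀ (List.map-++ first lIntersections H)) ⟩
        map first fixed ++ map first lIntersections ++ map first H
          ↭⟨ Perm.++⁺ˡ (map first fixed) (Perm.++⁺ firsts-l (↭-trans H.firsts-↭ (↭-reflexive firsts-u))) ⟩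
        map first fixed ++ map first (map proj₂ lLinks) ++ map first Adm
          ≡⟨ trans (List.map-++ first fixed _) (cong (map first fixed ++_) (List.map-++ first (map proj₂ lLinks) Adm)) ⟨
        map first (fixed ++ map proj₂ lLinks ++ Adm)
          ↭⟨ Perm.map⁺ first Γ-parts ⟩
        map first Γ ∎
    ; uppers-≈   = begin
        uppers G
          ↭⟨ uppers-of πs singles ⟩
        map lastDouble πs ++ map lastᴰ πs ++ map last singles
          ≡⟨ cong (λ ts → map lastDouble πs ++ map lastᴰ πs ++ ts)
               (trans (List.map-++ last π₀ links) (cong₂ _++_ lasts-π₀ (List.map-++ last lIntersections H))) ⟩
        map lastDouble πs ++ map lastᴰ πs ++ rest ++ (map last lIntersections ++ map last H)
          ≡⟨ trans (List.++-assoc (map lastDouble πs) _ _) (cong (map lastDouble πs ++_) (List.++-assoc (map lastᴰ πs) rest _)) ⟨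
        (map lastDouble πs ++ map lastᴰ πs ++ rest) ++ (map last lIntersections ++ map last H)
          ↭⟨ Perm.++⁺ʳ _ N.elements ⟩
        T ++ (map last lIntersections ++ map last H)
          ↭⟨ all-ends ⟩
        uppers αs ∎
    ; positive   = All.++⁺ (All.map⁺ (All.map double N.positive)) (All.map⁺ (All.map single singles-valid))
    ; uncrossed  = λ γ∈ γ′∈ → singles-uncrossed (in-singles γ∈) (in-singles γ′∈)
    ; unspanned  = λ δ∈ γ∈ → unspanned′ (in-πs δ∈) (Mem.∈-++⁻ π₀ (in-singles γ∈))
    ; nested     = λ δ∈ η∈ → nested′ (in-πs δ∈) (in-πs η∈)
    ; no-doubles = λ none → case subst (_ ∈_) none (∈-doubles⁺ (head∈ (proj₂ head-double))) of λ ()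
    }
    where
    open Perm.PermutationReasoning
    head∈ : ∀ {x} {xs : List (Root B n)} → head xs ≡ just x → x ∈ xs
    head∈ {xs = _ ∷ _} refl = here refl
    unspanned′ : ∀ {δ γ} → δ ∈ πs → γ ∈ π₀ ⊎ γ ∈ links → Unspanned δ γ
    unspanned′ {δ} {γ} δ∈ (inj₁ γ∈) = let one , t∈ = π₀∈ γ∈ in record
      { clear-left  = λ m → contradiction m (unmovable {γ} one)
      ; clear-right = λ m → contradiction m (unmovable {γ} one)
      ; between     = λ _ → All.lookup (All.lookup N.inner δ∈) t∈
      }
    unspanned′ {δ} {γ} δ∈ (inj₂ γ∈) = record
      { clear-left  = λ _ → links-clear γ∈ (πs-left δ∈)
      ; clear-right = λ _ → links-clear γ∈ (πs-right δ∈)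
      ; between     = λ one → contradiction (links-movable γ∈) (unmovable {γ} one)
      }
    nested′ : ∀ {δ η} → δ ∈ πs → η ∈ πs → lastDouble δ Fin.< lastDouble η → lastᴰ η Fin.< lastᴰ δ
    nested′ δ∈ η∈ lt with allPairs-compare N.nested δ∈ η∈
    ... | inj₁ refl            = contradiction lt (ℕ.<-irrefl refl)
    ... | inj₂ (inj₁ (_ , r))  = r
    ... | inj₂ (inj₂ (lt′ , _)) = contradiction lt (ℕ.<-asym lt′)

module _ {n : ℕ} (αs : List (Root B n)) where

  open Linking αs

  valueRoots : List (Root B n)
  valueRoots = roots-of πs (π₀ ++ lIntersections ++ untangle B n (length uIntersections) uIntersections)

value-rearranges : (αs : List (Root B n)) → All IsPositive αs → AllPairs Before αs → Linked Meet αs →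
                   ∃[ δ ] head αs ≡ just (double δ) → Rearranges αs (valueRoots αs)
value-rearranges {n} αs positive ordered linked head-double =
  ValueDiagram.rearranges d nesting lasts-π₀ firsts-π₀ π₀∈ head-double
  where
  open Linking αs using (Γd; Γ; lLinks; uLinks; T; nest; π₀)

  lGreedy : LLinks.IsGreedy Γd (doubles-sorted ordered) Γ lLinks
  lGreedy = subst (LLinks.IsGreedy Γd (doubles-sorted ordered) Γ) (sym (lLinks-links αs (doubles-sorted ordered)))
                  (LLinks.links-greedy Γd (doubles-sorted ordered) Γ (intervals-sorted ordered))

  -- The head of the list is a double root, so every interval has a left neighbour.
  predecessors : (βs : List (Interval n)) → (∀ {β} → β ∈ βs → β ∈ Γ) → All (ULinks.HasPredecessor αs positive ordered) βs
  predecessors βs ⊆ = All.tabulate λ β∈ → predecessor positive ordered linked (∈-intervals⁻ (⊆ β∈))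
    λ eq → case trans (sym (proj₂ head-double)) eq of λ ()

  uGreedy : ULinks.IsGreedy αs positive ordered (filter (admissible? lLinks) Γ) uLinks
  uGreedy = ULinks.links-greedy αs positive ordered (filter (admissible? lLinks) Γ)
    (AllPairs.filter⁺ (admissible? lLinks) (intervals-sorted ordered))
    (predecessors _ λ β∈ → proj₁ (Mem.∈-filter⁻ (admissible? lLinks) {xs = Γ} β∈))

  d : LinkData αs positive ordered
  d = linkData lGreedy uGreedy

  open Value d using (T-sorted; count; fixed)

  rest : List (Fin n)
  rest = proj₂ (nest (length Γd) T)

  -- `T` from `Linking` and the one from `Value d` unfold to the same list, so the facts about the
  -- latter apply without conversion.
  nesting = nest-nesting {αs = αs} (length Γd) T T-sorted count

  fixed-initial : fixed ≡ initial Γ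
  fixed-initial = filter-initial (intervals-sorted ordered)

  length-rest : length rest ≡ length (initial Γ)
  length-rest = trans (IsNesting.length-rest nesting) (cong length fixed-initial)

  lasts-π₀ : map last π₀ ≡ rest
  lasts-π₀ = trans (cong (map last) (π₀-pick αs)) (pick-lasts Γ rest length-rest)

  firsts-π₀ : map first π₀ ≡ map first fixed
  firsts-π₀ = trans (cong (map first) (π₀-pick αs))
    (trans (pick-firsts Γ rest length-rest) (cong (map first) (sym fixed-initial)))

  π₀∈ : ∀ {γ} → γ ∈ π₀ → toℕ (first γ) ≡ 0 × last γ ∈ rest
  π₀∈ γ∈ = pick∈ Γ rest (subst (_ ∈_) (π₀-pick αs) γ∈)

module _ {n : ℕ} (αs : List (Root B n)) where

  open Linking αs

  value-reflections : Inverse.to value ≗ Inverse.to (product (map reflection (valueRoots αs)))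
  value-reflections z = sym (begin
    to (product (map reflection (valueRoots αs))) z
      ≡⟨ to-++ (map double πs) (map single singles) z ⟩
    to (product (map reflection (map double πs))) (to (product (map reflection (map single singles))) z)
      ≡⟨ cong₂ (λ σs → to (product σs)) (sym (List.map-∘ πs)) (inner z) ⟩
    to value z ∎)
    where
    open ≡-Reasoning
    open Inverse using (to)
    links = lIntersections ++ untangle B n (length uIntersections) uIntersections
    singles = π₀ ++ links
    H = untangle B n (length uIntersections) uIntersections
    to-++ : ∀ xs ys z → to (product (map reflection (xs ++ ys))) z
                      ≡ to (product (map reflection xs)) (to (product (map reflection ys)) z)
    to-++ xs ys z = trans (cong (λ σs → to (product σs) z) (List.map-++ reflection xs ys))
                          (product-++ (map reflection xs) (map reflection ys) z)
    inner : ∀ z → to (product (map reflection (map single singles))) z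
                ≡ to (reflections B n π₀) (to (reflections B n lIntersections) (to (fSingle B n (length uIntersections) uIntersections) z))
    inner z = begin
      to (product (map reflection (map single singles))) z
        ≡⟨ cong (λ σs → to (product σs) z) (List.map-∘ singles) ⟨
      to (reflections B n (π₀ ++ links)) z
        ≡⟨ reflections-++ B n π₀ links z ⟩
      to (reflections B n π₀) (to (reflections B n links) z)
        ≡⟨ cong (to (reflections B n π₀)) (reflections-++ B n lIntersections H z) ⟩
      to (reflections B n π₀) (to (reflections B n lIntersections) (to (reflections B n H) z))
        ≡⟨ cong (to (reflections B n π₀) ∘ to (reflections B n lIntersections))
             (fSingle-reflections B n (length uIntersections) uIntersections z) ⟨
      to (reflections B n π₀) (to (reflections B n lIntersections) (to (fSingle B n (length uIntersections) uIntersections) z)) ∎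

-- Gluing the connected components

open Interval
open Double renaming (last to lastᴰ)

∈-uppers : {G : List (Root B n)} {α : Root B n} → α ∈ G → ∀ {t} → t ∈ upperEnds α → t ∈ uppers G
∈-uppers α∈ t∈ = Mem.∈-concatMap⁺ upperEnds (lose α∈ t∈)

uppers-below : {αs : List (Root B n)} → All IsPositive αs → ∀ {t} → t ∈ uppers αs →
               ∃[ α ] α ∈ αs × t Fin.≤ lastIndex α
uppers-below {αs = αs} pos t∈ with find (Mem.∈-concatMap⁻ upperEnds {xs = αs} t∈)
... | α@(single _) , α∈ , here refl         = α , α∈ , ℕ.≤-refl
... | α@(double _) , α∈ , there (here refl) = α , α∈ , ℕ.≤-refl
... | α@(double _) , α∈ , here refl         = α , α∈ , (case All.lookup pos α∈ of λ { (double lt) → ℕ.<⇒≤ lt })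

-- The second case is empty because any two double roots share the term 2r_1, so a double root never
-- comes after a gap.
RootApart : Rel (Root B n) 0ℓ
RootApart α (single γ) = lastIndex α Fin.< first γ
RootApart α (double _) = ⊥

doubles-++ : (xs ys : List (Root B n)) → doubles (xs ++ ys) ≡ doubles xs ++ doubles ys
doubles-++ xs ys = List.mapMaybe-++ _ xs ys

intervals-++ : (xs ys : List (Root B n)) → intervals (xs ++ ys) ≡ intervals xs ++ intervals ys
intervals-++ xs ys = List.mapMaybe-++ _ xs ys

-- Every upper end on the left lies below every first index on the right, and both properties
-- survive the re-pairing. This excludes crossings, and it forbids first index 1 on the right, so
-- the double roots on the left satisfy `Unspanned` there too.
rearranges-++ : {αs βs G H : List (Root B n)} → All IsPositive αs → doubles βs ≡ [] →
                All (λ α → All (RootApart α) βs) αs →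
                Rearranges αs G → Rearranges βs H → Rearranges (αs ++ βs) (G ++ H)
rearranges-++ {n} {αs} {βs} {G} {H} αs-pos none apart r s = record
  { firsts-↭   = begin
      map first (intervals (G ++ H))
        ≡⟨ trans (cong (map first) (intervals-++ G H)) (List.map-++ first (intervals G) _) ⟩
      map first (intervals G) ++ map first (intervals H)
        ↭⟨ Perm.++⁺ r.firsts-↭ s.firsts-↭ ⟩
      map first (intervals αs) ++ map first (intervals βs)
        ≡⟨ trans (cong (map first) (intervals-++ αs βs)) (List.map-++ first (intervals αs) _) ⟨
      map first (intervals (αs ++ βs)) ∎
  ; uppers-≈   = begin
      uppers (G ++ H)
        ≡⟨ List.concatMap-++ upperEnds G H ⟩
      uppers G ++ uppers H
        ↭⟨ Perm.++⁺ r.uppers-≈ s.uppers-≈ ⟩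
      uppers αs ++ uppers βs
        ≡⟨ List.concatMap-++ upperEnds αs βs ⟨
      uppers (αs ++ βs) ∎
  ; positive   = All.++⁺ r.positive s.positive
  ; uncrossed  = λ p q → uncrossed′ (Mem.∈-++⁻ G p) (Mem.∈-++⁻ G q)
  ; unspanned  = λ p q → unspanned′ (Mem.∈-++⁻ G p) (Mem.∈-++⁻ G q)
  ; nested     = λ p q → r.nested (inG p) (inG q)
  ; no-doubles = λ eq → trans (doubles-++ G H)
      (cong₂ _++_ (r.no-doubles (List.++-conicalˡ _ _ (trans (sym (doubles-++ αs βs)) eq))) H-singles)
  }
  where
  module r = Rearranges r
  module s = Rearranges s
  open Perm.PermutationReasoning

  H-singles : doubles H ≡ []
  H-singles = s.no-doubles none

  inG : ∀ {δ} → double δ ∈ G ++ H → double δ ∈ G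
  inG p with Mem.∈-++⁻ G p
  ... | inj₁ q = q
  ... | inj₂ q = case subst (_ ∈_) H-singles (∈-doubles⁺ q) of λ ()

  below : ∀ {t γ} → t ∈ uppers G → single γ ∈ H → t Fin.< first γ
  below t∈ γ∈
    with α , α∈ , le ← uppers-below αs-pos (Perm.∈-resp-↭ r.uppers-≈ t∈)
    with β , β∈ , eq ← Mem.∈-map⁻ first (Perm.∈-resp-↭ s.firsts-↭ (Mem.∈-map⁺ first (∈-intervals⁺ γ∈))) =
    subst (_ Fin.<_) (sym eq) (ℕ.≤-<-trans le (All.lookup (All.lookup apart α∈) (∈-intervals⁻ β∈)))

  uncrossed′ : ∀ {γ γ′} → single γ ∈ G ⊎ single γ ∈ H → single γ′ ∈ G ⊎ single γ′ ∈ H → ¬ Crossing γ γ′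
  uncrossed′ (inj₁ p) (inj₁ q) x = r.uncrossed p q x
  uncrossed′ (inj₂ p) (inj₂ q) x = s.uncrossed p q x
  uncrossed′ (inj₁ p) (inj₂ q) (_ , le , _) = ℕ.<⇒≱ (below (∈-uppers p (here refl)) q) le
  uncrossed′ (inj₂ p) (inj₁ q) (_ , _ , lt) with single v ← All.lookup s.positive p =
    ℕ.<-asym lt (ℕ.<-≤-trans (below (∈-uppers q (here refl)) p) v)

  unspanned′ : ∀ {δ γ} → double δ ∈ G ⊎ double δ ∈ H → single γ ∈ G ⊎ single γ ∈ H → Unspanned δ γ
  unspanned′ (inj₁ p) (inj₁ q) = r.unspanned p q
  unspanned′ (inj₂ p) _        = case subst (_ ∈_) H-singles (∈-doubles⁺ p) of λ ()
  unspanned′ (inj₁ p) (inj₂ q) = record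
    { clear-left  = λ _ (le , _) → ℕ.<⇒≱ (below (∈-uppers p (here refl)) q) le
    ; clear-right = λ _ (le , _) → ℕ.<⇒≱ (below (∈-uppers p (there (here refl))) q) le
    ; between     = λ eq → contradiction (subst (_ <_) eq (below (∈-uppers p (here refl)) q)) ℕ.n≮0
    }

rearranges-root : {α : Root B n} → IsPositive α → Rearranges [ α ] [ α ]
rearranges-root pos = record
  { firsts-↭   = ↭-refl
  ; uppers-≈   = ↭-refl
  ; positive   = pos ∷ []
  ; uncrossed  = λ { (here refl) (here refl) (lt , _) → ℕ.<-irrefl refl lt }
  ; unspanned  = λ { (here refl) (here ()) }
  ; nested     = λ { (here refl) (here refl) lt → contradiction lt (ℕ.<-irrefl refl) }
  ; no-doubles = id
  }

rearranges-singles : {is H : List (Interval n)} → Untangles is H → Rearranges (map single is) (map single H)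
rearranges-singles {n} {is} {H} u = record
  { firsts-↭   = ↭-trans (↭-reflexive (cong (map first) (intervals-of [] H)))
                   (↭-trans firsts-↭ (↭-reflexive (cong (map first) (sym (intervals-of [] is)))))
  ; uppers-≈   = ↭-trans (uppers-of [] H) (↭-trans lasts-↭ (↭-sym (uppers-of [] is)))
  ; positive   = All.map⁺ (All.map single valid)
  ; uncrossed  = λ p q → uncrossed (in-H p) (in-H q)
  ; unspanned  = λ p → ⊥-elim (no-double p)
  ; nested     = λ p → ⊥-elim (no-double p)
  ; no-doubles = λ _ → doubles-of [] H
  }
  where
  open Untangles u
  in-H : ∀ {γ} → single γ ∈ map single H → γ ∈ H
  in-H p = subst (_ ∈_) (intervals-of [] H) (∈-intervals⁺ p)
  no-double : ∀ {δ} → double δ ∉ map single H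
  no-double p = case subst (_ ∈_) (doubles-of [] H) (∈-doubles⁺ p) of λ ()

-- Double roots come first in an antichain, so the head already decides between the two cases that
-- `fConnected` distinguishes by looking for double roots.
rearrangeRun : List⁺ (Root B n) → List (Root B n)
rearrangeRun     (α ∷ [])              = [ α ]
rearrangeRun     (double δ ∷ αs@(_ ∷ _)) = valueRoots (double δ ∷ αs)
rearrangeRun {n} (single γ ∷ αs@(_ ∷ _)) =
  map single (untangle B n (length (single {B} {n} γ ∷ αs)) (intervals (single γ ∷ αs)))

rearrange : List (Root B n) → List (Root B n)
rearrange αs = concatMap rearrangeRun (components meet? αs)

single-first : {αs : List (Root B n)} {γ : Interval n} → AllPairs Before (single γ ∷ αs) → doubles (single {B} γ ∷ αs) ≡ []
single-first {αs = αs} (p ∷ _) = go αs p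
  where
  go : ∀ αs → All (Before (single _)) αs → doubles αs ≡ []
  go []              []       = refl
  go (single _ ∷ αs) (_ ∷ ps) = go αs ps

fConnected-singles : (α β : Root B n) (γs : List (Root B n)) → doubles (α ∷ β ∷ γs) ≡ [] →
                     fConnected (α ∷ β ∷ γs) ≡ fSingle B n (length (α ∷ β ∷ γs)) (intervals (α ∷ β ∷ γs))
fConnected-singles α β γs eq with doubles (α ∷ β ∷ γs)
... | [] = refl

module _ {c : List⁺ (Root B n)} (positive : All IsPositive (List⁺.toList c))
         (ordered : AllPairs Before (List⁺.toList c)) where

  run-reflections : Inverse.to (fConnected c) ≗ Inverse.to (product (map reflection (rearrangeRun c)))
  run-reflections = go c ordered
    where
    go : (c : List⁺ (Root B n)) → AllPairs Before (List⁺.toList c) →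
         Inverse.to (fConnected c) ≗ Inverse.to (product (map reflection (rearrangeRun c)))
    go (single _ ∷ []) _ z = refl
    go (double _ ∷ []) _ z = refl
    go (double δ ∷ α ∷ αs) _ z = value-reflections (double δ ∷ α ∷ αs) z
    go (single γ ∷ α ∷ αs) ordered z = trans
      (cong (λ σ → Inverse.to σ z) (fConnected-singles (single γ) α αs (single-first ordered)))
      (trans (fSingle-reflections B n (length (single {B} {n} γ ∷ α ∷ αs)) (intervals (single γ ∷ α ∷ αs)) z)
             (cong (λ σs → Inverse.to (product σs) z) (List.map-∘ {g = reflection} {f = single} (untangle B n (length (single {B} {n} γ ∷ α ∷ αs)) (intervals (single γ ∷ α ∷ αs))))))

  run-rearranges : Linked Meet (List⁺.toList c) → Rearranges (List⁺.toList c) (rearrangeRun c)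
  run-rearranges = go c positive ordered
    where
    go : (c : List⁺ (Root B n)) → All IsPositive (List⁺.toList c) → AllPairs Before (List⁺.toList c) →
         Linked Meet (List⁺.toList c) → Rearranges (List⁺.toList c) (rearrangeRun c)
    go (single _ ∷ []) (p ∷ []) _ _ = rearranges-root p
    go (double _ ∷ []) (p ∷ []) _ _ = rearranges-root p
    go (double δ ∷ α ∷ αs) positive ordered linked =
      value-rearranges (double δ ∷ α ∷ αs) positive ordered linked (δ , refl)
    go (single γ ∷ α ∷ αs) positive ordered _ =
      subst (λ xs → Rearranges xs (rearrangeRun (single γ ∷ α ∷ αs)))
        (singles-only (single γ ∷ α ∷ αs) (single-first ordered))
        (rearranges-singles (untangle-untangles B n (length (single {B} {n} γ ∷ α ∷ αs)) (intervals (single γ ∷ α ∷ αs))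
          (ℕ.≤-reflexive (trans (sym (List.length-map single (intervals (single γ ∷ α ∷ αs))))
            (cong length (singles-only (single γ ∷ α ∷ αs) (single-first ordered)))))
          (intervals-valid positive) (intervals-sorted ordered)))

record _⊰_ (α β : Root B n) : Set where
  constructor ordered
  field
    before    : Before α β
    positiveˡ : IsPositive α
    positiveʳ : IsPositive β

apart : {α β : Root B n} → α ⊰ β → ¬ Meet α β → RootApart α β
apart {n} (ordered (single-single {i = i} {j} {k} {l} i<k _) _ (single k≤l)) ¬meet =
  ℕ.≰⇒> λ k≤j → ¬meet (meet-singles {B} {n} {i} {j} {k} {l} (ℕ.<⇒≤ i<k) k≤j k≤l)
apart {suc _} (ordered (double-double {j = j} {i} {l} {k} _ _) _ _) ¬meet =
  ¬meet (zero , (λ ()) , refl)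
apart {n} (ordered (double-single {j = j} {i} {k} {l} i<l) (double j<i) _) ¬meet =
  -- At its last index `i` the double root has coefficient 1, because `j < i`; an interval that
  -- starts at or below `i` shares this term.
  ℕ.≰⇒> λ k≤i → ¬meet (i , (λ eq → case trans (sym once) eq of λ ()) ,
    trans once (sym (coeff-single-1 {B} {n} {k} {l} {i} k≤i (ℕ.<⇒≤ i<l))))
  where
  once : coeff (double 2[ j ]+[ i ]) i ≡ 1
  once rewrite dec-false (i Fin.≤? j) (ℕ.<⇒≱ j<i) | dec-true (i Fin.≤? i) ℕ.≤-refl = refl

module _ {αs : List (Root B n)} (positive : All IsPositive αs) (αs-ordered : AllPairs Before αs) where

  private
    flat = flatten-components meet? αs

    runs : (cs : List (List⁺ (Root B n))) → All IsPositive (flatten cs) → AllPairs Before (flatten cs) →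
           All (λ c → All IsPositive (List⁺.toList c) × AllPairs Before (List⁺.toList c)) cs
    runs []       _   _   = []
    runs (c ∷ cs) pos ord with ord-c , ord-cs , _ ← allPairs-++⁻ (List⁺.toList c) ord =
      (All.++⁻ˡ (List⁺.toList c) pos , ord-c) ∷ runs cs (All.++⁻ʳ (List⁺.toList c) pos) ord-cs

    all-runs = runs (components meet? αs) (subst (All IsPositive) (sym flat) positive)
                                          (subst (AllPairs Before) (sym flat) αs-ordered)

  f-reflections : Inverse.to (f αs) ≗ Inverse.to (product (map reflection (rearrange αs)))
  f-reflections = product-concatMap reflection rearrangeRun (components meet? αs)
    (All.map (λ {c} (pos , ord) → run-reflections {c = c} pos ord) all-runs)

  rearrange-rearranges : Rearranges αs (rearrange αs)
  rearrange-rearranges = subst (λ xs → Rearranges xs (rearrange αs)) flat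
    (go (components meet? αs) all-runs (components-linked meet? αs)
      (components-separated meet? {_⊰_} {RootApart} apart
        (λ {α} {β} {γ} → extendˡ {α} {β} {γ}) (λ {α} {β} {γ} → extendʳ {α} {β} {γ})
        (allPairs-zipAll (λ p q r → ordered r p q) positive αs-ordered)))
    where
    extendˡ : ∀ {α β γ} → α ⊰ β → RootApart β γ → RootApart α γ
    extendˡ {γ = single _} p lt = ℕ.<-trans (before⇒last< (_⊰_.before p)) lt
    extendʳ : ∀ {α β γ} → RootApart α β → β ⊰ γ → RootApart α γ
    extendʳ {β = single _} lt (ordered (single-single i<k _) _ _) = ℕ.<-trans lt i<k
    singles-after : ∀ {α} xs → All (RootApart α) xs → doubles xs ≡ []
    singles-after []              []       = refl
    singles-after (single _ ∷ xs) (_ ∷ ps) = singles-after xs ps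
    go : (cs : List (List⁺ (Root B n))) →
         All (λ c → All IsPositive (List⁺.toList c) × AllPairs Before (List⁺.toList c)) cs →
         All (Linked Meet ∘ List⁺.toList) cs →
         AllPairs (λ c d → All (λ α → All (RootApart α) (List⁺.toList d)) (List⁺.toList c)) cs →
         Rearranges (flatten cs) (concatMap rearrangeRun cs)
    go [] _ _ _ = record
      { firsts-↭ = ↭-refl ; uppers-≈ = ↭-refl ; positive = [] ; uncrossed = λ () ; unspanned = λ ()
      ; nested = λ () ; no-doubles = λ _ → refl }
    go (c ∷ cs) ((pos , ord) ∷ ps) (linked ∷ ls) (sep ∷ seps) =
      rearranges-++ pos (singles-after {List⁺.head c} (flatten cs) (All.head far)) far
        (run-rearranges {c = c} pos ord linked) (go cs ps ls seps)
      where
      far : All (λ α → All (RootApart α) (flatten cs)) (List⁺.toList c)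
      far = All.map (All.concat⁺ ∘ All.map⁺) (All.All-swap sep)

open Interval
open Double renaming (last to lastᴰ)

-- The image of an antichain is noncrossing

pos : Point Ψ n → ℕ
pos {Ψ} {n} x = toℕ (position {Ψ} {n} x)

pos-injective : Injective _≡_ _≡_ (pos {Ψ} {n})
pos-injective {Ψ} eq = position-injective {Ψ} (Fin.toℕ-injective eq)

Uncrossed : Rel (Point Ψ n) 0ℓ → Set
Uncrossed {Ψ} {n} R = ∀ {p q r s} → pos {Ψ} {n} p < pos {Ψ} q → pos {Ψ} q < pos {Ψ} r → pos {Ψ} r < pos {Ψ} s →
                      SymClosure R p r → ¬ SymClosure R q s

module SignedDiagram {G : List (Root B n)} (positive : All IsPositive G)
  (unique-firsts : Unique (map first (intervals G)))
  (uncrossed  : ∀ {γ γ′} → single γ ∈ G → single γ′ ∈ G → ¬ Crossing γ γ′)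
  (unspanned  : ∀ {δ γ} → double δ ∈ G → single γ ∈ G → Unspanned δ γ)
  (nested     : ∀ {δ η} → double δ ∈ G → double η ∈ G → lastDouble δ Fin.< lastDouble η → lastᴰ η Fin.< lastᴰ δ)
  where

  data Straight (x : Fin n) : Fin n → Set where
    straight : ∀ {γ} → single γ ∈ G → toℕ (first γ) ≡ suc (toℕ x) → Straight x (last γ)

  data Through : Fin n → Fin n → Set where
    middle : ∀ {γ} → single γ ∈ G → toℕ (first γ) ≡ 0 → Through (last γ) (last γ)
    leftᴰ  : ∀ {δ} → double δ ∈ G → Through (lastDouble δ) (lastᴰ δ)
    rightᴰ : ∀ {δ} → double δ ∈ G → Through (lastᴰ δ) (lastDouble δ)

  -- The edges of the diagram, each read in the direction of the order
  -- 1, …, n, -1, …, -n.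
  data Chord : Rel (Point B n) 0ℓ where
    plus  : ∀ {x y} → Straight x y → Chord (Sign.+ , x) (Sign.+ , y)
    minus : ∀ {x y} → Straight x y → Chord (Sign.- , x) (Sign.- , y)
    mixed : ∀ {u v} → Through u v → Chord (Sign.+ , u) (Sign.- , v)

  through-sym : ∀ {u v} → Through u v → Through v u
  through-sym (middle γ∈ eq) = middle γ∈ eq
  through-sym (leftᴰ δ∈)     = rightᴰ δ∈
  through-sym (rightᴰ δ∈)    = leftᴰ δ∈

  straight-uncrossed : ∀ {x y z w} → Straight x y → Straight z w → x Fin.< z → z Fin.< y → ¬ y Fin.< w
  straight-uncrossed (straight γ∈ eq) (straight γ′∈ eq′) x<z z<y y<w =
    uncrossed γ∈ γ′∈ (subst₂ _<_ (sym eq) (sym eq′) (s≤s x<z) , subst (_≤ _) (sym eq′) z<y , y<w)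

  through-clear : ∀ {x y u v} → Straight x y → Through u v → x Fin.< u → ¬ u Fin.< y
  through-clear (straight γ∈ eq) (middle γ₀∈ zero-first) x<u u<y =
    uncrossed γ₀∈ γ∈ (subst₂ _<_ (sym zero-first) (sym eq) (s≤s z≤n) , subst (_≤ _) (sym eq) x<u , u<y)
  through-clear (straight γ∈ eq) (leftᴰ δ∈) x<u u<y =
    Unspanned.clear-left (unspanned δ∈ γ∈) (subst (1 ≤_) (sym eq) (s≤s z≤n)) (subst (_≤ _) (sym eq) x<u , u<y)
  through-clear (straight γ∈ eq) (rightᴰ δ∈) x<u u<y =
    Unspanned.clear-right (unspanned δ∈ γ∈) (subst (1 ≤_) (sym eq) (s≤s z≤n)) (subst (_≤ _) (sym eq) x<u , u<y)

  left<right : ∀ {δ} → double δ ∈ G → lastDouble δ Fin.< lastᴰ δ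
  left<right δ∈ with double lt ← All.lookup positive δ∈ = lt

  inside-out : ∀ {δ η} → double δ ∈ G → double η ∈ G → ¬ lastᴰ δ Fin.< lastDouble η
  inside-out δ∈ η∈ i<l = ℕ.<-asym i<l (ℕ.<-trans (left<right η∈)
    (nested δ∈ η∈ (ℕ.<-trans (left<right δ∈) i<l)))

  -- Chords from the positive to the negative half cross exactly when both ends increase. Nesting
  -- excludes this for two double roots and `between` for a double root and an arc from -j to j; two
  -- arcs of the latter kind would share first index 1.
  through-antitone : ∀ {u v u′ v′} → Through u v → Through u′ v′ → u Fin.< u′ → ¬ v Fin.< v′
  through-antitone (middle p eq) (middle q eq′) lt _
    with refl ← unique-map⇒injective unique-firsts (∈-intervals⁺ p) (∈-intervals⁺ q)
                  (Fin.toℕ-injective (trans eq (sym eq′))) = ℕ.<-irrefl refl lt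
  through-antitone (middle p eq) (leftᴰ q)  lt _  = ℕ.<-asym lt (proj₁ (Unspanned.between (unspanned q p) eq))
  through-antitone (middle p eq) (rightᴰ q) _  lt = ℕ.<-asym lt (proj₁ (Unspanned.between (unspanned q p) eq))
  through-antitone (leftᴰ p)  (middle q eq) _  lt = ℕ.<-asym lt (proj₂ (Unspanned.between (unspanned p q) eq))
  through-antitone (rightᴰ p) (middle q eq) lt _  = ℕ.<-asym lt (proj₂ (Unspanned.between (unspanned p q) eq))
  through-antitone (leftᴰ p)  (leftᴰ q)  lt lt′   = ℕ.<-asym lt′ (nested p q lt)
  through-antitone (leftᴰ p)  (rightᴰ q) _  lt′   = inside-out p q lt′
  through-antitone (rightᴰ p) (leftᴰ q)  lt _     = inside-out p q lt
  through-antitone (rightᴰ p) (rightᴰ q) lt lt′   = ℕ.<-asym lt (nested p q lt′)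

  private
    plus< : ∀ {x y : Fin n} → pos {B} (Sign.+ , x) < pos {B} {n} (Sign.+ , y) → x Fin.< y
    plus< {x} {y} = subst₂ _<_ (Fin.toℕ-↑ˡ x n) (Fin.toℕ-↑ˡ y n)

    minus< : ∀ {x y : Fin n} → pos {B} (Sign.- , x) < pos {B} {n} (Sign.- , y) → x Fin.< y
    minus< {x} {y} lt = ℕ.+-cancelˡ-< n _ _ (subst₂ _<_ (Fin.toℕ-↑ʳ n x) (Fin.toℕ-↑ʳ n y) lt)

    minus≮plus : ∀ {x y : Fin n} → ¬ pos {B} (Sign.- , x) < pos {B} {n} (Sign.+ , y)
    minus≮plus {x} {y} lt = ℕ.<⇒≱ (subst₂ _<_ (Fin.toℕ-↑ʳ n x) (Fin.toℕ-↑ˡ y n) lt)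
      (ℕ.≤-trans (ℕ.<⇒≤ (Fin.toℕ<n y)) (ℕ.m≤m+n n (toℕ x)))

    inject₁-≮ : ∀ {m} {i : Fin m} {j : Fin (suc m)} → toℕ i < toℕ j → ¬ j Fin.< inject₁ i
    inject₁-≮ {i = i} i<j j<i = ℕ.<-asym i<j (subst (_ <_) (Fin.toℕ-inject₁ i) j<i)

  chords-uncrossed : ∀ {p q r s} → pos {B} p < pos {B} q → pos {B} q < pos {B} r → pos {B} r < pos {B} s →
                     Chord p r → ¬ Chord q s
  chords-uncrossed a b c (plus p)  (plus q)  = straight-uncrossed p q (plus< a) (plus< b) (plus< c)
  chords-uncrossed a b c (plus p)  (mixed q) = through-clear p q (plus< a) (plus< b)
  chords-uncrossed a b c (minus p) (minus q) = straight-uncrossed p q (minus< a) (minus< b) (minus< c)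
  chords-uncrossed a b c (mixed p) (minus q) = through-clear q (through-sym p) (minus< b) (minus< c)
  chords-uncrossed a b c (mixed p) (mixed q) = through-antitone p q (plus< a) (minus< c)
  chords-uncrossed a b c (plus p)  (minus q) = contradiction b minus≮plus
  chords-uncrossed a b c (minus p) (plus q)  = contradiction a minus≮plus
  chords-uncrossed a b c (minus p) (mixed q) = contradiction a minus≮plus
  chords-uncrossed a b c (mixed p) (plus q)  = contradiction c minus≮plus

  private
    root-of : ∀ {x y} → Arc (allArcs G) x y → ∃[ α ] α ∈ G × (x , y) ∈ arcs α
    root-of a = find (Mem.∈-concatMap⁻ arcs {xs = G} a)

  -- In the order 1, ..., n, -1, ..., -n an arc with a negative left end runs backwards. So `fwd`
  -- leaves only arcs between positive points, and `bwd` leaves the others.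
  chord : ∀ {p r} → SymClosure (Arc (allArcs G)) p r → pos {B} p < pos {B} r → Chord p r
  chord (fwd a) lt with root-of a
  ... | single [ zero ⋯ j ]  , α∈ , here refl         = contradiction lt minus≮plus
  ... | single [ suc i ⋯ j ] , α∈ , here refl         = plus (straight α∈ (cong suc (sym (Fin.toℕ-inject₁ i))))
  ... | single [ suc i ⋯ j ] , α∈ , there (here refl) with single v ← All.lookup positive α∈ =
    contradiction (minus< lt) (inject₁-≮ v)
  chord (fwd a) lt | double _ , α∈ , here refl         = contradiction lt minus≮plus
  chord (fwd a) lt | double _ , α∈ , there (here refl) = contradiction lt minus≮plus
  chord (bwd a) lt with root-of a
  ... | single [ zero ⋯ j ]  , α∈ , here refl         = mixed (middle α∈ refl)
  ... | single [ suc i ⋯ j ] , α∈ , there (here refl) = minus (straight α∈ (cong suc (sym (Fin.toℕ-inject₁ i))))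
  ... | single [ suc i ⋯ j ] , α∈ , here refl with single v ← All.lookup positive α∈ =
    contradiction (plus< lt) (inject₁-≮ v)
  chord (bwd a) lt | double _ , α∈ , here refl         = mixed (rightᴰ α∈)
  chord (bwd a) lt | double _ , α∈ , there (here refl) = mixed (leftᴰ α∈)

  arcs-uncrossed : Uncrossed {B} (Arc (allArcs G))
  arcs-uncrossed a b c e e′ = chords-uncrossed a b c (chord e (ℕ.<-trans a b)) (chord e′ (ℕ.<-trans b c))

-- Negation exchanges the two arcs of a root, or fixes the single arc of e_j, and reverses their
-- direction.
arcs-symmetric : (G : List (Root Ψ n)) → SymmetryCondition {Ψ} (EqClosure (Arc (allArcs G)))
arcs-symmetric {A} G = tt
arcs-symmetric {B} {n} G = Eq.gfold (Eq.isEquivalence _) negate step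
  where
  back : ∀ {α x y} → α ∈ G → (x , y) ∈ arcs α → EqClosure (Arc (allArcs G)) y x
  back α∈ a = Eq.symmetric _ (Eq.return (Mem.∈-concatMap⁺ arcs (lose α∈ a)))
  step : ∀ {x y} → Arc (allArcs G) x y → EqClosure (Arc (allArcs G)) (negate x) (negate y)
  step a with find (Mem.∈-concatMap⁻ arcs {xs = G} a)
  ... | single [ zero ⋯ j ]  , α∈ , here refl         = back α∈ (here refl)
  ... | single [ suc i ⋯ j ] , α∈ , here refl         = back α∈ (there (here refl))
  ... | single [ suc i ⋯ j ] , α∈ , there (here refl) = back α∈ (here refl)
  ... | double _             , α∈ , here refl         = back α∈ (there (here refl))
  ... | double _             , α∈ , there (here refl) = back α∈ (here refl)

lowers-sorted : {αs : List (Root Ψ n)} → AllPairs Before αs → AllPairs Fin._<_ (lowers {Ψ} αs)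
lowers-sorted [] = []
lowers-sorted {A} {suc m} {single [ i ⋯ j ] ∷ αs} (p ∷ ps) =
  All.concat⁺ (All.map⁺ (All.map (λ { (single-single i<k _) →
    subst₂ _<_ (sym (Fin.toℕ-inject₁ _)) (sym (Fin.toℕ-inject₁ _)) i<k ∷ [] }) p)) ∷ lowers-sorted ps
lowers-sorted {B} {n} {single [ zero ⋯ j ] ∷ αs} (p ∷ ps) = lowers-sorted ps
lowers-sorted {B} {n} {single [ suc i ⋯ j ] ∷ αs} (p ∷ ps) =
  All.concat⁺ (All.map⁺ (All.map (λ { (single-single {k = suc k} (s≤s i<k) _) →
    subst₂ _<_ (sym (Fin.toℕ-inject₁ _)) (sym (Fin.toℕ-inject₁ _)) i<k ∷ [] }) p)) ∷ lowers-sorted ps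
lowers-sorted {B} {n} {double _ ∷ αs} (p ∷ ps) = lowers-sorted ps

sorted⇒unique : {xs : List (Fin n)} → AllPairs Fin._<_ xs → Unique xs
sorted⇒unique = AllPairs.map λ { lt refl → ℕ.<-irrefl refl lt }

uppers-unique : {αs : List (Root Ψ n)} → All IsPositive αs → AllPairs Before αs → Unique (uppers {Ψ} αs)
uppers-unique {A} _ [] = []
uppers-unique {A} {suc m} {single [ i ⋯ j ] ∷ αs} (_ ∷ pos) (p ∷ ps) =
  All.concat⁺ (All.map⁺ (All.map (λ { (single-single _ j<l) →
    (λ { refl → ℕ.<-irrefl refl j<l }) ∷ [] }) p)) ∷ uppers-unique pos ps
uppers-unique {B} {n} {αs} pos ord = ↭-unique (↭-sym (uppers-↭ αs)) (Unique.++⁺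
  (AllPairs.map⁺ (AllPairs.map (λ { (lt , _) eq → ℕ.<⇒≢ lt (cong toℕ (sym eq)) }) (doubles-sorted ord)))
  (AllPairs.map⁺ (AllPairs.map (λ x<y eq → ℕ.<⇒≢ (before⇒last< x<y) (cong toℕ eq)) ord))
  λ (p , q) → case Mem.∈-map⁻ lastDouble p , Mem.∈-map⁻ lastIndex q of λ where
    ((δ , δ∈ , refl) , (α , α∈ , eq)) → ℕ.<⇒≢ (lastDouble<last pos ord (∈-doubles⁻ δ∈) α∈) (cong toℕ eq))

nonnesting-diagram : (π : NN Ψ n) → IsDiagram (roots π)
nonnesting-diagram {Ψ} π = record
  { positive     = NN.positive π
  ; uniqueLowers = sorted⇒unique (lowers-sorted {Ψ} (nonnesting-before π))
  ; uniqueUppers = uppers-unique {Ψ} (NN.positive π) (nonnesting-before π)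
  }

-- The interface between the analysis of `f` and the theorem: everything proved about `f` from here
-- on uses only these fields, in both types alike.
record Image (π : NN Ψ n) : Set where
  field
    G         : List (Root Ψ n)
    product-G : Inverse.to (f (roots π)) ≗ Inverse.to (product (map reflection G))
    diagram   : IsDiagram G
    lowers-≈  : lowers {Ψ} G ↭ lowers {Ψ} (roots π)
    uppers-≈  : uppers {Ψ} G ↭ uppers {Ψ} (roots π)
    uncrossed : Uncrossed {Ψ} (Arc (allArcs G))

-- Sends a first index to the point where the arc starts; with first index 1 no arc starts at a
-- positive point.
moved : Fin n → Maybe (Fin n)
moved zero    = nothing
moved (suc i) = just (inject₁ i)

lowers-firsts : (G : List (Root B n)) → lowers {B} G ≡ mapMaybe moved (map first (intervals G))
lowers-firsts []                         = refl
lowers-firsts (single [ zero ⋯ j ] ∷ G)  = lowers-firsts G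
lowers-firsts (single [ suc i ⋯ j ] ∷ G) = cong (inject₁ i ∷_) (lowers-firsts G)
lowers-firsts (double _ ∷ G)             = lowers-firsts G

imageᴮ : (π : NN B n) → Image π
imageᴮ {n} π = record
  { G         = G
  ; product-G = f-reflections (NN.positive π) ord
  ; diagram   = record
    { positive     = positive
    ; uniqueLowers = ↭-unique (↭-sym lowers-≈) (IsDiagram.uniqueLowers d)
    ; uniqueUppers = ↭-unique (↭-sym uppers-≈) (IsDiagram.uniqueUppers d)
    }
  ; lowers-≈  = lowers-≈
  ; uppers-≈  = uppers-≈
  ; uncrossed = SignedDiagram.arcs-uncrossed positive
      (↭-unique (↭-sym firsts-↭) (AllPairs.map⁺ (AllPairs.map
        (λ (lt , _) eq → ℕ.<⇒≢ lt (cong toℕ eq)) (intervals-sorted ord))))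
      uncrossed unspanned nested
  }
  where
  ord = nonnesting-before π
  d   = nonnesting-diagram π
  G   = rearrange (roots π)
  open Rearranges (rearrange-rearranges (NN.positive π) ord)
  lowers-≈ : lowers {B} G ↭ lowers {B} (roots π)
  lowers-≈ = ↭-trans (↭-reflexive (lowers-firsts G))
    (↭-trans (Perm.mapMaybe-↭ moved firsts-↭) (↭-reflexive (sym (lowers-firsts (roots π)))))

module _ {m : ℕ} where

  lowersᴬ : (is : List (Interval m)) → lowers {A} {suc m} (map single is) ≡ map inject₁ (map first is)
  lowersᴬ []       = refl
  lowersᴬ (i ∷ is) = cong (_ ∷_) (lowersᴬ is)

  uppersᴬ : (is : List (Interval m)) → uppers {A} {suc m} (map single is) ≡ map suc (map last is)
  uppersᴬ []       = refl
  uppersᴬ (i ∷ is) = cong (_ ∷_) (uppersᴬ is)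

  rootsᴬ : (αs : List (Root A (suc m))) → map single (intervals αs) ≡ αs
  rootsᴬ []              = refl
  rootsᴬ (single α ∷ αs) = cong (single α ∷_) (rootsᴬ αs)

imageᴬ : ∀ {m} (π : NN A (suc m)) → Image π
imageᴬ {m} π = record
  { G         = G
  ; product-G = λ z → trans (fSingle-reflections A (suc m) (length (roots π)) is z)
      (cong (λ σs → Inverse.to (product σs) z) (List.map-∘ {g = reflection {A}} {f = single} H))
  ; diagram   = record
    { positive     = All.map⁺ (All.map single valid)
    ; uniqueLowers = ↭-unique (↭-sym lowers-≈) (IsDiagram.uniqueLowers d)
    ; uniqueUppers = ↭-unique (↭-sym uppers-≈) (IsDiagram.uniqueUppers d)
    }
  ; lowers-≈  = lowers-≈
  ; uppers-≈  = uppers-≈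
  ; uncrossed = λ {p} {q} {r} {s} → arcs-uncrossed {p} {q} {r} {s}
  }
  where
  ord = nonnesting-before π
  d   = nonnesting-diagram π
  is  = intervals (roots π)
  H   = untangle A (suc m) (length (roots π)) is
  G : List (Root A (suc m))
  G   = map single H
  open Untangles (untangle-untangles A (suc m) (length (roots π)) is
    (ℕ.≤-reflexive (trans (sym (List.length-map single is)) (cong length (rootsᴬ (roots π)))))
    (intervals-valid (NN.positive π)) (intervals-sorted ord))

  lowers-≈ : lowers {A} G ↭ lowers {A} (roots π)
  lowers-≈ = ↭-trans (↭-reflexive (lowersᴬ H)) (↭-trans (Perm.map⁺ inject₁ firsts-↭)
    (↭-reflexive (trans (sym (lowersᴬ is)) (cong (lowers {A}) (rootsᴬ (roots π))))))

  uppers-≈ : uppers {A} G ↭ uppers {A} (roots π)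
  uppers-≈ = ↭-trans (↭-reflexive (uppersᴬ H)) (↭-trans (Perm.map⁺ suc lasts-↭)
    (↭-reflexive (trans (sym (uppersᴬ is)) (cong (uppers {A}) (rootsᴬ (roots π))))))

  data ArcView : Rel (Fin (suc m)) 0ℓ where
    arc : ∀ {γ} → γ ∈ H → ArcView (inject₁ (first γ)) (suc (last γ))

  arcView : ∀ {x y} → Arc (allArcs G) x y → ArcView x y
  arcView a with find (Mem.∈-concatMap⁻ arcs {xs = G} a)
  ... | single γ , γ∈ , here refl with _ , p , refl ← Mem.∈-map⁻ single γ∈ = arc p

  chord : ∀ {p r} → SymClosure (Arc (allArcs G)) p r → p Fin.< r → ArcView p r
  chord (fwd a) _  = arcView a
  chord (bwd a) lt with arc {γ} γ∈ ← arcView a =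
    contradiction (ℕ.<-≤-trans lt (ℕ.≤-trans (ℕ.≤-reflexive (Fin.toℕ-inject₁ (first γ)))
      (ℕ.m≤n⇒m≤1+n (All.lookup valid γ∈)))) (ℕ.<-irrefl refl)

  arcs-uncrossed : Uncrossed {A} (Arc (allArcs G))
  arcs-uncrossed {p} {q} {r} {s} a b c e e′
    with arc {γ} γ∈ ← chord {p} {r} e (ℕ.<-trans a b) | arc {γ′} γ′∈ ← chord {q} {s} e′ (ℕ.<-trans b c) =
    uncrossed γ∈ γ′∈ (subst₂ _<_ (Fin.toℕ-inject₁ (first γ)) (Fin.toℕ-inject₁ (first γ′)) a ,
      ℕ.s≤s⁻¹ (subst (_< _) (Fin.toℕ-inject₁ (first γ′)) b) , ℕ.s≤s⁻¹ c)

-- Partitions drawn by a diagram, and their triples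

⇔-trans : {R S T : Rel X 0ℓ} → R ⇔ S → S ⇔ T → R ⇔ T
⇔-trans (a , b) (c , d) = (λ p → c (a p)) , (λ p → b (d p))

⇔-sym : {R S : Rel X 0ℓ} → R ⇔ S → S ⇔ R
⇔-sym (a , b) = b , a

dec-transfer : {R S : Rel X 0ℓ} → R ⇔ S → IsDecEquivalence R → IsDecEquivalence S
dec-transfer (to , from) R-equiv = record
  { isEquivalence = record
    { refl  = to R.refl
    ; sym   = λ p → to (R.sym (from p))
    ; trans = λ p q → to (R.trans (from p) (from q))
    }
  ; _≟_ = λ x y → map′ to from (x R.≟ y)
  }
  where module R = IsDecEquivalence R-equiv

Cycle : Perm (Point Ψ n) → Rel (Point Ψ n) 0ℓ
Cycle {Ψ} {n} σ = Partition._~_ (cycles {Ψ} {n} σ)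

cycle-dec : (σ : Perm (Point Ψ n)) → IsDecEquivalence (Cycle {Ψ} σ)
cycle-dec {Ψ} σ = Partition.isDecEquivalence (cycles {Ψ} σ)

record IsDrawn (R : Rel (Point Ψ n) 0ℓ) (G : List (Root Ψ n)) : Set where
  field
    dec     : IsDecEquivalence R
    diagram : IsDiagram G
    drawn   : R ⇔ EqClosure (Arc (allArcs G))

  symmetric : SymmetryCondition {Ψ} R
  symmetric = transfer {Ψ} G drawn
    where
    transfer : ∀ {Ψ} {R : Rel (Point Ψ n) 0ℓ} (G : List (Root Ψ n)) → R ⇔ EqClosure (Arc (allArcs G)) → SymmetryCondition {Ψ} R
    transfer {A} G _           = tt
    transfer {B} G (to , from) = λ p → from (arcs-symmetric G (to p))

product-drawn : {G : List (Root Ψ n)} (σ : Perm (Point Ψ n)) → Inverse.to σ ≗ Inverse.to (product (map reflection G)) →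
                IsDiagram G → IsDrawn (Cycle {Ψ} σ) G
product-drawn {Ψ} {n} {G} σ eq d = record
  { dec     = cycle-dec {Ψ} σ
  ; diagram = d
  ; drawn   = ⇔-trans
      (sameCycle-cong (position-injective {Ψ} {n}) (_≟ᴾ_ {Ψ}) σ (transpositions (_≟ᴾ_ {Ψ}) (allArcs G))
        (λ z → trans (eq z) (product-arcs G z)))
      (cycles-of-transpositions (position-injective {Ψ} {n}) (_≟ᴾ_ {Ψ}) (allArcs G) (diagram-arcs d))
  }

transpositions-step : (_≟_ : DecidableEquality X) (L : List (X × X)) (z : X) →
                      EqClosure (Arc L) z (Inverse.to (transpositions _≟_ L) z)
transpositions-step _≟_ []            z = ε
transpositions-step _≟_ ((x , y) ∷ L) z =
  Eq.map there (transpositions-step _≟_ L z) ◅◅ aux (swapView _≟_ x y _)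
  where
  aux : ∀ {z w} → SwapView x y z w → EqClosure (Arc ((x , y) ∷ L)) z w
  aux (left refl)  = Eq.return (here refl)
  aux (right refl) = Eq.symmetric _ (Eq.return (here refl))
  aux (other _ _)  = ε

swap-right : (_≟_ : DecidableEquality X) (x y : X) → swap _≟_ x y y ≡ x
swap-right _≟_ x y = trans (swap-comm _≟_ x y y) (swap-left _≟_ y x)

module _ (_≟_ : DecidableEquality X) (a b c d : X) (a≢c : a ≢ c) (a≢d : a ≢ d) (b≢c : b ≢ c) (b≢d : b ≢ d) where

  swaps-outerˡ : swap _≟_ a b (swap _≟_ c d a) ≡ b
  swaps-outerˡ = trans (cong (swap _≟_ a b) (swap-other _≟_ a≢c a≢d)) (swap-left _≟_ a b)

  swaps-outerʳ : swap _≟_ a b (swap _≟_ c d b) ≡ a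
  swaps-outerʳ = trans (cong (swap _≟_ a b) (swap-other _≟_ b≢c b≢d)) (swap-right _≟_ a b)

  swaps-innerˡ : swap _≟_ a b (swap _≟_ c d c) ≡ d
  swaps-innerˡ = trans (cong (swap _≟_ a b) (swap-left _≟_ c d)) (swap-other _≟_ (≢-sym a≢d) (≢-sym b≢d))

  swaps-innerʳ : swap _≟_ a b (swap _≟_ c d d) ≡ c
  swaps-innerʳ = trans (cong (swap _≟_ a b) (swap-right _≟_ c d)) (swap-other _≟_ (≢-sym a≢c) (≢-sym b≢c))

reflection-exchanges : {α : Root Ψ n} → IsPositive α → ∀ {x y} → (x , y) ∈ arcs α →
                       Inverse.to (reflection {Ψ} α) x ≡ y × Inverse.to (reflection {Ψ} α) y ≡ x
reflection-exchanges {A} {suc m} (single {i = i} {j} _) (here refl) =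
  swap-left Fin._≟_ (inject₁ i) (suc j) , swap-right Fin._≟_ (inject₁ i) (suc j)
reflection-exchanges {B} {n} (single {i = zero} {j} _) (here refl) =
  swap-right (_≟ᴾ_ {B} {n}) (Sign.+ , j) (Sign.- , j) , swap-left (_≟ᴾ_ {B} {n}) (Sign.+ , j) (Sign.- , j)
reflection-exchanges {B} {n} (single {i = suc i} {j} _) = λ where
    (here refl)         → swaps-outerʳ _≟_ a b c d (λ ()) (λ ()) (λ ()) (λ ()) ,
                          swaps-outerˡ _≟_ a b c d (λ ()) (λ ()) (λ ()) (λ ())
    (there (here refl)) → swaps-innerˡ _≟_ a b c d (λ ()) (λ ()) (λ ()) (λ ()) ,
                          swaps-innerʳ _≟_ a b c d (λ ()) (λ ()) (λ ()) (λ ())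
  where
  _≟_ = _≟ᴾ_ {B} {n}
  a b c d : Point B n
  a = Sign.+ , j
  b = Sign.+ , inject₁ i
  c = Sign.- , j
  d = Sign.- , inject₁ i
reflection-exchanges {B} {n} (double {j = j} {i} j<i) = λ where
    (here refl)         → swaps-outerʳ _≟_ a b c d (λ ()) a≢d b≢c (λ ()) ,
                          swaps-outerˡ _≟_ a b c d (λ ()) a≢d b≢c (λ ())
    (there (here refl)) → swaps-innerˡ _≟_ a b c d (λ ()) a≢d b≢c (λ ()) ,
                          swaps-innerʳ _≟_ a b c d (λ ()) a≢d b≢c (λ ())
  where
  _≟_ = _≟ᴾ_ {B} {n}
  a b c d : Point B n
  a = Sign.+ , i
  b = Sign.- , j
  c = Sign.- , i
  d = Sign.+ , j
  a≢d : a ≢ d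
  a≢d refl = ℕ.<-irrefl refl j<i
  b≢c : b ≢ c
  b≢c refl = ℕ.<-irrefl refl j<i

-- The block relation of an antichain comes without a decision procedure. It has the same arcs as
-- the cycles of the product of all reflections in the antichain, and decidability is taken over
-- from there.
nonnesting-drawn : (π : NN Ψ n) → IsDrawn (nonnestingBlocks π) (roots π)
nonnesting-drawn {Ψ} {n} π = record
  { dec     = dec-transfer (⇔-trans product.drawn (⇔-sym drawn)) product.dec
  ; diagram = nonnesting-diagram π
  ; drawn   = drawn
  }
  where
  module product = IsDrawn (product-drawn (product (map reflection (roots π))) (λ _ → refl) (nonnesting-diagram π))
  widen : ∀ {α} → α ∈ roots π → ∀ {x y} → (x , y) ∈ arcs α → Arc (allArcs (roots π)) x y
  widen α∈ a = Mem.∈-concatMap⁺ arcs (lose α∈ a)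
  drawn : nonnestingBlocks π ⇔ EqClosure (Arc (allArcs (roots π)))
  drawn = Eq.fold (Eq.isEquivalence _) to , Eq.map from
    where
    to : ∀ {x y} → Any (λ α → Inverse.to (reflection {Ψ} {n} α) x ≡ y × Inverse.to (reflection {Ψ} {n} α) y ≡ x) (roots π) →
         EqClosure (Arc (allArcs (roots π))) x y
    to {x} any with α , α∈ , refl , _ ← find any =
      Eq.map (widen α∈) (subst (EqClosure (Arc (arcs α)) x) (sym (reflection-arcs α x))
                               (transpositions-step (_≟ᴾ_ {Ψ}) (arcs α) x))
    from : ∀ {x y} → Arc (allArcs (roots π)) x y →
           Any (λ α → Inverse.to (reflection {Ψ} {n} α) x ≡ y × Inverse.to (reflection {Ψ} {n} α) y ≡ x) (roots π)
    from a with α , α∈ , b ← find (Mem.∈-concatMap⁻ arcs {xs = roots π} a) = lose α∈ (reflection-exchanges (All.lookup (NN.positive π) α∈) b)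

module _ {R : Rel (Point Ψ n) 0ℓ} {G : List (Root Ψ n)} (dr : IsDrawn R G) where
  open IsDrawn dr

  closer⇒∉ : ∀ {x} → Closer {Ψ} R x → x ∉ lowers {Ψ} G
  closer⇒∉ c = greatest⇒∉lowers diagram drawn (closer⇒greatest {Ψ} symmetric c)

  ∉⇒closer : ∀ {x} → x ∉ lowers {Ψ} G → Closer {Ψ} R x
  ∉⇒closer x∉ = greatest⇒closer {Ψ} dec (∉lowers⇒greatest diagram drawn x∉)

  opener⇒∉ : ∀ {x} → Opener {Ψ} R x → x ∉ uppers {Ψ} G
  opener⇒∉ o = least⇒∉uppers diagram drawn (opener⇒least {Ψ} o)

  ∉⇒opener : ∀ {x} → x ∉ uppers {Ψ} G → Opener {Ψ} R x
  ∉⇒opener x∉ = least⇒opener {Ψ} (∉uppers⇒least diagram drawn x∉)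

same-triple : {R S : Rel (Point Ψ n) 0ℓ} {G H : List (Root Ψ n)} → IsDrawn R G → IsDrawn S H →
              lowers {Ψ} G ↭ lowers {Ψ} H → uppers {Ψ} G ↭ uppers {Ψ} H → SameTriple {Ψ} R S
same-triple {Ψ} {R = R} {S} r s l u = (o , o′) , (c , c′) , (t , t′)
  where
  o : Opener {Ψ} R ⊆ Opener {Ψ} S
  o p = ∉⇒opener s (λ x∈ → opener⇒∉ r p (Perm.∈-resp-↭ (↭-sym u) x∈))
  o′ : Opener {Ψ} S ⊆ Opener {Ψ} R
  o′ p = ∉⇒opener r (λ x∈ → opener⇒∉ s p (Perm.∈-resp-↭ u x∈))
  c : Closer {Ψ} R ⊆ Closer {Ψ} S
  c p = ∉⇒closer s (λ x∈ → closer⇒∉ r p (Perm.∈-resp-↭ (↭-sym l) x∈))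
  c′ : Closer {Ψ} S ⊆ Closer {Ψ} R
  c′ p = ∉⇒closer r (λ x∈ → closer⇒∉ s p (Perm.∈-resp-↭ l x∈))
  t : Transient {Ψ} R ⊆ Transient {Ψ} S
  t (¬o , ¬c) = (λ p → ¬o (o′ p)) , (λ p → ¬c (c′ p))
  t′ : Transient {Ψ} S ⊆ Transient {Ψ} R
  t′ (¬o , ¬c) = (λ p → ¬o (o p)) , (λ p → ¬c (c p))

image : ∀ n .{{_ : NonZero n}} Ψ (π : NN Ψ n) → Image π
image zero {{}} Ψ
image (suc m) A π = imageᴬ π
image (suc m) B π = imageᴮ π

module _ {π : NN Ψ n} (im : Image π) where
  open Image im

  image-drawn : IsDrawn (Cycle {Ψ} (f (roots π))) G
  image-drawn = product-drawn (f (roots π)) product-G diagram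

  image-nc : IsNC {Ψ} {n} (cycles {Ψ} {n} (f (roots π)))
  image-nc =
    (λ a<b b<c c<d (a~c , b~d , a≁b) →
      closure-noncrossing (pos-injective {Ψ} {n}) (λ {p} {q} {r} {s} → uncrossed {p} {q} {r} {s}) a<b b<c c<d
        (proj₁ drawn a~c , proj₁ drawn b~d , λ a~b → a≁b (proj₂ drawn a~b))) ,
    symmetric
    where open IsDrawn image-drawn

  image-triple : SameTriple {Ψ} {n} (Cycle {Ψ} (f (roots π))) (nonnestingBlocks π)
  image-triple = same-triple {Ψ} image-drawn (nonnesting-drawn π) lowers-≈ uppers-≈

open Interval
open Double renaming (last to lastᴰ)

-- Antichains are determined by the endpoints of their arcs

∉⇒∈ : {xs ys : List (Fin n)} → (∀ {x} → x ∉ ys → x ∉ xs) → ∀ {x} → x ∈ xs → x ∈ ys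
∉⇒∈ {n} {ys = ys} h {x} x∈ = decidable-stable (x ∈? ys) (λ x∉ → h x∉ x∈)
  where open DecMembership (Fin._≟_ {n}) using (_∈?_)

tail-⊆ : {x : Fin n} {xs ys : List (Fin n)} → All (x Fin.<_) xs → (∀ {z} → z ∈ x ∷ xs → z ∈ x ∷ ys) →
         ∀ {z} → z ∈ xs → z ∈ ys
tail-⊆ x< g z∈ with g (there z∈)
... | here refl = contradiction (All.lookup x< z∈) (ℕ.<-irrefl refl)
... | there q   = q

sorted-≡ : {xs ys : List (Fin n)} → AllPairs Fin._<_ xs → AllPairs Fin._<_ ys →
           (∀ {x} → x ∈ xs → x ∈ ys) → (∀ {x} → x ∈ ys → x ∈ xs) → xs ≡ ys
sorted-≡ [] [] _ _ = refl
sorted-≡ [] (_ ∷ _) _ from with () ← from (here refl)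
sorted-≡ (_ ∷ _) [] to _ with () ← to (here refl)
sorted-≡ {xs = x ∷ xs} {y ∷ ys} (x< ∷ sx) (y< ∷ sy) to from with to (here refl) | from (here refl)
... | there x∈ | there y∈ = contradiction (All.lookup x< y∈) (ℕ.<-asym (All.lookup y< x∈))
... | here refl | _         = cong (x ∷_) (sorted-≡ sx sy (tail-⊆ x< to) (tail-⊆ y< from))
... | there _ | here refl = cong (x ∷_) (sorted-≡ sx sy (tail-⊆ x< to) (tail-⊆ y< from))

++-injective : {xs xs′ ys ys′ : List X} → length xs ≡ length xs′ → xs ++ ys ≡ xs′ ++ ys′ → xs ≡ xs′ × ys ≡ ys′
++-injective {xs = []}     {[]}      _   eq = refl , eq
++-injective {xs = x ∷ xs} {y ∷ xs′} len eq
  with refl ← List.∷-injectiveˡ eq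
  with refl , eq′ ← ++-injective {xs = xs} {xs′} (ℕ.suc-injective len) (List.∷-injectiveʳ eq) = refl , eq′

intervals-≡ : {is js : List (Interval N)} → map first is ≡ map first js → map last is ≡ map last js → is ≡ js
intervals-≡ {is = []}     {[]}     _  _  = refl
intervals-≡ {is = i ∷ is} {j ∷ js} eq eq′ = cong₂ _∷_
  (cong₂ [_⋯_] (List.∷-injectiveˡ eq) (List.∷-injectiveˡ eq′))
  (intervals-≡ (List.∷-injectiveʳ eq) (List.∷-injectiveʳ eq′))

doubles-≡ : {ds es : List (Double n)} → map lastDouble ds ≡ map lastDouble es → map lastᴰ ds ≡ map lastᴰ es → ds ≡ es
doubles-≡ {ds = []}     {[]}     _  _  = refl
doubles-≡ {ds = d ∷ ds} {e ∷ es} eq eq′ = cong₂ _∷_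
  (cong₂ 2[_]+[_] (List.∷-injectiveˡ eq) (List.∷-injectiveˡ eq′))
  (doubles-≡ (List.∷-injectiveʳ eq) (List.∷-injectiveʳ eq′))

-- Division by 2 with remainder. The total will be the surplus of upper over lower ends, `a` the
-- number of double roots, and `d` will tell whether first index 1 occurs.
halves : ∀ a b {d e} → d ≤ 1 → e ≤ 1 → (a + a) + d ≡ (b + b) + e → a ≡ b
halves zero    zero    _ _ _ = refl
halves (suc a) (suc b) {d} {e} d≤1 e≤1 eq = cong suc (halves a b d≤1 e≤1 (ℕ.suc-injective (ℕ.suc-injective
  (subst₂ (λ p q → suc p + d ≡ suc q + e) (ℕ.+-suc a a) (ℕ.+-suc b b) eq))))
halves zero    (suc b) {d} {e} d≤1 _ eq =
  contradiction (subst (_≤ 1) (trans eq (cong (λ p → suc p + e) (ℕ.+-suc b b))) d≤1) λ { (s≤s ()) }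
halves (suc a) zero    {d} {e} _ e≤1 eq =
  contradiction (subst (_≤ 1) (trans (sym eq) (cong (λ p → suc p + d) (ℕ.+-suc a a))) e≤1) λ { (s≤s ()) }

length-0 : {xs : List X} → length xs ≡ 0 → xs ≡ []
length-0 {xs = []} _ = refl

-- The list of first indices is recovered from its nonzero elements and
-- its length, since zero can occur only in front.
data FirstsView : ∀ {n} → List (Fin n) → Set where
  moved-only : ∀ {m} (is : List (Fin m)) → FirstsView (map suc is)
  with-zero  : ∀ {m} (is : List (Fin m)) → FirstsView (zero ∷ map suc is)
  no-firsts  : ∀ {n} → FirstsView {n} []

all-suc : ∀ {m} (fs : List (Fin (suc m))) → All (λ k → 0 < toℕ k) fs → ∃[ is ] fs ≡ map suc is
all-suc []           []       = [] , refl
all-suc (suc i ∷ fs) (_ ∷ ps) with is , refl ← all-suc fs ps = i ∷ is , refl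

firstsView : {fs : List (Fin n)} → AllPairs Fin._<_ fs → FirstsView fs
firstsView {fs = []} [] = no-firsts
firstsView {fs = zero ∷ fs} (p ∷ _) with is , refl ← all-suc fs p = with-zero is
firstsView {fs = suc k ∷ fs} (p ∷ _)
  with is , refl ← all-suc fs (All.map (ℕ.≤-<-trans z≤n) p) = moved-only (k ∷ is)

moved-suc : ∀ {m} (is : List (Fin m)) → mapMaybe moved (map suc is) ≡ map inject₁ is
moved-suc []       = refl
moved-suc (i ∷ is) = cong (inject₁ i ∷_) (moved-suc is)

zeros : {fs : List (Fin n)} → FirstsView fs → ℕ
zeros (moved-only _) = 0
zeros (with-zero _)  = 1
zeros no-firsts      = 0

zeros≤1 : {fs : List (Fin n)} (v : FirstsView fs) → zeros v ≤ 1
zeros≤1 (moved-only _) = z≤n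
zeros≤1 (with-zero _)  = s≤s z≤n
zeros≤1 no-firsts      = z≤n

length-moved : {fs : List (Fin n)} (v : FirstsView fs) → length fs ≡ zeros v + length (mapMaybe moved fs)
length-moved (moved-only is) = trans (List.length-map suc is)
  (sym (trans (cong length (moved-suc is)) (List.length-map inject₁ is)))
length-moved (with-zero is)  = cong suc (length-moved (moved-only is))
length-moved no-firsts       = refl

moved-injective : {fs gs : List (Fin n)} → AllPairs Fin._<_ fs → AllPairs Fin._<_ gs →
                  mapMaybe moved fs ≡ mapMaybe moved gs → length fs ≡ length gs → fs ≡ gs
moved-injective {fs = fs} {gs} sf sg eq len = go (firstsView sf) (firstsView sg) eq len
  where
  sucs : ∀ {m} (is js : List (Fin m)) → mapMaybe moved (map suc is) ≡ mapMaybe moved (map suc js) → map suc is ≡ map suc js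
  sucs is js eq = cong (map {B = Fin (suc _)} suc) (List.map-injective {f = inject₁} Fin.inject₁-injective {is} {js}
    (trans (sym (moved-suc is)) (trans eq (moved-suc js))))
  go : ∀ {fs gs : List (Fin _)} → FirstsView fs → FirstsView gs →
       mapMaybe moved fs ≡ mapMaybe moved gs → length fs ≡ length gs → fs ≡ gs
  go no-firsts       v               eq len = sym (length-0 (sym len))
  go v               no-firsts       eq len = length-0 len
  go (moved-only is) (moved-only js) eq len = sucs is js eq
  go (with-zero is)  (with-zero js)  eq len = cong (zero ∷_) (sucs is js eq)
  go v@(moved-only is) w@(with-zero js) eq len = contradiction
    (trans (sym (length-moved v)) (trans len (length-moved w))) λ q → ℕ.1+n≢n (trans (sym q) (cong length eq))
  go v@(with-zero is) w@(moved-only js) eq len = contradiction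
    (trans (sym (length-moved v)) (trans len (length-moved w))) λ q → ℕ.1+n≢n (trans q (cong length (sym eq)))

allPairs-reverse : {R : Rel X 0ℓ} {xs : List X} → AllPairs R xs → AllPairs (flip R) (reverse xs)
allPairs-reverse [] = []
allPairs-reverse {R = R} {x ∷ xs} (p ∷ ps) = subst (AllPairs (flip R)) (sym (List.unfold-reverse x xs))
  (AllPairs.++⁺ (allPairs-reverse ps) ([] ∷ [])
    (All.tabulate λ y∈ → All.lookup p (Perm.∈-resp-↭ (Perm.↭-reverse xs) y∈) ∷ []))

-- The upper ends in increasing order: last double indices decrease along an antichain, last indices
-- increase, and the former all lie below the latter.
sortedUppers : List (Root B n) → List (Fin n)
sortedUppers αs = reverse (map lastDouble (doubles αs)) ++ map lastIndex αs

sortedUppers-↭ : (αs : List (Root B n)) → sortedUppers αs ↭ uppers αs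
sortedUppers-↭ αs = ↭-trans (Perm.++⁺ʳ (map lastIndex αs) (Perm.↭-reverse (map lastDouble (doubles αs))))
                            (↭-sym (uppers-↭ αs))

sortedUppers-sorted : {αs : List (Root B n)} → All IsPositive αs → AllPairs Before αs →
                      AllPairs Fin._<_ (sortedUppers αs)
sortedUppers-sorted {αs = αs} pos ord = AllPairs.++⁺
  (allPairs-reverse (AllPairs.map⁺ (AllPairs.map proj₁ (doubles-sorted ord))))
  (AllPairs.map⁺ (AllPairs.map before⇒last< ord))
  (All.tabulate λ p → All.tabulate λ q →
    case Mem.∈-map⁻ lastDouble (Perm.∈-resp-↭ (Perm.↭-reverse (map lastDouble (doubles αs))) p) , Mem.∈-map⁻ lastIndex q of λ where
      ((δ , δ∈ , refl) , (α , α∈ , refl)) → lastDouble<last pos ord (∈-doubles⁻ δ∈) α∈)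

SameElements : Rel (List X) 0ℓ
SameElements xs ys = (∀ {x} → x ∈ xs → x ∈ ys) × (∀ {x} → x ∈ ys → x ∈ xs)

↭-sameElements : {xs ys xs′ ys′ : List X} → xs′ ↭ xs → ys′ ↭ ys → SameElements xs ys → SameElements xs′ ys′
↭-sameElements p q (to , from) =
  (λ x∈ → Perm.∈-resp-↭ (↭-sym q) (to (Perm.∈-resp-↭ p x∈))) ,
  (λ x∈ → Perm.∈-resp-↭ (↭-sym p) (from (Perm.∈-resp-↭ q x∈)))

module _ {αs βs : List (Root B n)} (pos-α : All IsPositive αs) (ord-α : AllPairs Before αs)
         (pos-β : All IsPositive βs) (ord-β : AllPairs Before βs)
         (same-lowers : lowers {B} αs ≡ lowers {B} βs) (same-uppers : sortedUppers αs ≡ sortedUppers βs) where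

  private
    fα = map first (intervals αs)
    fβ = map first (intervals βs)

    sorted-firsts : {γs : List (Root B n)} → AllPairs Before γs → AllPairs Fin._<_ (map first (intervals γs))
    sorted-firsts ord = AllPairs.map⁺ (AllPairs.map proj₁ (intervals-sorted ord))

    moved-same : mapMaybe moved fα ≡ mapMaybe moved fβ
    moved-same = trans (sym (lowers-firsts αs)) (trans same-lowers (lowers-firsts βs))

    vα = firstsView (sorted-firsts ord-α)
    vβ = firstsView (sorted-firsts ord-β)

    length-uppers : {γs : List (Root B n)} (ord : AllPairs Before γs) → length (sortedUppers γs) ≡
      ((length (doubles γs) + length (doubles γs)) + zeros (firstsView (sorted-firsts ord))) +
      length (mapMaybe moved (map first (intervals γs)))
    length-uppers {γs} ord = begin
      length (sortedUppers γs)
        ≡⟨ trans (List.length-++ (reverse (map lastDouble (doubles γs))))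
             (cong₂ _+_ (trans (List.length-reverse (map lastDouble (doubles γs))) (List.length-map lastDouble (doubles γs)))
                        (List.length-map lastIndex γs)) ⟩
      length (doubles γs) + length γs
        ≡⟨ cong (λ xs → length (doubles γs) + length xs) (roots-split ord) ⟨
      length (doubles γs) + length (roots-of (doubles γs) (intervals γs))
        ≡⟨ cong (λ m → length (doubles γs) + m) (trans (List.length-++ (map double (doubles γs)))
             (cong₂ _+_ (List.length-map double (doubles γs)) (List.length-map single (intervals γs)))) ⟩
      length (doubles γs) + (length (doubles γs) + length (intervals γs))
        ≡⟨ ℕ.+-assoc (length (doubles γs)) _ _ ⟨
      (length (doubles γs) + length (doubles γs)) + length (intervals γs)
        ≡⟨ cong (λ m → (length (doubles γs) + length (doubles γs)) + m)
             (trans (sym (List.length-map first (intervals γs))) (length-moved (firstsView (sorted-firsts ord)))) ⟩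
      (length (doubles γs) + length (doubles γs)) + (zeros (firstsView (sorted-firsts ord)) + length (mapMaybe moved (map first (intervals γs))))
        ≡⟨ ℕ.+-assoc (length (doubles γs) + length (doubles γs)) _ _ ⟨
      ((length (doubles γs) + length (doubles γs)) + zeros (firstsView (sorted-firsts ord))) + length (mapMaybe moved (map first (intervals γs))) ∎
      where open ≡-Reasoning

    balance : (length (doubles αs) + length (doubles αs)) + zeros vα ≡ (length (doubles βs) + length (doubles βs)) + zeros vβ
    balance = ℕ.+-cancelʳ-≡ (length (mapMaybe moved fα)) _ _
      (trans (sym (length-uppers ord-α)) (trans (cong length same-uppers)
        (trans (length-uppers ord-β) (cong (λ ms → ((length (doubles βs) + length (doubles βs)) + zeros vβ) + length ms) (sym moved-same)))))

    same-doubles : length (doubles αs) ≡ length (doubles βs)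
    same-doubles = halves _ _ (zeros≤1 vα) (zeros≤1 vβ) balance

    same-zeros : zeros vα ≡ zeros vβ
    same-zeros = ℕ.+-cancelˡ-≡ (length (doubles αs) + length (doubles αs)) _ _
      (trans balance (cong (λ m → (m + m) + zeros vβ) (sym same-doubles)))

    firsts-≡ : fα ≡ fβ
    firsts-≡ = moved-injective (sorted-firsts ord-α) (sorted-firsts ord-β) moved-same
      (trans (length-moved vα) (trans (cong₂ (λ z ms → z + length ms) same-zeros moved-same) (sym (length-moved vβ))))

    lasts-split : {γs : List (Root B n)} → AllPairs Before γs → map lastIndex γs ≡ map lastᴰ (doubles γs) ++ map last (intervals γs)
    lasts-split {γs} ord = trans (cong (map lastIndex) (sym (roots-split ord))) (lastIndices-of (doubles γs) (intervals γs))

    parts₁ = ++-injective {xs = reverse (map lastDouble (doubles αs))} {reverse (map lastDouble (doubles βs))}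
      (trans (List.length-reverse (map lastDouble (doubles αs))) (trans (List.length-map lastDouble (doubles αs))
        (trans same-doubles (sym (trans (List.length-reverse (map lastDouble (doubles βs))) (List.length-map lastDouble (doubles βs)))))))
      same-uppers

    parts₂ = ++-injective {xs = map lastᴰ (doubles αs)} {map lastᴰ (doubles βs)}
      (trans (List.length-map lastᴰ (doubles αs)) (trans same-doubles (sym (List.length-map lastᴰ (doubles βs)))))
      (trans (sym (lasts-split ord-α)) (trans (proj₂ parts₁) (lasts-split ord-β)))

  -- The numbers of ends give the number of double roots and whether first index 1 occurs. The
  -- former says where to cut the sorted upper ends into last double indices, last indices of double
  -- roots and last indices of intervals; the latter whether to put `zero` in front of the first
  -- indices read off from the lower ends.
  roots-determinedᴮ : αs ≡ βs
  roots-determinedᴮ = trans (sym (roots-split ord-α)) (trans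
    (cong₂ roots-of (doubles-≡ (List.reverse-injective (proj₁ parts₁)) (proj₁ parts₂))
                    (intervals-≡ firsts-≡ (proj₂ parts₂)))
    (roots-split ord-β))

uppers-sortedᴬ : {αs : List (Root A n)} → AllPairs Before αs → AllPairs Fin._<_ (uppers {A} αs)
uppers-sortedᴬ [] = []
uppers-sortedᴬ {suc m} {single [ i ⋯ j ] ∷ αs} (p ∷ ps) =
  All.concat⁺ (All.map⁺ (All.map (λ { (single-single _ j<l) → s≤s j<l ∷ [] }) p)) ∷ uppers-sortedᴬ ps

roots-determined : (π ρ : NN Ψ n) → SameElements (lowers {Ψ} (roots π)) (lowers {Ψ} (roots ρ)) →
                   SameElements (uppers {Ψ} (roots π)) (uppers {Ψ} (roots ρ)) → roots π ≡ roots ρ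
roots-determined {B} π ρ (lto , lfrom) same-u =
  let uto , ufrom = ↭-sameElements (sortedUppers-↭ (roots π)) (sortedUppers-↭ (roots ρ)) same-u
  in roots-determinedᴮ (NN.positive π) (nonnesting-before π) (NN.positive ρ) (nonnesting-before ρ)
       (sorted-≡ (lowers-sorted {B} (nonnesting-before π)) (lowers-sorted {B} (nonnesting-before ρ)) lto lfrom)
       (sorted-≡ (sortedUppers-sorted (NN.positive π) (nonnesting-before π))
                 (sortedUppers-sorted (NN.positive ρ) (nonnesting-before ρ)) uto ufrom)
roots-determined {A} {zero} π ρ _ _ = trans (none (roots π)) (sym (none (roots ρ)))
  where
  none : (αs : List (Root A 0)) → αs ≡ []
  none [] = refl
  none (single [ () ⋯ _ ] ∷ _)
roots-determined {A} {suc m} π ρ (lto , lfrom) (uto , ufrom) =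
  trans (sym (rootsᴬ (roots π))) (trans (cong (map single) (intervals-≡
    (List.map-injective Fin.inject₁-injective (trans (lowers-firstsᴬ (roots π)) (trans
      (sorted-≡ (lowers-sorted {A} (nonnesting-before π)) (lowers-sorted {A} (nonnesting-before ρ)) lto lfrom)
      (sym (lowers-firstsᴬ (roots ρ))))))
    (List.map-injective Fin.suc-injective (trans (uppers-lastsᴬ (roots π)) (trans
      (sorted-≡ (uppers-sortedᴬ (nonnesting-before π)) (uppers-sortedᴬ (nonnesting-before ρ)) uto ufrom)
      (sym (uppers-lastsᴬ (roots ρ))))))))
  (rootsᴬ (roots ρ)))
  where
  lowers-firstsᴬ : (αs : List (Root A (suc m))) → map inject₁ (map first (intervals αs)) ≡ lowers {A} αs
  lowers-firstsᴬ αs = trans (sym (lowersᴬ (intervals αs))) (cong (lowers {A}) (rootsᴬ αs))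
  uppers-lastsᴬ : (αs : List (Root A (suc m))) → map suc (map last (intervals αs)) ≡ uppers {A} αs
  uppers-lastsᴬ αs = trans (sym (uppersᴬ (intervals αs))) (cong (uppers {A}) (rootsᴬ αs))

f-injective : {π ρ : NN Ψ n} → Image π → Image ρ → Cycle {Ψ} (f (roots π)) ⇔ Cycle {Ψ} (f (roots ρ)) → π ≈ᴺᴺ ρ
f-injective {Ψ} {n} {π} {ρ} im jm R⇔S = roots-determined π ρ
    (∉⇒∈ (lower im jm (⇔-sym R⇔S)) , ∉⇒∈ (lower jm im R⇔S))
    (∉⇒∈ (upper im jm (⇔-sym R⇔S)) , ∉⇒∈ (upper jm im R⇔S))
  where
  open IsDrawn
  lower : {π ρ : NN Ψ n} (im : Image π) (jm : Image ρ) → Cycle {Ψ} (f (roots ρ)) ⇔ Cycle {Ψ} (f (roots π)) →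
          ∀ {x} → x ∉ lowers {Ψ} (roots ρ) → x ∉ lowers {Ψ} (roots π)
  lower im jm (to , from) x∉ x∈ = greatest⇒∉lowers (diagram (image-drawn im)) (drawn (image-drawn im))
    (λ y p → ∉lowers⇒greatest (diagram (image-drawn jm)) (drawn (image-drawn jm))
       (λ q → x∉ (Perm.∈-resp-↭ (Image.lowers-≈ jm) q)) y (from p))
    (Perm.∈-resp-↭ (↭-sym (Image.lowers-≈ im)) x∈)
  upper : {π ρ : NN Ψ n} (im : Image π) (jm : Image ρ) → Cycle {Ψ} (f (roots ρ)) ⇔ Cycle {Ψ} (f (roots π)) →
          ∀ {x} → x ∉ uppers {Ψ} (roots ρ) → x ∉ uppers {Ψ} (roots π)
  upper im jm (to , from) x∉ x∈ = least⇒∉uppers (diagram (image-drawn im)) (drawn (image-drawn im))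
    (λ y p → ∉uppers⇒least (diagram (image-drawn jm)) (drawn (image-drawn jm))
       (λ q → x∉ (Perm.∈-resp-↭ (Image.uppers-≈ jm) q)) y (from p))
    (Perm.∈-resp-↭ (↭-sym (Image.uppers-≈ im)) x∈)

-- Noncrossing partitions are determined by their openers and closers

searchable : Searchable (Point Ψ n)
searchable {A} P? = Fin.any? P?
searchable {B} {n} {P} P? = map′ to from (Fin.any? (λ k → P? (Sign.+ , k)) ⊎-dec Fin.any? (λ k → P? (Sign.- , k)))
  where
  to : (∃[ k ] P (Sign.+ , k)) ⊎ (∃[ k ] P (Sign.- , k)) → ∃ P
  to = [ (λ (k , p) → (Sign.+ , k) , p) , (λ (k , p) → (Sign.- , k) , p) ]′
  from : ∃ P → (∃[ k ] P (Sign.+ , k)) ⊎ (∃[ k ] P (Sign.- , k))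
  from ((Sign.+ , k) , p) = inj₁ (k , p)
  from ((Sign.- , k) , p) = inj₂ (k , p)

level : ∀ Ψ → Fin n → ℕ
level Ψ x = height {Ψ} (point {Ψ = Ψ} x)

level-injective : ∀ Ψ → Injective _≡_ _≡_ (level {n} Ψ)
level-injective A eq = height-injective {A} eq
level-injective B {x} {y} eq = cong proj₂ (height-injective {B} {_} {Sign.+ , x} {Sign.+ , y} eq)

level⇒pos : ∀ Ψ {x y : Fin n} → level Ψ x < level Ψ y → pos {Ψ} (point {Ψ = Ψ} x) < pos {Ψ} (point {Ψ = Ψ} y)
level⇒pos A lt = lt
level⇒pos {n} B {x} {y} lt = subst₂ _<_ (sym (Fin.toℕ-↑ˡ x n)) (sym (Fin.toℕ-↑ˡ y n)) (ℕ.+-cancelˡ-< n _ _ lt)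

plus<minus : (x y : Fin n) → pos {B} (Sign.+ , x) < pos {B} {n} (Sign.- , y)
plus<minus {n} x y = subst₂ _<_ (sym (Fin.toℕ-↑ˡ x n)) (sym (Fin.toℕ-↑ʳ n y))
  (ℕ.<-≤-trans (Fin.toℕ<n x) (ℕ.m≤m+n n (toℕ y)))

data Raised {Ψ n} : Point Ψ n → Set where
  raised : ∀ y → Raised (point {Ψ = Ψ} y)

above-point : ∀ {Ψ} {x : Fin n} (y : Point Ψ n) → level Ψ x < height {Ψ} y → Raised {Ψ} y
above-point {Ψ = A} y _ = raised y
above-point {Ψ = B} (Sign.+ , y) _ = raised y
above-point {Ψ = B} {x} (Sign.- , y) lt = contradiction lt (ℕ.<-asym (negative-below y x))

module NoncrossingPartition {Ψ : Series} {n : ℕ} {_~_ : Rel (Point Ψ n) 0ℓ} (~-dec : IsDecEquivalence _~_)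
                            (noncrossing : Noncrossing {Ψ} _~_) (symm : SymmetryCondition {Ψ} _~_) where

  private module ~ = IsDecEquivalence ~-dec

  open Adjacency (height-injective {Ψ} {n}) (searchable {Ψ}) ~-dec public
    using (Adjacent; adjacent-arcs; generated)
    renaming (successor to nextAbove; predecessor to nextBelow)

  merge-crossing : ∀ {a b c d} → pos {Ψ} {n} a < pos {Ψ} b → pos {Ψ} b < pos {Ψ} c → pos {Ψ} c < pos {Ψ} d →
                   a ~ c → b ~ d → a ~ b
  merge-crossing {a} {b} {c} {d} a<b b<c c<d a~c b~d = decidable-stable (a ~.≟ b) λ a≁b →
    noncrossing {a} {b} {c} {d} a<b b<c c<d (a~c , b~d , a≁b)

  HasLower HasUpper : Pred (Fin n) 0ℓ
  HasLower x = ∃[ y ] point {Ψ = Ψ} x ~ y × height {Ψ} y < level Ψ x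
  HasUpper x = ∃[ y ] point {Ψ = Ψ} x ~ y × level Ψ x < height {Ψ} y

  hasLower? : Decidable HasLower
  hasLower? x = searchable {Ψ} λ y → (point {Ψ = Ψ} x ~.≟ y) ×-dec (height {Ψ} y ℕ.<? level Ψ x)

  hasUpper? : Decidable HasUpper
  hasUpper? x = searchable {Ψ} λ y → (point {Ψ = Ψ} x ~.≟ y) ×-dec (level Ψ x ℕ.<? height {Ψ} y)

  ¬least : ∀ {x} → HasLower x → ¬ Least {Ψ} _~_ x
  ¬least (y , x~y , lt) l = ℕ.<⇒≱ lt (l y x~y)

  ¬hasLower : ∀ {x} → ¬ HasLower x → Least {Ψ} _~_ x
  ¬hasLower ¬p y x~y = ℕ.≮⇒≥ λ lt → ¬p (y , x~y , lt)

  ¬greatest : ∀ {x} → HasUpper x → ¬ Greatest {Ψ} _~_ x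
  ¬greatest (y , x~y , lt) g = ℕ.<⇒≱ lt (g y x~y)

  ¬hasUpper : ∀ {x} → ¬ HasUpper x → Greatest {Ψ} _~_ x
  ¬hasUpper ¬p y x~y = ℕ.≮⇒≥ λ lt → ¬p (y , x~y , lt)

  Next : Rel (Fin n) 0ℓ
  Next x y = Adjacent (point {Ψ = Ψ} x) (point {Ψ = Ψ} y)

  next : ∀ {x} → HasUpper x → ∃ (Next x)
  next {x} (y , x~y , lt) with z , adj ← nextAbove x~y lt with above-point {Ψ = Ψ} {x = x} z (proj₁ adj)
  ... | raised z′ = z′ , adj

  next⇒hasUpper : ∀ {x y} → Next x y → HasUpper x
  next⇒hasUpper (lt , x~y , _) = _ , x~y , lt

  next⇒hasLower : ∀ {x y} → Next x y → HasLower y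
  next⇒hasLower (lt , x~y , _) = _ , ~.sym x~y , lt

  next-arcs : IsArcSystem (level Ψ) Next
  next-arcs = record
    { increasing = proj₁
    ; functional = λ {x} {y} {z} p q → point-injective Ψ (IsArcSystem.functional adjacent-arcs {point {Ψ = Ψ} x} p q)
    ; injective  = λ {x} {y} {z} p q → point-injective Ψ (IsArcSystem.injective adjacent-arcs {z = point {Ψ = Ψ} z} p q)
    }
    where
    point-injective : ∀ Ψ {x y : Fin n} → point {Ψ = Ψ} x ≡ point {Ψ = Ψ} y → x ≡ y
    point-injective A refl = refl
    point-injective B refl = refl

  next-matching : {Q : Pred (Fin n) 0ℓ} → Q ⊆ HasLower → HasLower ⊆ Q → IsMatching (level Ψ) Q Next
  next-matching {Q} Q⇒ ⇒Q = record
    { isArcSystem = next-arcs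
    ; target      = λ p → ⇒Q (next⇒hasLower p)
    ; uncrossed   = λ {x} {y} {z} {w} (_ , x~y , gap) (_ , z~w , _) x<z z<y y<w →
        gap (point {Ψ = Ψ} z) (merge-crossing (level⇒pos Ψ x<z) (level⇒pos Ψ z<y) (level⇒pos Ψ y<w) x~y z~w , x<z , z<y)
    ; covered     = λ p q x<b b<y → covered Ψ refl p (Q⇒ q) x<b b<y
    }
    where
    covered : ∀ Ψ′ → Ψ′ ≡ Ψ → ∀ {x y b} → Next x y → HasLower b → level Ψ x < level Ψ b → level Ψ b < level Ψ y →
              ∃[ z ] Next z b
    covered A refl p (z , b~z , lt) x<b b<y = nextBelow (~.sym b~z) lt
    covered B refl {x} {y} {b} (_ , x~y , gap) (z , b~z , lt) x<b b<y with nextBelow (~.sym b~z) lt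
    ... | (Sign.+ , w) , adj = w , adj
    -- In the order 1, ..., n, -1, ..., -n the points are `x`, `b`, `y`, -w. Noncrossing merges the
    -- two blocks, and then `b` lies between the neighbours `x` and `y`.
    ... | (Sign.- , w) , (_ , w~b , _) = contradiction
      (merge-crossing (level⇒pos B {x} {b} x<b) (level⇒pos B {b} {y} b<y) (plus<minus y w) x~y (~.sym w~b) , x<b , b<y)
      (gap (point {Ψ = B} b))

-- `M u v` stands for an arc from -u to v: symmetric by invariance under negation, antitone because
-- such arcs do not cross.
record IsReversal (M : Rel (Fin n) 0ℓ) : Set where
  field
    symmetric  : ∀ {u v} → M u v → M v u
    functional : ∀ {u v w} → M u v → M u w → v ≡ w
    antitone   : ∀ {u v u′ v′} → M u v → M u′ v′ → u Fin.< u′ → v′ Fin.< v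

module _ {n : ℕ} where

  private
    -- If u has partners v < v′ for M and M′, then the partner of v′ for M is
    -- smaller than u.
    agree : {M M′ : Rel (Fin n) 0ℓ} → IsReversal M → IsReversal M′ →
            (∀ {u} → ∃ (M u) → ∃ (M′ u)) → (∀ {u} → ∃ (M′ u) → ∃ (M u)) →
            ∀ {u} → (∀ {w v} → w Fin.< u → M w v → M′ w v) → (∀ {w v} → w Fin.< u → M′ w v → M w v) →
            ∀ {v} → M u v → M′ u v
    agree {M} {M′} r r′ to from {u} ih ih′ {v} uMv with v′ , uMv′ ← to (v , uMv)
      with ℕ.<-cmp (toℕ v) (toℕ v′)
    ... | tri≈ _ eq _ = subst (M′ u) (sym (Fin.toℕ-injective eq)) uMv′
    ... | tri< v<v′ _ _ with w , v′Mw ← from (u , IsReversal.symmetric r′ uMv′)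
      with w<u ← IsReversal.antitone r (IsReversal.symmetric r uMv) v′Mw v<v′ =
      contradiction w<u (ℕ.<-irrefl (cong toℕ (IsReversal.functional r′
        (IsReversal.symmetric r′ (ih w<u (IsReversal.symmetric r v′Mw))) (IsReversal.symmetric r′ uMv′))))
    ... | tri> _ _ v′<v
      with w , vMw ← to (u , IsReversal.symmetric r uMv)
      with w<u ← IsReversal.antitone r′ (IsReversal.symmetric r′ uMv′) vMw v′<v =
      contradiction w<u (ℕ.<-irrefl (cong toℕ (IsReversal.functional r
        (IsReversal.symmetric r (ih′ w<u (IsReversal.symmetric r′ vMw))) (IsReversal.symmetric r uMv))))

  reversal-unique : {M M′ : Rel (Fin n) 0ℓ} → IsReversal M → IsReversal M′ →
                    (∀ {u} → ∃ (M u) → ∃ (M′ u)) → (∀ {u} → ∃ (M′ u) → ∃ (M u)) → M ⇒ M′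
  reversal-unique {M} {M′} r r′ to from {u} = proj₁ (go (suc (toℕ u)) u ℕ.≤-refl)
    where
    go : ∀ k u → toℕ u < k → (∀ {v} → M u v → M′ u v) × (∀ {v} → M′ u v → M u v)
    go (suc k) u (s≤s u≤k) =
      agree r r′ to from (λ w<u → proj₁ (go k _ (ℕ.<-≤-trans w<u u≤k))) (λ w<u → proj₂ (go k _ (ℕ.<-≤-trans w<u u≤k))) ,
      agree r′ r from to (λ w<u → proj₂ (go k _ (ℕ.<-≤-trans w<u u≤k))) (λ w<u → proj₁ (go k _ (ℕ.<-≤-trans w<u u≤k)))

negate-height : {x y : Point B n} → height {B} x < height {B} y → height {B} (negate y) < height {B} (negate x)
negate-height {n} {x} {y} lt = ℕ.≰⇒> λ le → ℕ.<⇒≱ lt (subst₂ (λ a b → height {B} {n} a ≤ height {B} b)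
  (negate² y) (negate² x) (≤±⇒height {x = negate (negate y)} {negate (negate x)}
    (negate-≤± {x = negate x} {negate y} (height⇒≤± {x = negate x} {negate y} le))))
  where
  negate² : (z : Point B n) → negate (negate z) ≡ z
  negate² (Sign.+ , _) = refl
  negate² (Sign.- , _) = refl

module SignedPartition {n : ℕ} {_~_ : Rel (Point B n) 0ℓ} (~-dec : IsDecEquivalence _~_)
                       (noncrossing : Noncrossing {B} _~_) (symm : SymmetryCondition {B} _~_) where

  open NoncrossingPartition {B} ~-dec noncrossing symm public
  private module ~ = IsDecEquivalence ~-dec

  private
    negate² : (z : Point B n) → negate (negate z) ≡ z
    negate² (Sign.+ , _) = refl
    negate² (Sign.- , _) = refl

  negate-adjacent : ∀ {x y} → Adjacent x y → Adjacent (negate y) (negate x)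
  negate-adjacent {x} {y} (lt , x~y , gap) =
    negate-height {n} {x} {y} lt , symm (~.sym x~y) , λ z (y~z , lo , hi) →
      gap (negate z) (~.trans x~y (subst (_~ negate z) (negate² y) (symm y~z)) ,
        subst (λ w → height {B} w < height {B} (negate z)) (negate² x) (negate-height {n} {z} {negate x} hi) ,
        subst (λ w → height {B} (negate z) < height {B} w) (negate² y) (negate-height {n} {negate y} {z} lo))

  Across : Rel (Fin n) 0ℓ
  Across u v = Adjacent (Sign.- , u) (Sign.+ , v)

  -- If both ends increased, `v`, `v′`, -u, -u′ would be crossing positions. Noncrossing then puts
  -- `v` into the block of `v′`, strictly between the neighbours -u′ and `v′`.
  across-reversal : IsReversal Across
  across-reversal = record
    { symmetric  = negate-adjacent
    ; functional = λ {u} p q → cong proj₂ (IsArcSystem.functional adjacent-arcs {Sign.- , u} p q)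
    ; antitone   = antitone
    }
    where
    antitone : ∀ {u v u′ v′} → Across u v → Across u′ v′ → u Fin.< u′ → v′ Fin.< v
    antitone {u} {v} {u′} {v′} p@(_ , u~v , _) q@(_ , u′~v′ , gap) u<u′ with ℕ.<-cmp (toℕ v′) (toℕ v)
    ... | tri< lt _ _ = lt
    ... | tri≈ _ eq _ with refl ← Fin.toℕ-injective eq
      with refl ← IsArcSystem.injective adjacent-arcs {z = Sign.+ , v} p q = contradiction u<u′ (ℕ.<-irrefl refl)
    ... | tri> _ _ v<v′ = contradiction
      (~.trans u′~v′ (~.sym (merge-crossing {Sign.+ , v} {Sign.+ , v′} {Sign.- , u} {Sign.- , u′}
         (level⇒pos B {v} {v′} (ℕ.+-monoʳ-< n v<v′)) (plus<minus v′ u)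
         (subst₂ _<_ (sym (Fin.toℕ-↑ʳ n u)) (sym (Fin.toℕ-↑ʳ n u′)) (ℕ.+-monoʳ-< n u<u′))
         (~.sym u~v) (~.sym u′~v′))) ,
       negative-below u′ v , ℕ.+-monoʳ-< n v<v′)
      (gap (Sign.+ , v))

  -- Some arc ends at `v`, and it does not start at a positive point. Thus the domain of `Across` is
  -- known as soon as `HasLower` and `Next` are.
  across : ∀ {v} → HasLower v → (∀ x → ¬ Next x v) → ∃ (Across v)
  across (y , v~y , lt) ¬next with nextBelow (~.sym v~y) lt
  ... | (Sign.+ , x) , adj = contradiction adj (¬next x)
  ... | (Sign.- , u) , adj = u , negate-adjacent adj

  across⇒hasLower : ∀ {u v} → Across u v → HasLower u
  across⇒hasLower p with lt , u~v , _ ← negate-adjacent p = _ , ~.sym u~v , lt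

  across⇒¬next : ∀ {u v x} → Across u v → ¬ Next x u
  across⇒¬next {u} p q with () ← IsArcSystem.injective adjacent-arcs {z = Sign.+ , u} (negate-adjacent p) q

-- The arcs between positive points form a matching fixed by its endpoints, and those between
-- negative points are their mirror images. The remaining arcs form a reversal, whose domain depends
-- only on the lower ends and on the arcs already identified.
nc-unique : {R S : Rel (Point Ψ n) 0ℓ} → IsDecEquivalence R → Noncrossing {Ψ} R → SymmetryCondition {Ψ} R →
            IsDecEquivalence S → Noncrossing {Ψ} S → SymmetryCondition {Ψ} S →
            (∀ {x} → Greatest {Ψ} R x → Greatest {Ψ} S x) → (∀ {x} → Greatest {Ψ} S x → Greatest {Ψ} R x) →
            (∀ {x} → Least {Ψ} R x → Least {Ψ} S x) → (∀ {x} → Least {Ψ} S x → Least {Ψ} R x) → R ⇒ S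
nc-unique {Ψ} {n} {R} {S} R-dec R-nc R-symm S-dec S-nc S-symm g g′ l l′ p =
  Eq.fold (IsDecEquivalence.isEquivalence S-dec) (adjacent Ψ refl) (proj₁ R.generated p)
  where
  module R = NoncrossingPartition {Ψ} R-dec R-nc R-symm
  module S = NoncrossingPartition {Ψ} S-dec S-nc S-symm

  lowerRS : R.HasLower ⊆ S.HasLower
  lowerRS {x} p = decidable-stable (S.hasLower? x) λ ¬q → R.¬least p (l′ (S.¬hasLower ¬q))
  lowerSR : S.HasLower ⊆ R.HasLower
  lowerSR {x} p = decidable-stable (R.hasLower? x) λ ¬q → S.¬least p (l (R.¬hasLower ¬q))
  upperRS : R.HasUpper ⊆ S.HasUpper
  upperRS {x} p = decidable-stable (S.hasUpper? x) λ ¬q → R.¬greatest p (g′ (S.¬hasUpper ¬q))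
  upperSR : S.HasUpper ⊆ R.HasUpper
  upperSR {x} p = decidable-stable (R.hasUpper? x) λ ¬q → S.¬greatest p (g (R.¬hasUpper ¬q))

  R-matching = R.next-matching {R.HasLower} id id
  S-matching = S.next-matching {R.HasLower} lowerRS lowerSR

  next⇒ : R.Next ⇒ S.Next
  next⇒ = matching-unique (level-injective Ψ) R-matching S-matching
    (λ (_ , q) → R.next (upperSR (S.next⇒hasUpper q))) (λ (_ , q) → S.next (upperRS (R.next⇒hasUpper q)))
  next⇐ : S.Next ⇒ R.Next
  next⇐ = matching-unique (level-injective Ψ) S-matching R-matching
    (λ (_ , q) → S.next (upperRS (R.next⇒hasUpper q))) (λ (_ , q) → R.next (upperSR (S.next⇒hasUpper q)))

  adjacent : ∀ Ψ′ → Ψ′ ≡ Ψ → R.Adjacent ⇒ S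
  adjacent A refl q = proj₁ (proj₂ (next⇒ q))
  adjacent B refl {Sign.+ , x} {Sign.+ , y} q = proj₁ (proj₂ (next⇒ q))
  adjacent B refl {Sign.- , x} {Sign.- , y} q =
    S-symm (IsDecEquivalence.sym S-dec (proj₁ (proj₂ (next⇒ (R±.negate-adjacent q)))))
    where module R± = SignedPartition R-dec R-nc R-symm
  adjacent B refl {Sign.+ , x} {Sign.- , y} (lt , _) = contradiction lt (ℕ.<-asym (negative-below y x))
  adjacent B refl {Sign.- , x} {Sign.+ , y} q = proj₁ (proj₂ (reversal-unique R±.across-reversal S±.across-reversal
      (λ (_ , m) → S±.across (lowerRS (R±.across⇒hasLower m)) (λ x s → R±.across⇒¬next m (next⇐ s)))
      (λ (_ , m) → R±.across (lowerSR (S±.across⇒hasLower m)) (λ x s → S±.across⇒¬next m (next⇒ s))) q))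
    where
    module R± = SignedPartition R-dec R-nc R-symm
    module S± = SignedPartition S-dec S-nc S-symm

open Interval
open Double renaming (last to lastᴰ)

-- Antichains with given endpoints

unique-⊆⇒length≤ : {xs ys : List X} → Unique xs → (∀ {x} → x ∈ xs → x ∈ ys) → length xs ≤ length ys
unique-⊆⇒length≤ {xs = []}     _        _  = z≤n
unique-⊆⇒length≤ {xs = x ∷ xs} {ys} (x∉ ∷ u) to with us , vs , refl ← Mem.∈-∃++ (to (here refl)) =
  subst (suc (length xs) ≤_) (sym (trans (List.length-++ us) (trans (ℕ.+-suc (length us) (length vs))
    (cong suc (sym (List.length-++ us))))))
    (s≤s (unique-⊆⇒length≤ u λ {z} z∈ → case Mem.∈-++⁻ us (to (there z∈)) of λ where
      (inj₁ p)           → Mem.∈-++⁺ˡ p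
      (inj₂ (here refl)) → contradiction refl (All.lookup x∉ z∈)
      (inj₂ (there p))   → Mem.∈-++⁺ʳ us p))

module _ {R : X → Y → Set} (injective : ∀ {x x′ y} → R x y → R x′ y → x ≡ x′) where

  -- Lists the images of `xs` under one choice of partners, so that counting by `unique-⊆⇒length≤`
  -- applies.
  transversal : {xs : List X} → Unique xs → (∀ {x} → x ∈ xs → ∃ (R x)) →
                ∃[ ys ] length ys ≡ length xs × Unique ys × (∀ {y} → y ∈ ys → ∃[ x ] x ∈ xs × R x y)
  transversal {[]} _ _ = [] , refl , [] , λ ()
  transversal {x ∷ xs} (x∉ ∷ u) total
    with ys , len , v , back ← transversal u (λ p → total (there p)) | y , xRy ← total (here refl) =
    y ∷ ys , cong suc len ,
    All.tabulate (λ z∈ → λ { refl → let x′ , x′∈ , x′Rz = back z∈ in All.lookup x∉ x′∈ (injective xRy x′Rz) }) ∷ v ,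
    λ where
      (here refl) → x , here refl , xRy
      (there z∈)  → let x′ , x′∈ , r = back z∈ in x′ , there x′∈ , r

-- An increasing injection of as into bs makes the k-th largest element
-- of as smaller than the k-th largest of bs.
dominated : {R : Rel (Fin n) 0ℓ} {bs : List (Fin n)} → (∀ {x x′ y} → R x y → R x′ y → x ≡ x′) →
            (∀ {x y} → R x y → x Fin.< y) → (∀ {x y} → R x y → y ∈ bs) → AllPairs Fin._<_ bs →
            {as : List (Fin n)} → AllPairs Fin._<_ as → (∀ {a} → a ∈ as → ∃ (R a)) →
            ∃[ front ] ∃[ back ] bs ≡ front ++ back × Pointwise Fin._<_ as back
dominated {bs = bs} inj inc target bs< [] total = bs , [] , sym (List.++-identityʳ bs) , []
dominated {bs = bs} inj inc target bs< {a ∷ as} as<@(a< ∷ as<′) total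
  with front , back , refl , pw ← dominated inj inc target bs< as<′ (λ p → total (there p))
  with ys , len , u , source ← transversal inj (sorted⇒unique as<) total
  with initLast front
... | [] = contradiction (unique-⊆⇒length≤ u (λ y∈ → target (proj₂ (proj₂ (source y∈)))))
             (ℕ.<⇒≱ (subst (length back <_) (sym len) (s≤s (ℕ.≤-reflexive (sym (Pointwise.Pointwise-length pw))))))
... | fr ∷ʳ′ b with ℕ.<-≤-connex (toℕ a) (toℕ b)
...   | inj₁ a<b = fr , b ∷ back , List.++-assoc fr [ b ] back , a<b ∷ pw
-- Otherwise the images of `a ∷ as` all exceed `a`, hence `b`, and lie in `back`, which is one
-- element too short.
...   | inj₂ b≤a = contradiction (unique-⊆⇒length≤ u late)
             (ℕ.<⇒≱ (subst (length back <_) (sym len) (s≤s (ℕ.≤-reflexive (sym (Pointwise.Pointwise-length pw))))))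
  where
  above-a : ∀ {y} → y ∈ ys → a Fin.< y
  above-a y∈ with source y∈
  ... | x , here refl , r = inc r
  ... | x , there x∈  , r = ℕ.<-trans (All.lookup a< x∈) (inc r)
  fr<b : ∀ {y} → y ∈ fr → y Fin.< b
  fr<b y∈ = All.head (All.lookup (proj₂ (proj₂ (allPairs-++⁻ fr (proj₁ (allPairs-++⁻ (fr ∷ʳ b) bs<))))) y∈)
  late : ∀ {y} → y ∈ ys → y ∈ back
  late y∈ with Mem.∈-++⁻ (fr ∷ʳ b) (target (proj₂ (proj₂ (source y∈))))
  ... | inj₂ p = p
  ... | inj₁ p with Mem.∈-++⁻ fr p
  ...   | inj₁ q           = contradiction (ℕ.<-trans (above-a y∈) (fr<b q)) (ℕ.≤⇒≯ b≤a)
  ...   | inj₂ (here refl) = contradiction (above-a y∈) (ℕ.≤⇒≯ b≤a)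

record HasEnds (Ψ : Series) {n} (as bs : List (Fin n)) : Set where
  field
    π        : NN Ψ n
    lowers-≈ : lowers {Ψ} (roots π) ↭ as
    uppers-≈ : uppers {Ψ} (roots π) ↭ bs

lower : ∀ {m} {a b : Fin (suc m)} → a Fin.< b → ∃[ i ] inject₁ i ≡ a
lower {m} {a} {b} a<b = Fin.fromℕ< a<m , Fin.toℕ-injective (trans (Fin.toℕ-inject₁ _) (Fin.toℕ-fromℕ< a<m))
  where
  a<m : toℕ a < m
  a<m = ℕ.<-≤-trans a<b (ℕ.s≤s⁻¹ (Fin.toℕ<n b))

intervalsᴬ : ∀ {m} {as bs : List (Fin (suc m))} → Pointwise Fin._<_ as bs →
             ∃[ is ] map inject₁ (map first is) ≡ as × map suc (map last is) ≡ bs × All Valid is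
intervalsᴬ [] = [] , refl , refl , []
intervalsᴬ {bs = suc j ∷ _} (a<b ∷ pw) with i , refl ← lower a<b | is , refl , refl , valid ← intervalsᴬ pw =
  [ i ⋯ j ] ∷ is , refl , refl , subst (_≤ toℕ j) (Fin.toℕ-inject₁ i) (ℕ.s≤s⁻¹ a<b) ∷ valid

intervalsᴮ : ∀ {m} {as bs : List (Fin (suc m))} → Pointwise Fin._<_ as bs →
             ∃[ ks ] ∃[ is ] map inject₁ ks ≡ as × map first is ≡ map suc ks × map last is ≡ bs × All Valid is
intervalsᴮ [] = [] , [] , refl , refl , refl , []
intervalsᴮ {bs = b ∷ _} (a<b ∷ pw)
  with i , refl ← lower a<b | ks , is , refl , eq , refl , valid ← intervalsᴮ pw =
  i ∷ ks , [ suc i ⋯ b ] ∷ is , refl , cong (suc i ∷_) eq , refl ,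
  subst (_< toℕ b) (Fin.toℕ-inject₁ i) a<b ∷ valid

sorted-intervals : {is : List (Interval N)} → AllPairs Fin._<_ (map first is) → AllPairs Fin._<_ (map last is) →
                   AllPairs _⊏_ is
sorted-intervals p q = AllPairs.zip (AllPairs.map⁻ p , AllPairs.map⁻ q)

inject₁-sorted⁻ : ∀ {m} {ks : List (Fin m)} → AllPairs Fin._<_ (map inject₁ ks) → AllPairs Fin._<_ ks
inject₁-sorted⁻ p = AllPairs.map (subst₂ _<_ (Fin.toℕ-inject₁ _) (Fin.toℕ-inject₁ _)) (AllPairs.map⁻ p)

hasEndsᴬ : ∀ {m} {as bs : List (Fin (suc m))} → AllPairs Fin._<_ as → AllPairs Fin._<_ bs → Pointwise Fin._<_ as bs →
           HasEnds A as bs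
hasEndsᴬ {m} as< bs< pw with is , refl , refl , valid ← intervalsᴬ pw = record
  { π        = antichainOf (map single is) (All.map⁺ (All.map single valid))
      (AllPairs.map⁺ (AllPairs.map (uncurry single-single)
        (sorted-intervals (inject₁-sorted⁻ as<) (AllPairs.map ℕ.s<s⁻¹ (AllPairs.map⁻ bs<)))))
  ; lowers-≈ = ↭-reflexive (lowersᴬ is)
  ; uppers-≈ = ↭-reflexive (uppersᴬ is)
  }

data Halved {X : Set} : List X → Set where
  even : ∀ ℓ ts → length ts ≡ ℓ + ℓ → Halved ts
  odd  : ∀ ℓ ts t → length ts ≡ ℓ + ℓ → Halved (ts ∷ʳ t)

halved : (xs : List X) → Halved xs
halved []       = even 0 [] refl
halved (x ∷ []) = odd 0 [] x refl
halved (x ∷ y ∷ xs) with halved xs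
... | even ℓ ts len  = even (suc ℓ) (x ∷ y ∷ ts) (cong suc (trans (cong suc len) (sym (ℕ.+-suc ℓ ℓ))))
... | odd ℓ ts t len = odd (suc ℓ) (x ∷ y ∷ ts) t (cong suc (trans (cong suc len) (sym (ℕ.+-suc ℓ ℓ))))

module _ {m : ℕ} where

  -- The cutting of `sortedUppers` read backwards: `ts` is paired from the outside in to double
  -- roots, `es` holds the last index of a possible root with first index 1, and `back` is paired in
  -- order with the lower ends.
  hasEndsᴮ′ : {as : List (Fin (suc m))} (ts : List (Fin (suc m))) {es back : List (Fin (suc m))} (ℓ : ℕ) →
              length ts ≡ ℓ + ℓ → length es ≤ 1 → AllPairs Fin._<_ as → AllPairs Fin._<_ (ts ++ es ++ back) →
              Pointwise Fin._<_ as back → HasEnds B as (ts ++ es ++ back)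
  hasEndsᴮ′ ts {es} {back} ℓ len len-es as< bs< pw
    with ks , is , refl , firsts-is , refl , valid ← intervalsᴮ pw = record
    { π        = antichainOf αs positive ordered′
    ; lowers-≈ = ↭-reflexive (trans (lowers-firsts αs) (trans (cong (λ js → mapMaybe moved (map first js)) (intervals-of ds (es′ ++ is))) moved-es))
    ; uppers-≈ = begin
        uppers αs
          ↭⟨ uppers-of ds (es′ ++ is) ⟩
        map lastDouble ds ++ map lastᴰ ds ++ map last (es′ ++ is)
          ≡⟨ cong (λ xs → map lastDouble ds ++ map lastᴰ ds ++ xs) lasts-es ⟩
        map lastDouble ds ++ map lastᴰ ds ++ (es ++ map last is)
          ≡⟨ List.++-assoc (map lastDouble ds) (map lastᴰ ds) _ ⟨
        (map lastDouble ds ++ map lastᴰ ds) ++ (es ++ map last is)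
          ↭⟨ Perm.++⁺ʳ (es ++ map last is) ends ⟩
        ts ++ (es ++ map last is) ∎
    }
    where
    open Perm.PermutationReasoning
    ts< = allPairs-++⁻ ts bs<
    ps = proj₁ (Linking.nest {suc m} [] ℓ ts)
    module N = IsNesting (nest-nesting {αs = []} ℓ ts (proj₁ ts<) (trans len (sym (ℕ.+-identityʳ (ℓ + ℓ)))))
    -- `nest` produces the outermost pair, with the largest last index, first; antichains are listed
    -- by increasing last index.
    ds : List (Double (suc m))
    ds = reverse ps
    es′ : List (Interval (suc m))
    es′ = map (λ t → [ zero ⋯ t ]) es
    αs : List (Root B (suc m))
    αs = roots-of ds (es′ ++ is)

    ends : map lastDouble ds ++ map lastᴰ ds ↭ ts
    ends = ↭-trans (Perm.++⁺ (Perm.map⁺ lastDouble (Perm.↭-reverse ps)) (Perm.map⁺ lastᴰ (Perm.↭-reverse ps)))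
      (↭-trans (↭-reflexive (cong (map lastDouble ps ++_) (trans (sym (List.++-identityʳ (map lastᴰ ps)))
        (cong (map lastᴰ ps ++_) (sym (length-0 N.length-rest)))))) N.elements)

    es-lasts : ∀ es → map last (map (λ (t : Fin (suc m)) → [ zero ⋯ t ]) es) ≡ es
    es-lasts []       = refl
    es-lasts (t ∷ es) = cong (t ∷_) (es-lasts es)

    es-firsts : ∀ es → mapMaybe moved (map first (map (λ (t : Fin (suc m)) → [ zero {m} ⋯ t ]) es)) ≡ []
    es-firsts []       = refl
    es-firsts (t ∷ es) = es-firsts es

    lasts-es : map last (es′ ++ is) ≡ es ++ map last is
    lasts-es = trans (List.map-++ last es′ is) (cong (_++ map last is) (es-lasts es))

    moved-es : mapMaybe moved (map first (es′ ++ is)) ≡ map inject₁ ks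
    moved-es = trans (cong (mapMaybe moved) (List.map-++ first es′ is))
      (trans (List.mapMaybe-++ moved (map first es′) (map first is))
        (trans (cong₂ _++_ (es-firsts es) (cong (mapMaybe moved) firsts-is)) (moved-suc ks)))

    firsts-sorted : AllPairs Fin._<_ (map first (es′ ++ is))
    firsts-sorted = subst (AllPairs Fin._<_) (sym (trans (List.map-++ first es′ is) (cong (map first es′ ++_) firsts-is)))
      (go es len-es)
      where
      sucs : AllPairs Fin._<_ (map suc ks)
      sucs = AllPairs.map⁺ (AllPairs.map s≤s (inject₁-sorted⁻ as<))
      go : ∀ es → length es ≤ 1 → AllPairs Fin._<_ (map first (map (λ (t : Fin (suc m)) → [ zero {m} ⋯ t ]) es) ++ map suc ks)
      go []          _ = sucs
      go (t ∷ [])    _ = All.map⁺ (All.universal (λ _ → s≤s z≤n) ks) ∷ sucs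
      go (_ ∷ _ ∷ _) (s≤s ())

    positive : All IsPositive αs
    positive = All.++⁺ (All.map⁺ (All.map double (Perm.All-resp-↭ (↭-sym (Perm.↭-reverse ps)) N.positive)))
      (All.map⁺ (All.map single (All.++⁺ (All.map⁺ (All.universal (λ _ → z≤n) es)) valid)))

    ordered′ : AllPairs Before αs
    ordered′ = AllPairs.++⁺
      (AllPairs.map⁺ (AllPairs.map (uncurry double-double) (allPairs-reverse N.nested)))
      (AllPairs.map⁺ (AllPairs.map (uncurry single-single)
        (sorted-intervals firsts-sorted (subst (AllPairs Fin._<_) (sym lasts-es) (proj₁ (proj₂ ts<))))))
      (All.map⁺ (All.tabulate λ δ∈ → All.map⁺ (All.tabulate λ γ∈ → double-single
        (All.lookup (All.lookup (proj₂ (proj₂ ts<)) (Perm.∈-resp-↭ ends (Mem.∈-++⁺ʳ (map lastDouble ds) (Mem.∈-map⁺ lastᴰ δ∈))))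
          (subst (_ ∈_) lasts-es (Mem.∈-map⁺ last γ∈))))))

  hasEndsᴮ : {as : List (Fin (suc m))} (front : List (Fin (suc m))) {back : List (Fin (suc m))} →
             AllPairs Fin._<_ as → AllPairs Fin._<_ (front ++ back) → Pointwise Fin._<_ as back →
             HasEnds B as (front ++ back)
  hasEndsᴮ {as} front {back} as< bs< pw with halved front
  ... | even ℓ ts len = hasEndsᴮ′ ts {[]} ℓ len z≤n as< bs< pw
  ... | odd ℓ ts t len = subst (HasEnds B as) (sym (List.++-assoc ts [ t ] back))
    (hasEndsᴮ′ ts {[ t ]} ℓ len (s≤s z≤n) as< (subst (AllPairs Fin._<_) (List.++-assoc ts [ t ] back) bs<) pw)

module _ {Ψ : Series} {m : ℕ} (ρ : NC Ψ (suc m)) where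

  private
    _~_ = Partition._~_ (NC.partition ρ)
    ~-dec = Partition.isDecEquivalence (NC.partition ρ)
    open NoncrossingPartition {Ψ} {suc m} ~-dec (proj₁ (NC.isNC ρ)) (proj₂ (NC.isNC ρ))

    as bs : List (Fin (suc m))
    as = filter hasUpper? (allFin (suc m))
    bs = filter hasLower? (allFin (suc m))

    allFin-sorted : AllPairs Fin._<_ (allFin (suc m))
    allFin-sorted = AllPairs.tabulate⁺-< id

    as< : AllPairs Fin._<_ as
    as< = AllPairs.filter⁺ hasUpper? allFin-sorted
    bs< : AllPairs Fin._<_ bs
    bs< = AllPairs.filter⁺ hasLower? allFin-sorted

    level⇒< : ∀ Ψ {x y : Fin (suc m)} → level Ψ x < level Ψ y → x Fin.< y
    level⇒< A lt = lt
    level⇒< B lt = ℕ.+-cancelˡ-< (suc m) _ _ lt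

    as∈ : ∀ {x} → x ∈ as → HasUpper x
    as∈ x∈ = proj₂ (Mem.∈-filter⁻ hasUpper? {xs = allFin (suc m)} x∈)
    bs∈ : ∀ {x} → x ∈ bs → HasLower x
    bs∈ x∈ = proj₂ (Mem.∈-filter⁻ hasLower? {xs = allFin (suc m)} x∈)
    ∈as : ∀ {x} → HasUpper x → x ∈ as
    ∈as = Mem.∈-filter⁺ hasUpper? (Mem.∈-allFin _)
    ∈bs : ∀ {x} → HasLower x → x ∈ bs
    ∈bs = Mem.∈-filter⁺ hasLower? (Mem.∈-allFin _)

    open IsArcSystem next-arcs using (injective; functional; increasing)

    domination : ∃[ front ] ∃[ back ] bs ≡ front ++ back × Pointwise Fin._<_ as back
    domination = dominated injective (λ p → level⇒< Ψ (increasing p)) (λ p → ∈bs (next⇒hasLower p)) bs< as< (λ a∈ → next (as∈ a∈))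

    hasEnds : HasEnds Ψ as bs
    hasEnds with front , back , eq , pw ← domination = go Ψ refl front eq pw
      where
      go : ∀ Ψ′ → Ψ′ ≡ Ψ → ∀ front {back} → bs ≡ front ++ back → Pointwise Fin._<_ as back → HasEnds Ψ as bs
      go B refl front eq pw =
        subst (HasEnds B as) (sym eq) (hasEndsᴮ front as< (subst (AllPairs Fin._<_) eq bs<) pw)
      -- In type A every point with something below it in its block is preceded by a point with
      -- something above it. So `bs` is no longer than `as`, and `front` is empty.
      go A refl front {back} eq pw with xs , len , u , source ← transversal (λ p q → functional p q)
        (sorted⇒unique bs<) (λ {b} b∈ → let y , b~y , lt = bs∈ b∈ in nextBelow (IsDecEquivalence.sym ~-dec b~y) lt) = hasEndsᴬ as< bs<
          (subst (Pointwise Fin._<_ as) (trans (cong (_++ back) (sym (length-0 front-empty))) (sym eq)) pw)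
        where
        bs≤as : length bs ≤ length as
        bs≤as = subst (_≤ length as) len (unique-⊆⇒length≤ u λ x∈ → ∈as (next⇒hasUpper (proj₂ (proj₂ (source x∈)))))
        front-empty : length front ≡ 0
        front-empty = ℕ.n≤0⇒n≡0 (ℕ.+-cancelʳ-≤ (length back) (length front) 0
          (subst₂ _≤_ (trans (cong length eq) (List.length-++ front)) (Pointwise.Pointwise-length pw) bs≤as))

  -- The arcs of the chosen antichain, and hence those of its image, start and end at the same
  -- positive points as the arcs of `ρ`. So both partitions have the same greatest and least points,
  -- and `nc-unique` identifies them.
  preimage : Σ[ π ∈ NN Ψ (suc m) ] (Image π → Cycle {Ψ} (f (roots π)) ⇔ _~_)
  preimage = π , λ im → same im
    where
    open HasEnds hasEnds
    module _ (im : Image π) where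
      open IsDrawn (image-drawn im)
      private module im = Image im

      greatest⇒ : ∀ {x} → Greatest {Ψ} (Cycle {Ψ} (f (roots π))) x → Greatest {Ψ} _~_ x
      greatest⇒ g = ¬hasUpper λ p → greatest⇒∉lowers diagram drawn g
        (Perm.∈-resp-↭ (↭-sym (↭-trans im.lowers-≈ lowers-≈)) (∈as p))
      greatest⇐ : ∀ {x} → Greatest {Ψ} _~_ x → Greatest {Ψ} (Cycle {Ψ} (f (roots π))) x
      greatest⇐ g = ∉lowers⇒greatest diagram drawn λ x∈ →
        ¬greatest (as∈ (Perm.∈-resp-↭ (↭-trans im.lowers-≈ lowers-≈) x∈)) g
      least⇒ : ∀ {x} → Least {Ψ} (Cycle {Ψ} (f (roots π))) x → Least {Ψ} _~_ x
      least⇒ l = ¬hasLower λ p → least⇒∉uppers diagram drawn l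
        (Perm.∈-resp-↭ (↭-sym (↭-trans im.uppers-≈ uppers-≈)) (∈bs p))
      least⇐ : ∀ {x} → Least {Ψ} _~_ x → Least {Ψ} (Cycle {Ψ} (f (roots π))) x
      least⇐ l = ∉uppers⇒least diagram drawn λ x∈ →
        ¬least (bs∈ (Perm.∈-resp-↭ (↭-trans im.uppers-≈ uppers-≈) x∈)) l

      same : Cycle {Ψ} (f (roots π)) ⇔ _~_
      same = nc-unique {Ψ} dec (proj₁ (image-nc im)) symmetric ~-dec (proj₁ (NC.isNC ρ)) (proj₂ (NC.isNC ρ))
               greatest⇒ greatest⇐ least⇒ least⇐ ,
             nc-unique {Ψ} ~-dec (proj₁ (NC.isNC ρ)) (proj₂ (NC.isNC ρ)) dec (proj₁ (image-nc im)) symmetric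
               greatest⇐ greatest⇒ least⇐ least⇒

-- Surjectivity concerns every antichain with the same roots as the chosen one, and `_≈ᴺᴺ_` compares
-- the root lists alone.
cycle-resp : {R : Rel (Point Ψ n) 0ℓ} {αs βs : List (Root Ψ n)} → βs ≡ αs →
             Cycle {Ψ} (f αs) ⇔ R → Cycle {Ψ} (f βs) ⇔ R
cycle-resp refl R⇔ = R⇔

theorem3p4 : (n : ℕ) .{{_ : NonZero n}} (Ψ : Series) →
    Σ[ nc ∈ ((π : NN Ψ n) → IsNC {Ψ} {n} (cycles {Ψ} {n} (f (roots π)))) ]
    Bijective _≈ᴺᴺ_ _≈ᴺᶜ_ (λ π → mkNC (cycles {Ψ} {n} (f (roots π))) (nc π))
    × ((π : NN Ψ n) →
    SameTriple {Ψ} {n} (Partition._~_ (cycles {Ψ} {n} (f (roots π)))) (nonnestingBlocks π))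
theorem3p4 zero {{}} Ψ
theorem3p4 n@(suc m) Ψ =
  (λ π → image-nc (image n Ψ π)) ,
  ((λ {π} {ρ} same → f-injective (image n Ψ π) (image n Ψ ρ) same) ,
   λ ρ → proj₁ (preimage ρ) ,
     λ {σ} eq → cycle-resp {Ψ} {αs = roots (proj₁ (preimage ρ))} eq
                  (proj₂ (preimage ρ) (image n Ψ (proj₁ (preimage ρ))))) ,
  λ π → image-triple (image n Ψ π)
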